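{- There exists a constant $C>0$ such that for all integers $n\ge2$ and $\ell$ with $1\le\ell<n$, there exists an $\ell$-covering set of $\mathbb{Z}_n$ of size at most $C\,\frac{n\log n}{\ell}$; that is, $f(n,\ell)\le C\,\frac{n\log n}{\ell}$.
   Context: For integers $n\ge 2$ and $\ell\ge0$, a set $B\subseteq\mathbb{Z}_n$ is an $\ell$-covering set if $\{ab\bmod n: 0\le a\le\ell,\ b\in B\}=\mathbb{Z}_n$, and $f(n,\ell)$ is the minimum size of an $\ell$-covering set of $\mathbb{Z}_n$. Convention: $\log x$ denotes $\max(\ln x,1)$. -}

module Defs where

open import Data.Nat as ℕ using (ℕ; zero; suc; NonZero)
import Data.Nat.Properties as ℕₚ
open import Data.Nat.DivMod using (_mod_; m<n⇒m%n≡m; m%n<n)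
import Data.Nat.Solver as ℕS
open import Data.Integer as ℤ using (+_; +[1+_]; -[1+_])
import Data.Integer.Properties as ℤₚ
open import Data.Rational renaming (NonZero to NonZeroℚ)
open import Data.Rational.Properties
import Data.Rational.Unnormalised as ℚᵘ
import Data.Rational.Unnormalised.Properties as ℚᵘₚ
import Data.Rational.Solver as ℚS
open import Data.Fin as Fin using (Fin; toℕ)
import Data.Fin.Properties as Finₚ
open import Data.Fin.Subset as Subset using (Subset; _∈_)
open import Data.Fin.Subset.Properties using (_∈?_; ∈⊤; anySubset?)
open import Data.Product using (∃; ∃-syntax; _×_; _,_; proj₁; proj₂)
open import Data.Sum using (inj₁; inj₂)
open import Data.Empty using (⊥-elim)
open import Relation.Nullary using (Dec; yes; no)
open import Relation.Nullary.Decidable using (map′; _×-dec_)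
open import Relation.Unary using (Pred; Decidable)
open import Relation.Binary.PropositionalEquality
open import Level using (0ℓ)

------------------------------------------------------------------------
-- Covering sets of ℤₙ

-- ℤₙ is Fin n.  Every a b mod n lies in ℤₙ, so equality of
-- { a b mod n : 0 ≤ a ≤ ℓ, b ∈ B } with ℤₙ is the inclusion of ℤₙ in it.
IsCovering : (n ℓ : ℕ) .{{_ : NonZero n}} → Subset n → Set
IsCovering n ℓ B =
  ∀ (x : Fin n) → ∃[ a ] (a ℕ.≤ ℓ × (∃[ b ] (b ∈ B × (a ℕ.* toℕ b) mod n ≡ x)))

IsCovering? : (n ℓ : ℕ) .{{_ : NonZero n}} → Decidable (IsCovering n ℓ)
IsCovering? n ℓ B = Finₚ.all? λ x →
  map′ (λ { (a , ℕ.s≤s a≤ℓ , p) → a , a≤ℓ , p })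
       (λ { (a , a≤ℓ , p) → a , ℕ.s≤s a≤ℓ , p })
       (ℕₚ.anyUpTo?
         (λ a → Finₚ.any? λ b → (b ∈? B) ×-dec ((a ℕ.* toℕ b) mod n Fin.≟ x))
         (suc ℓ))

IsMinimum : Pred ℕ 0ℓ → ℕ → Set
IsMinimum P m = P m × (∀ k → P k → m ℕ.≤ k)

least : {P : Pred ℕ 0ℓ} → Decidable P → ∀ m → P m → ∃ (IsMinimum P)
least P? zero    P0 = 0 , P0 , λ _ _ → ℕ.z≤n
least P? (suc m) Pm with P? 0
... | yes P0 = 0 , P0 , λ _ _ → ℕ.z≤n
... | no ¬P0 with least (λ k → P? (suc k)) m Pm
...   | k , Pk , k-min =
  suc k , Pk , λ { zero P0 → ⊥-elim (¬P0 P0) ; (suc j) Pj → ℕ.s≤s (k-min j Pj) }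

HasCoveringOfSize : (n ℓ : ℕ) .{{_ : NonZero n}} → Pred ℕ 0ℓ
HasCoveringOfSize n ℓ m = ∃[ B ] (IsCovering n ℓ B × Subset.∣ B ∣ ≡ m)

⊤-isCovering : (n ℓ : ℕ) .{{_ : NonZero n}} .{{_ : NonZero ℓ}} →
               IsCovering n ℓ Subset.⊤
⊤-isCovering n ℓ x = 1 , ℕ.>-nonZero⁻¹ ℓ , x , ∈⊤ , Finₚ.toℕ-injective (begin
  toℕ ((1 ℕ.* toℕ x) mod n)  ≡⟨ Finₚ.toℕ-fromℕ< (m%n<n (1 ℕ.* toℕ x) n) ⟩
  (1 ℕ.* toℕ x) ℕ.% n        ≡⟨ cong (λ t → t ℕ.% n) (ℕₚ.*-identityˡ (toℕ x)) ⟩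
  toℕ x ℕ.% n                ≡⟨ m<n⇒m%n≡m (Finₚ.toℕ<n x) ⟩
  toℕ x                      ∎)
  where
  open ≡-Reasoning

minCovering : (n ℓ : ℕ) .{{_ : NonZero n}} .{{_ : NonZero ℓ}} →
              ∃ (IsMinimum (HasCoveringOfSize n ℓ))
minCovering n ℓ =
  least (λ m → anySubset? λ B → IsCovering? n ℓ B ×-dec (Subset.∣ B ∣ ℕₚ.≟ m))
        Subset.∣ Subset.⊤ {n} ∣ (Subset.⊤ , ⊤-isCovering n ℓ , refl)

-- For ℓ = 0 and n ≥ 2 there is no covering set, whence the NonZero ℓ.
f : (n ℓ : ℕ) .{{_ : NonZero n}} .{{_ : NonZero ℓ}} → ℕ
f n ℓ = proj₁ (minCovering n ℓ)

f-isMinimum : (n ℓ : ℕ) .{{_ : NonZero n}} .{{_ : NonZero ℓ}} →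
              IsMinimum (HasCoveringOfSize n ℓ) (f n ℓ)
f-isMinimum n ℓ = proj₂ (minCovering n ℓ)

------------------------------------------------------------------------
-- Real numbers as Cauchy sequences of rationals

IsCauchy : (ℕ → ℚ) → Set
IsCauchy x = ∀ ε → 0ℚ < ε →
  ∃[ N ] (∀ i j → N ℕ.≤ i → N ℕ.≤ j → ∣ x i - x j ∣ ≤ ε)

record ℝ : Set where
  constructor mkℝ
  field
    seq    : ℕ → ℚ
    cauchy : IsCauchy seq

open ℝ public

infix  4 _≤ᴿ_ _<ᴿ_
infixl 6 _⊔ᴿ_
infixl 7 _*ᴿ_ _/ᴿ_

Eventually : Pred ℕ 0ℓ → Set
Eventually P = ∃[ N ] (∀ i → N ℕ.≤ i → P i)

-- The limits are compared, not the sequences term by term.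
_≤ᴿ_ : ℝ → ℝ → Set
x ≤ᴿ y = ∀ ε → 0ℚ < ε → Eventually λ i → seq x i ≤ seq y i + ε

_<ᴿ_ : ℝ → ℝ → Set
x <ᴿ y = ∃[ ε ] (0ℚ < ε × Eventually λ i → seq x i + ε ≤ seq y i)

module RingIdentities where
  open ℚS.+-*-Solver

  q+ε-q : ∀ q ε → (q + ε) - q ≡ ε
  q+ε-q = solve 2 (λ q ε → (q :+ ε) :- q := ε) refl

  p-q+q : ∀ p q → (p - q) + q ≡ p
  p-q+q = solve 2 (λ p q → (p :- q) :+ q := p) refl

  q+[p-q] : ∀ p q → p ≡ q + (p - q)
  q+[p-q] = solve 2 (λ p q → p := q :+ (p :- q)) refl

  swap-- : ∀ p q → q - p ≡ - (p - q)
  swap-- = solve 2 (λ p q → q :- p := :- (p :- q)) refl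

  -c+[c+a] : ∀ c a → - c + (c + a) ≡ a
  -c+[c+a] = solve 2 (λ c a → :- c :+ (c :+ a) := a) refl

  collect : ∀ b c r ε → b * (r * ε) + (r * ε) * c ≡ ((b + c) * r) * ε
  collect = solve 4 (λ b c r ε → b :* (r :* ε) :+ (r :* ε) :* c := ((b :+ c) :* r) :* ε) refl

  product-difference : ∀ p q r s → p * r - q * s ≡ p * (r - s) + (p - q) * s
  product-difference =
    solve 4 (λ p q r s → p :* r :- q :* s := p :* (r :- s) :+ (p :- q) :* s) refl

open RingIdentities

p≤q+ε⇒p-q≤ε : ∀ p q ε → p ≤ q + ε → p - q ≤ ε
p≤q+ε⇒p-q≤ε p q ε h =
  subst (p - q ≤_) (q+ε-q q ε) (+-monoˡ-≤ (- q) h)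

p-q≤ε⇒p≤q+ε : ∀ p q ε → p - q ≤ ε → p ≤ q + ε
p-q≤ε⇒p≤q+ε p q ε h =
  subst₂ _≤_ (p-q+q p q) (+-comm ε q) (+-monoˡ-≤ q h)

p≤∣p∣ : ∀ p → p ≤ ∣ p ∣
p≤∣p∣ p@(mkℚ (+ _)    _ _) = ≤-refl
p≤∣p∣ p@(mkℚ -[1+ _ ] _ _) = ≤-trans (<⇒≤ (negative⁻¹ p)) (0≤∣p∣ p)

∣p-q∣≤ε⇒p≤q+ε : ∀ p q ε → ∣ p - q ∣ ≤ ε → p ≤ q + ε
∣p-q∣≤ε⇒p≤q+ε p q ε h = p-q≤ε⇒p≤q+ε p q ε (≤-trans (p≤∣p∣ (p - q)) h)

≤⇒∣p-q∣≤ε : ∀ p q ε → p ≤ q + ε → q ≤ p + ε → ∣ p - q ∣ ≤ ε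
≤⇒∣p-q∣≤ε p q ε h₁ h₂ with ∣p∣≡p∨∣p∣≡-p (p - q)
... | inj₁ e = subst (_≤ ε) (sym e) (p≤q+ε⇒p-q≤ε p q ε h₁)
... | inj₂ e = subst (_≤ ε)
  (trans (swap-- p q) (sym e))
  (p≤q+ε⇒p-q≤ε q p ε h₂)

oneSided⇒IsCauchy : ∀ x →
  (∀ ε → 0ℚ < ε → ∃[ N ] (∀ i j → N ℕ.≤ i → N ℕ.≤ j → x i ≤ x j + ε)) → IsCauchy x
oneSided⇒IsCauchy x h ε ε>0 with h ε ε>0
... | N , b = N , λ i j N≤i N≤j →
  ≤⇒∣p-q∣≤ε (x i) (x j) ε (b i j N≤i N≤j) (b j i N≤j N≤i)

fromℚ : ℚ → ℝ
fromℚ q = mkℝ (λ _ → q) (oneSided⇒IsCauchy _ λ ε ε>0 →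
  0 , λ _ _ _ _ → subst (_≤ q + ε) (+-identityʳ q) (+-monoʳ-≤ q (<⇒≤ ε>0)))

fromℕ : ℕ → ℝ
fromℕ n = fromℚ (+ n / 1)

0ᴿ 1ᴿ : ℝ
0ᴿ = fromℕ 0
1ᴿ = fromℕ 1

_⊔ᴿ_ : ℝ → ℝ → ℝ
x ⊔ᴿ y = mkℝ (λ i → seq x i ⊔ seq y i) (oneSided⇒IsCauchy _ bound)
  where
  bound : ∀ ε → 0ℚ < ε → ∃[ N ] (∀ i j → N ℕ.≤ i → N ℕ.≤ j →
          seq x i ⊔ seq y i ≤ seq x j ⊔ seq y j + ε)
  bound ε ε>0 with cauchy x ε ε>0 | cauchy y ε ε>0
  ... | M , hx | N , hy = M ℕ.⊔ N , λ i j le₁ le₂ → ⊔-lub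
    (≤-trans
      (∣p-q∣≤ε⇒p≤q+ε (seq x i) (seq x j) ε
        (hx i j (ℕₚ.m⊔n≤o⇒m≤o M N le₁) (ℕₚ.m⊔n≤o⇒m≤o M N le₂)))
      (+-monoˡ-≤ ε (p≤p⊔q (seq x j) (seq y j))))
    (≤-trans
      (∣p-q∣≤ε⇒p≤q+ε (seq y i) (seq y j) ε
        (hy i j (ℕₚ.m⊔n≤o⇒n≤o M N le₁) (ℕₚ.m⊔n≤o⇒n≤o M N le₂)))
      (+-monoˡ-≤ ε (p≤q⊔p (seq x j) (seq y j))))

eventuallyBounded : ∀ x → ∃[ b ] (0ℚ < b × Eventually λ i → ∣ seq x i ∣ ≤ b)
eventuallyBounded x with cauchy x 1ℚ (positive⁻¹ 1ℚ)
... | N , h = ∣ seq x N ∣ + 1ℚ , +-mono-≤-< (0≤∣p∣ (seq x N)) (positive⁻¹ 1ℚ) , N , λ i N≤i → begin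
  ∣ seq x i ∣                          ≡⟨ cong ∣_∣ (q+[p-q] (seq x i) (seq x N)) ⟩
  ∣ seq x N + (seq x i - seq x N) ∣    ≤⟨ ∣p+q∣≤∣p∣+∣q∣ (seq x N) (seq x i - seq x N) ⟩
  ∣ seq x N ∣ + ∣ seq x i - seq x N ∣  ≤⟨ +-monoʳ-≤ ∣ seq x N ∣ (h i N N≤i ℕₚ.≤-refl) ⟩
  ∣ seq x N ∣ + 1ℚ                     ∎
  where
  open ≤-Reasoning

*-mono-≤ : ∀ {p q r s} → 0ℚ ≤ p → p ≤ q → 0ℚ ≤ r → r ≤ s → p * r ≤ q * s
*-mono-≤ {p} {q} {r} {s} 0≤p p≤q 0≤r r≤s =
  ≤-trans (*-monoʳ-≤-nonNeg r {{nonNegative 0≤r}} p≤q)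
          (*-monoˡ-≤-nonNeg q {{nonNegative (≤-trans 0≤p p≤q)}} r≤s)

reciprocal : ∀ s → 0ℚ < s → ∃[ r ] (0ℚ < r × s * r ≡ 1ℚ)
reciprocal s s>0 = 1/ s , positive⁻¹ (1/ s) {{1/pos⇒pos s}} , *-inverseʳ s
  where
  instance
    posS : Positive s
    posS = positive s>0
    nzS : NonZeroℚ s
    nzS = pos⇒nonZero s

0<p*q : ∀ p q → 0ℚ < p → 0ℚ < q → 0ℚ < p * q
0<p*q p q p>0 q>0 = positive⁻¹ (p * q) {{pos*pos⇒pos p {{positive p>0}} q {{positive q>0}}}}

splitTolerance : ∀ b c ε → 0ℚ < b → 0ℚ < c → 0ℚ < ε →
                 ∃[ δ ] (0ℚ < δ × b * δ + δ * c ≡ ε)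
splitTolerance b c ε b>0 c>0 ε>0 with reciprocal (b + c) (+-mono-< b>0 c>0)
... | r , r>0 , eq = r * ε , 0<p*q r ε r>0 ε>0 ,
  trans (collect b c r ε) (trans (cong (λ t → t * ε) eq) (*-identityˡ ε))

∣pr-qs∣≤ : ∀ p q r s b c δ → ∣ p ∣ ≤ b → ∣ s ∣ ≤ c → ∣ p - q ∣ ≤ δ → ∣ r - s ∣ ≤ δ →
           ∣ p * r - q * s ∣ ≤ b * δ + δ * c
∣pr-qs∣≤ p q r s b c δ p≤b s≤c pq rs = begin
  ∣ p * r - q * s ∣                        ≡⟨ cong ∣_∣ (product-difference p q r s) ⟩
  ∣ p * (r - s) + (p - q) * s ∣            ≤⟨ ∣p+q∣≤∣p∣+∣q∣ (p * (r - s)) ((p - q) * s) ⟩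
  ∣ p * (r - s) ∣ + ∣ (p - q) * s ∣        ≡⟨ cong₂ _+_ (∣p*q∣≡∣p∣*∣q∣ p (r - s)) (∣p*q∣≡∣p∣*∣q∣ (p - q) s) ⟩
  ∣ p ∣ * ∣ r - s ∣ + ∣ p - q ∣ * ∣ s ∣    ≤⟨ +-mono-≤ (*-mono-≤ (0≤∣p∣ p) p≤b (0≤∣p∣ (r - s)) rs)
                                                      (*-mono-≤ (0≤∣p∣ (p - q)) pq (0≤∣p∣ s) s≤c) ⟩
  b * δ + δ * c                            ∎
  where
  open ≤-Reasoning

*-isCauchy : ∀ x y → IsCauchy (λ i → seq x i * seq y i)
*-isCauchy x y ε ε>0 = combine (eventuallyBounded x) (eventuallyBounded y)
  where
  Goal : Set
  Goal = ∃[ N ] (∀ i j → N ℕ.≤ i → N ℕ.≤ j → ∣ seq x i * seq y i - seq x j * seq y j ∣ ≤ ε)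

  Close : ℝ → ℚ → Set
  Close z δ = ∃[ N ] (∀ i j → N ℕ.≤ i → N ℕ.≤ j → ∣ seq z i - seq z j ∣ ≤ δ)

  assemble : ∀ {b c δ} → b * δ + δ * c ≡ ε →
             (Eventually λ i → ∣ seq x i ∣ ≤ b) → (Eventually λ i → ∣ seq y i ∣ ≤ c) →
             Close x δ → Close y δ → Goal
  assemble {b} {c} {δ} eq (K , hb) (L , hc) (M , hx) (N , hy) = (K ℕ.⊔ L) ℕ.⊔ (M ℕ.⊔ N) ,
    λ i j le₁ le₂ →
      let KL≤i = ℕₚ.m⊔n≤o⇒m≤o (K ℕ.⊔ L) (M ℕ.⊔ N) le₁
          KL≤j = ℕₚ.m⊔n≤o⇒m≤o (K ℕ.⊔ L) (M ℕ.⊔ N) le₂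
          MN≤i = ℕₚ.m⊔n≤o⇒n≤o (K ℕ.⊔ L) (M ℕ.⊔ N) le₁
          MN≤j = ℕₚ.m⊔n≤o⇒n≤o (K ℕ.⊔ L) (M ℕ.⊔ N) le₂
      in ≤-trans
        (∣pr-qs∣≤ (seq x i) (seq x j) (seq y i) (seq y j) b c δ
          (hb i (ℕₚ.m⊔n≤o⇒m≤o K L KL≤i))
          (hc j (ℕₚ.m⊔n≤o⇒n≤o K L KL≤j))
          (hx i j (ℕₚ.m⊔n≤o⇒m≤o M N MN≤i) (ℕₚ.m⊔n≤o⇒m≤o M N MN≤j))
          (hy i j (ℕₚ.m⊔n≤o⇒n≤o M N MN≤i) (ℕₚ.m⊔n≤o⇒n≤o M N MN≤j)))
        (≤-reflexive eq)

  combine : (∃[ b ] (0ℚ < b × Eventually λ i → ∣ seq x i ∣ ≤ b)) →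
            (∃[ c ] (0ℚ < c × Eventually λ i → ∣ seq y i ∣ ≤ c)) → Goal
  combine (b , b>0 , hb) (c , c>0 , hc) = finish (splitTolerance b c ε b>0 c>0 ε>0)
    where
    finish : (∃[ δ ] (0ℚ < δ × b * δ + δ * c ≡ ε)) → Goal
    finish (δ , δ>0 , eq) = assemble eq hb hc (cauchy x δ δ>0) (cauchy y δ δ>0)

_*ᴿ_ : ℝ → ℝ → ℝ
x *ᴿ y = mkℝ (λ i → seq x i * seq y i) (*-isCauchy x y)

_/ᴿ_ : ℝ → (d : ℕ) .{{_ : NonZero d}} → ℝ
x /ᴿ d = x *ᴿ fromℚ (+ 1 / d)

------------------------------------------------------------------------
-- The natural logarithm of a positive integer

-- 1/(a+1) + 1/(a+2) + ⋯ + 1/(a+m)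
reciprocalSum : ℕ → ℕ → ℚ
reciprocalSum a zero    = 0ℚ
reciprocalSum a (suc m) = + 1 / suc a + reciprocalSum (suc a) m

-- ln n = ∫₁ⁿ dt/t.  With K = i + 1, the right-endpoint Riemann sum of mesh
-- 1/K is  ∑ (1/K) · 1/(1 + j/K) = ∑ 1/(K + j)  over 1 ≤ j ≤ (n − 1) K.
lnRiemannSum : ℕ → ℕ → ℚ
lnRiemannSum n i = reciprocalSum (suc i) ((n ℕ.∸ 1) ℕ.* suc i)

/-mono-≤ : ∀ m d m′ d′ → m ℕ.* suc d′ ℕ.≤ m′ ℕ.* suc d → + m / suc d ≤ + m′ / suc d′
/-mono-≤ m d m′ d′ h = toℚᵘ-cancel-≤ (begin
  toℚᵘ (+ m / suc d)      ≃⟨ toℚᵘ-fromℚᵘ (ℚᵘ.mkℚᵘ (+ m) d) ⟩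
  ℚᵘ.mkℚᵘ (+ m) d         ≤⟨ ℚᵘ.*≤* (subst₂ ℤ._≤_ (ℤₚ.pos-* m (suc d′)) (ℤₚ.pos-* m′ (suc d)) (ℤ.+≤+ h)) ⟩
  ℚᵘ.mkℚᵘ (+ m′) d′       ≃⟨ toℚᵘ-fromℚᵘ (ℚᵘ.mkℚᵘ (+ m′) d′) ⟨
  toℚᵘ (+ m′ / suc d′)    ∎)
  where
  open ℚᵘₚ.≤-Reasoning

/-suc : ∀ m d → + 1 / suc d + + m / suc d ≡ + suc m / suc d
/-suc m d = toℚᵘ-injective (begin-equality
  toℚᵘ (+ 1 / suc d + + m / suc d)             ≃⟨ toℚᵘ-homo-+ (+ 1 / suc d) (+ m / suc d) ⟩
  toℚᵘ (+ 1 / suc d) ℚᵘ.+ toℚᵘ (+ m / suc d)   ≃⟨ ℚᵘₚ.+-cong (toℚᵘ-fromℚᵘ (ℚᵘ.mkℚᵘ (+ 1) d)) (toℚᵘ-fromℚᵘ (ℚᵘ.mkℚᵘ (+ m) d)) ⟩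
  ℚᵘ.mkℚᵘ (+ 1) d ℚᵘ.+ ℚᵘ.mkℚᵘ (+ m) d         ≃⟨ ℚᵘ.*≡* eq ⟩
  ℚᵘ.mkℚᵘ (+ suc m) d                          ≃⟨ toℚᵘ-fromℚᵘ (ℚᵘ.mkℚᵘ (+ suc m) d) ⟨
  toℚᵘ (+ suc m / suc d)                       ∎)
  where
  open ℚᵘₚ.≤-Reasoning
  D = + suc d
  eq : (+ 1 ℤ.* D ℤ.+ + m ℤ.* D) ℤ.* D ≡ + suc m ℤ.* + (suc d ℕ.* suc d)
  eq = trans (cong (ℤ._* D) (sym (ℤₚ.*-distribʳ-+ D (+ 1) (+ m))))
      (trans (ℤₚ.*-assoc (+ suc m) D D)
             (cong (+ suc m ℤ.*_) (sym (ℤₚ.pos-* (suc d) (suc d)))))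

reciprocalSum-≤ : ∀ a m d → d ℕ.≤ a → reciprocalSum a m ≤ + m / suc d
reciprocalSum-≤ a zero    d d≤a = /-mono-≤ 0 0 0 d ℕ.z≤n
reciprocalSum-≤ a (suc m) d d≤a = subst (reciprocalSum a (suc m) ≤_) (/-suc m d)
  (+-mono-≤ (/-mono-≤ 1 a 1 d (ℕₚ.*-monoʳ-≤ 1 (ℕ.s≤s d≤a)))
            (reciprocalSum-≤ (suc a) m d (ℕₚ.m≤n⇒m≤1+n d≤a)))

reciprocalSum-≥ : ∀ a m d → a ℕ.+ m ℕ.≤ suc d → + m / suc d ≤ reciprocalSum a m
reciprocalSum-≥ a zero    d h = /-mono-≤ 0 d 0 0 ℕ.z≤n
reciprocalSum-≥ a (suc m) d h = subst (_≤ reciprocalSum a (suc m)) (/-suc m d)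
  (+-mono-≤ (/-mono-≤ 1 d 1 a (ℕₚ.*-monoʳ-≤ 1 (ℕₚ.≤-trans (ℕₚ.m≤m+n (suc a) m) h′)))
            (reciprocalSum-≥ (suc a) m d h′))
  where
  h′ : suc a ℕ.+ m ℕ.≤ suc d
  h′ = subst (ℕ._≤ suc d) (ℕₚ.+-suc a m) h

reciprocalSum-++ : ∀ a m k →
  reciprocalSum a (m ℕ.+ k) ≡ reciprocalSum a m + reciprocalSum (a ℕ.+ m) k
reciprocalSum-++ a zero    k = trans (cong (λ t → reciprocalSum t k) (sym (ℕₚ.+-identityʳ a)))
                                     (sym (+-identityˡ _))
reciprocalSum-++ a (suc m) k = begin
  u + reciprocalSum (suc a) (m ℕ.+ k)                                ≡⟨ cong (λ t → u + t) (reciprocalSum-++ (suc a) m k) ⟩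
  u + (reciprocalSum (suc a) m + reciprocalSum (suc a ℕ.+ m) k)      ≡⟨ sym (+-assoc u _ _) ⟩
  u + reciprocalSum (suc a) m + reciprocalSum (suc a ℕ.+ m) k        ≡⟨ cong (λ t → u + reciprocalSum (suc a) m + reciprocalSum t k) (sym (ℕₚ.+-suc a m)) ⟩
  u + reciprocalSum (suc a) m + reciprocalSum (a ℕ.+ suc m) k        ∎
  where
  open ≡-Reasoning
  u = + 1 / suc a

module _ (p : ℕ) where

  private
    T : ℕ → ℚ
    T = lnRiemannSum (suc p)

    r : ℕ → ℚ
    r i = + 1 / suc i

    block : ℕ → ℚ
    block i = reciprocalSum (suc i ℕ.+ p ℕ.* suc i) (suc p)

  lnRiemannSum-suc : ∀ i → r (suc i) + T (suc i) ≡ T i + block i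
  lnRiemannSum-suc i = trans
    (cong (reciprocalSum (suc i)) eq)
    (reciprocalSum-++ (suc i) (p ℕ.* suc i) (suc p))
    where
    open ℕS.+-*-Solver
    eq : suc (p ℕ.* suc (suc i)) ≡ p ℕ.* suc i ℕ.+ suc p
    eq = solve 2 (λ p i → con 1 :+ p :* (con 2 :+ i) := p :* (con 1 :+ i) :+ (con 1 :+ p)) refl p i

  block-≤ : ∀ i → block i ≤ r i
  block-≤ i = ≤-trans
    (reciprocalSum-≤ (suc i ℕ.+ p ℕ.* suc i) (suc p) (i ℕ.+ p ℕ.* suc i) (ℕₚ.n≤1+n _))
    (/-mono-≤ (suc p) (i ℕ.+ p ℕ.* suc i) 1 i (ℕₚ.≤-reflexive (sym (ℕₚ.*-identityˡ _))))

  block-≥ : ∀ i → r (suc i) ≤ block i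
  block-≥ i = ≤-trans
    (/-mono-≤ 1 (suc i) (suc p) (suc i ℕ.+ p ℕ.* suc (suc i)) (ℕₚ.≤-reflexive (ℕₚ.*-identityˡ _)))
    (reciprocalSum-≥ (suc i ℕ.+ p ℕ.* suc i) (suc p) (suc i ℕ.+ p ℕ.* suc (suc i))
      (ℕₚ.≤-reflexive eq))
    where
    open ℕS.+-*-Solver
    eq : suc i ℕ.+ p ℕ.* suc i ℕ.+ suc p ≡ suc (suc i ℕ.+ p ℕ.* suc (suc i))
    eq = solve 2 (λ p i → (con 1 :+ i) :+ p :* (con 1 :+ i) :+ (con 1 :+ p)
                          := con 1 :+ ((con 1 :+ i) :+ p :* (con 2 :+ i))) refl p i

  lnRiemannSum-mono-suc : ∀ i → T i ≤ T (suc i)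
  lnRiemannSum-mono-suc i = +-cancelˡ-≤ (r (suc i)) (begin
    r (suc i) + T i        ≡⟨ +-comm (r (suc i)) (T i) ⟩
    T i + r (suc i)        ≤⟨ +-monoʳ-≤ (T i) (block-≥ i) ⟩
    T i + block i          ≡⟨ sym (lnRiemannSum-suc i) ⟩
    r (suc i) + T (suc i)  ∎)
    where
    open ≤-Reasoning
    +-cancelˡ-≤ : ∀ c {a b} → c + a ≤ c + b → a ≤ b
    +-cancelˡ-≤ c {a} {b} h = subst₂ _≤_ (-c+[c+a] c a) (-c+[c+a] c b) (+-monoʳ-≤ (- c) h)

  lnRiemannSum-mono : ∀ {i j} → i ℕ.≤′ j → T i ≤ T j
  lnRiemannSum-mono ℕ.≤′-refl = ≤-refl
  lnRiemannSum-mono (ℕ.≤′-step i≤j) =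
    ≤-trans (lnRiemannSum-mono i≤j) (lnRiemannSum-mono-suc _)

  lnRiemannSum-anti : ∀ {i j} → i ℕ.≤′ j → r j + T j ≤ r i + T i
  lnRiemannSum-anti ℕ.≤′-refl = ≤-refl
  lnRiemannSum-anti {i} (ℕ.≤′-step {j} i≤j) = ≤-trans
    (subst₂ _≤_ (sym (lnRiemannSum-suc j)) (+-comm (T j) (r j)) (+-monoʳ-≤ (T j) (block-≤ j)))
    (lnRiemannSum-anti i≤j)

  lnRiemannSum-cauchy : IsCauchy T
  lnRiemannSum-cauchy = oneSided⇒IsCauchy T bound
    where
    bound : ∀ ε → 0ℚ < ε → ∃[ N ] (∀ i j → N ℕ.≤ i → N ℕ.≤ j → T i ≤ T j + ε)
    bound (mkℚ (+ 0)    d c) ε>0 = ⊥-elim (<-irrefl (sym (↥p≡0⇒p≡0 (mkℚ (+ 0) d c) refl)) ε>0)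
    bound (mkℚ -[1+ _ ] d c) ε>0 = ⊥-elim (<-asym ε>0 (negative⁻¹ _))
    bound ε@(mkℚ +[1+ k ] d c) ε>0 = d , λ i j d≤i d≤j → begin
      T i        ≡⟨ sym (+-identityˡ (T i)) ⟩
      0ℚ + T i   ≤⟨ +-monoˡ-≤ (T i) (/-mono-≤ 0 0 1 i ℕ.z≤n) ⟩
      r i + T i  ≤⟨ lnRiemannSum-anti (ℕₚ.≤⇒≤′ d≤i) ⟩
      r d + T d  ≤⟨ +-mono-≤ r≤ε (lnRiemannSum-mono (ℕₚ.≤⇒≤′ d≤j)) ⟩
      ε + T j    ≡⟨ +-comm ε (T j) ⟩
      T j + ε    ∎
      where
      open ≤-Reasoning
      r≤ε : r d ≤ ε
      r≤ε = subst (r d ≤_) (fromℚᵘ-toℚᵘ ε)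
        (/-mono-≤ 1 d (suc k) d (ℕₚ.*-monoˡ-≤ (suc d) {1} {suc k} (ℕ.s≤s ℕ.z≤n)))

ln : (n : ℕ) .{{_ : NonZero n}} → ℝ
ln n@(suc p) = mkℝ (lnRiemannSum n) (lnRiemannSum-cauchy p)

-- The paper's convention: log n = max(ln n, 1).
log : (n : ℕ) .{{_ : NonZero n}} → ℝ
log n = ln n ⊔ᴿ 1ᴿ

{-# OPTIONS --safe #-}

-- Say that b covers x if x ∈ {0,…,ℓ} b.  If every x in a set X has at least S
-- coverers in a pool P, then greedy choice covers all but |X|/ℓ elements of X
-- with about (|P|/S) log ℓ elements.  Let g = gcd(x,n) and m = n/g.
--
-- If ℓ/g exceeds a multiple of log² m, take P to be the units.  The number of
-- a ≤ ℓ/g prime to m is ≫ (ℓ/g) φ(m)/m: Chebyshev gives many products p k with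
-- p a prime not dividing m and k ≤ (ℓ/g)^(1/3) prime to m, and the sum of 1/k is
-- at least ∏ (1 - 1/p) times the full harmonic sum.  Each a yields
-- φ(n)/φ(m) coverers, so S ≫ ℓ φ(n)/n.
--
-- If m ≤ ℓ, the single element g covers all x with that gcd; as m ≪ (n/ℓ) log² m
-- here, there are O((n/ℓ) log n) such m with log² m ≪ log n.  For the other x
-- with m > ℓ, the primes p ≤ ℓ not dividing n give S ≫ ℓ/log ℓ coverers x/p, all
-- with the same gcd as x.  If log² ℓ ≪ log n this already suffices for all x.
-- Otherwise the x and m that remain have a common factor with n above
-- exp(C (log log n)²), and these are rare: such a factor has a large prime
-- power component or many prime factors, and 2^#{p | p ∣ x, p ∣ n} has mean
-- at most ∏ (1 + 1/p) ≪ log n.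

module Submission where

open import Defs
open import Data.Nat using (ℕ; NonZero; _≤_; _<_)
open import Data.Product using (∃-syntax; _×_)
open import Data.Nat
import Data.Nat.Properties as ℕₚ
open import Data.Nat.Properties hiding (*-mono-≤)
open import Data.Nat.Divisibility
open import Data.Nat.Primality
open import Data.Nat.Tactic.RingSolver using (solve-∀)
open import Data.List using (List; []; _∷_; _++_; length; filter; map; concatMap; downFrom)
open import Data.Nat.ListAction using (product)
open import Data.List.Properties using (length-map; length-++; filter-accept; filter-reject; length-filter; length-downFrom; map-id)
open import Data.List.Membership.Propositional using (_∈_; find)
open import Data.List.Membership.Propositional.Properties using (∈-filter⁺; ∈-filter⁻; ∈-++⁺ˡ; ∈-++⁺ʳ; ∈-++⁻; ∈-∃++; ∈-map⁺; ∈-map⁻; ∈-concatMap⁻; ∈-downFrom⁺; ∈-downFrom⁻)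
open import Data.List.Relation.Unary.All as All using (All; []; _∷_; all?)
open import Data.List.Relation.Unary.Any as Any using (Any; here; there)
import Data.List.Relation.Unary.Any.Properties as Anyₚ
open import Data.List.Relation.Unary.Unique.Propositional using (Unique; []; _∷_)
import Data.List.Relation.Unary.Unique.Propositional.Properties as Uniqueₚ
open import Data.Product using (∃₂; ∃-syntax; _×_; _,_; proj₁; proj₂)
open import Data.Sum using (_⊎_; inj₁; inj₂)
open import Data.Empty using (⊥; ⊥-elim)
open import Function using (_∘_; id)
open import Relation.Nullary using (¬_; Dec; yes; no; contradiction)
open import Relation.Nullary.Decidable using (¬?; _×-dec_; _⊎-dec_)
open import Relation.Unary using (Pred; Decidable)
open import Relation.Binary.PropositionalEquality
open import Level using (0ℓ)
import Data.Nat.DivMod as DM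
open import Data.Nat.GCD using (gcd; gcd[m,n]∣m; gcd[m,n]∣n; gcd-greatest; module Bézout)
open import Data.Nat.Coprimality as Coprimality using (Coprime; coprime-Bézout)
open import Data.Nat.Induction using (<-rec)
import Data.Nat.Primality.Factorisation as Factorisation
import Data.List.Relation.Unary.AllPairs as AllPairs
open import Data.List.Relation.Unary.AllPairs using (AllPairs)
import Data.List.Relation.Unary.AllPairs.Properties as AllPairsₚ
open import Data.Fin using (toℕ)
open import Data.Fin.Properties using (toℕ-injective; toℕ-fromℕ<; toℕ<n)
open import Data.Fin.Subset as Subset using (Subset; inside; outside)
import Data.Fin.Subset.Properties as Subsetₚ
open import Data.Vec using ([]; _∷_)
import Data.Integer as ℤ
import Data.Integer.Properties as ℤₚ
open import Data.Rational as ℚ using (0ℚ; 1ℚ)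
import Data.Rational.Properties as ℚₚ
import Data.Rational.Unnormalised as ℚᵘ
import Data.Rational.Unnormalised.Properties as ℚᵘₚ

-- Finite sums over lists

-- Write L for the integer part of log₂ n and λ for that of log₂ ℓ; the budget is O(n L / ℓ). If
-- every x to be covered has at least ℓ|P|/Q coverers in P, greedy choice costs about λ Q / ℓ. The
-- units achieve Q ≪ n and, as λ ≤ L, fit the budget for any set of x. Prime multipliers achieve
-- only Q ≪ λ|P|, and their cost λ²|P|/ℓ fits only if λ² ≪ L or if the class P has density ≪ 1/L.
-- This second logarithm is the obstacle that forces the case distinction and the rarity estimate:
-- where the units fail and λ is large, the x and the larger m left over have to be thinned by a
-- factor L. For ℓ ≤ 512 L all of ℤₙ is within the budget. Everything is an inequality between
-- natural numbers, with denominators cleared and logarithms given by powers of 2; real numbers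
-- enter only at the end, through L/2 ≤ ln n.

+-exchange : ∀ a b c → a + (b + c) ≡ b + (a + c)
+-exchange = solve-∀

module _ {A : Set} where

  ∑ : List A → (A → ℕ) → ℕ
  ∑ []       g = 0
  ∑ (x ∷ xs) g = g x + ∑ xs g

  ∑-mono : ∀ xs {g h : A → ℕ} → (∀ {x} → x ∈ xs → g x ≤ h x) → ∑ xs g ≤ ∑ xs h
  ∑-mono []       g≤h = z≤n
  ∑-mono (x ∷ xs) g≤h = +-mono-≤ (g≤h (here refl)) (∑-mono xs (g≤h ∘ there))

  ∑-++ : ∀ xs ys (g : A → ℕ) → ∑ (xs ++ ys) g ≡ ∑ xs g + ∑ ys g
  ∑-++ []       ys g = refl
  ∑-++ (x ∷ xs) ys g = trans (cong (g x +_) (∑-++ xs ys g)) (sym (+-assoc (g x) _ _))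

  ∑-const : ∀ xs c → ∑ xs (λ (_ : A) → c) ≡ length xs * c
  ∑-const []       c = refl
  ∑-const (x ∷ xs) c = cong (c +_) (∑-const xs c)

  ∑-1 : ∀ xs → ∑ xs (λ (_ : A) → 1) ≡ length xs
  ∑-1 xs = trans (∑-const xs 1) (*-identityʳ _)

  ∑-+ : ∀ xs (g h : A → ℕ) → ∑ xs (λ x → g x + h x) ≡ ∑ xs g + ∑ xs h
  ∑-+ []       g h = refl
  ∑-+ (x ∷ xs) g h = trans (cong (g x + h x +_) (∑-+ xs g h)) (lemma (g x) (h x) _ _)
    where
    lemma : ∀ a b c d → a + b + (c + d) ≡ a + c + (b + d)
    lemma = solve-∀

  ∑-*ʳ : ∀ xs (g : A → ℕ) c → ∑ xs (λ x → g x * c) ≡ ∑ xs g * c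
  ∑-*ʳ []       g c = refl
  ∑-*ʳ (x ∷ xs) g c = trans (cong (g x * c +_) (∑-*ʳ xs g c)) (sym (*-distribʳ-+ c (g x) _))

  ∑-split : ∀ {P : Pred A 0ℓ} (P? : Decidable P) xs (g : A → ℕ) →
            ∑ xs g ≡ ∑ (filter P? xs) g + ∑ (filter (¬? ∘ P?) xs) g
  ∑-split P? []       g = refl
  ∑-split P? (x ∷ xs) g with P? x
  ... | yes _ = trans (cong (g x +_) (∑-split P? xs g)) (sym (+-assoc (g x) _ _))
  ... | no  _ = trans (cong (g x +_) (∑-split P? xs g)) (+-exchange (g x) (∑ (filter P? xs) g) _)

  length-split : ∀ {P : Pred A 0ℓ} (P? : Decidable P) xs →
                 length xs ≡ length (filter P? xs) + length (filter (¬? ∘ P?) xs)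
  length-split P? xs = trans (sym (∑-1 xs))
    (trans (∑-split P? xs _) (cong₂ _+_ (∑-1 (filter P? xs)) (∑-1 (filter (¬? ∘ P?) xs))))

  length-filter-∷ : ∀ {P : Pred A 0ℓ} (P? : Decidable P) x xs →
                    length (filter P? xs) ≤ length (filter P? (x ∷ xs))
  length-filter-∷ P? x xs with P? x
  ... | yes _ = n≤1+n _
  ... | no  _ = ≤-refl

  ∃-≥average : ∀ x xs (g : A → ℕ) r → length (x ∷ xs) * r ≤ ∑ (x ∷ xs) g → ∃[ y ] r ≤ g y
  ∃-≥average x xs g r h with r ≤? g x
  ... | yes r≤gx = x , r≤gx
  ∃-≥average x [] g r h | no r≰gx =
    contradiction (subst₂ _≤_ (+-identityʳ r) (+-identityʳ (g x)) h) r≰gx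
  ∃-≥average x (y ∷ ys) g r h | no r≰gx = ∃-≥average y ys g r
    (+-cancelˡ-≤ r _ _ (≤-trans h (+-monoˡ-≤ _ (<⇒≤ (≰⇒> r≰gx)))))

module _ {A B : Set} where

  -- Cut the image of the head out of `ys`; injectivity keeps the images of the tail within what
  -- remains. Most counting below reduces to such an injection.
  ∑-inj : ∀ {xs : List A} {ys : List B} (g : A → B) {w v} → Unique xs →
          (∀ {x} → x ∈ xs → g x ∈ ys) →
          (∀ {x x′} → x ∈ xs → x′ ∈ xs → g x ≡ g x′ → x ≡ x′) →
          (∀ {x} → x ∈ xs → w x ≤ v (g x)) → ∑ xs w ≤ ∑ ys v
  ∑-inj {[]}     g uniq into inj w≤v = z≤n
  ∑-inj {x ∷ xs} g {w} {v} (x∉xs ∷ uniq) into inj w≤v with ∈-∃++ (into (here refl))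
  ... | as , bs , refl = begin
    w x + ∑ xs w                     ≤⟨ +-mono-≤ (w≤v (here refl)) ih ⟩
    v (g x) + ∑ (as ++ bs) v         ≡⟨ cong (v (g x) +_) (∑-++ as bs v) ⟩
    v (g x) + (∑ as v + ∑ bs v)      ≡⟨ +-exchange (v (g x)) (∑ as v) (∑ bs v) ⟩
    ∑ as v + (v (g x) + ∑ bs v)      ≡⟨ ∑-++ as (g x ∷ bs) v ⟨
    ∑ (as ++ g x ∷ bs) v             ∎
    where
    open ≤-Reasoning
    into′ : ∀ {x′} → x′ ∈ xs → g x′ ∈ as ++ bs
    into′ x′∈xs with ∈-++⁻ as (into (there x′∈xs))
    ... | inj₁ ∈as         = ∈-++⁺ˡ ∈as
    ... | inj₂ (there ∈bs) = ∈-++⁺ʳ as ∈bs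
    ... | inj₂ (here eq)   =
      contradiction (inj (here refl) (there x′∈xs) (sym eq)) (All.lookup x∉xs x′∈xs)
    ih : ∑ xs w ≤ ∑ (as ++ bs) v
    ih = ∑-inj g uniq into′ (λ p q → inj (there p) (there q)) (w≤v ∘ there)

  length-inj : ∀ {xs : List A} {ys : List B} (g : A → B) → Unique xs →
               (∀ {x} → x ∈ xs → g x ∈ ys) →
               (∀ {x x′} → x ∈ xs → x′ ∈ xs → g x ≡ g x′ → x ≡ x′) → length xs ≤ length ys
  length-inj {xs} {ys} g uniq into inj =
    subst₂ _≤_ (∑-1 xs) (∑-1 ys) (∑-inj g uniq into inj (λ _ → ≤-refl))

module _ {A : Set} where

  ∑-⊆ : ∀ {xs ys : List A} {g : A → ℕ} → Unique xs → (∀ {x} → x ∈ xs → x ∈ ys) → ∑ xs g ≤ ∑ ys g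
  ∑-⊆ xs! sub = ∑-inj id xs! sub (λ _ _ → id) (λ _ → ≤-refl)

  length-⊆ : ∀ {xs ys : List A} → Unique xs → (∀ {x} → x ∈ xs → x ∈ ys) → length xs ≤ length ys
  length-⊆ xs! sub = length-inj id xs! sub (λ _ _ → id)

module _ {A B : Set} where

  -- Disjointness makes the concatenation of the lists repetition-free. Used where a number, such as
  -- a product p k or a unit b, determines the index of its list.
  ∑-disjoint : ∀ {ks : List A} {ys : List B} (z : A → List B) → Unique ks →
               (∀ {k} → k ∈ ks → Unique (z k)) →
               (∀ {k v} → k ∈ ks → v ∈ z k → v ∈ ys) →
               (∀ {k k′ v} → k ∈ ks → k′ ∈ ks → v ∈ z k → v ∈ z k′ → k ≡ k′) →
               ∑ ks (length ∘ z) ≤ length ys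
  ∑-disjoint {ks} {ys} z ks! z! z⊆ys disj = begin
    ∑ ks (length ∘ z)        ≡⟨ length-concatMap ks ⟨
    length (concatMap z ks)  ≤⟨ length-⊆ (unique ks! z! disj) into ⟩
    length ys                ∎
    where
    open ≤-Reasoning
    length-concatMap : ∀ ks → length (concatMap z ks) ≡ ∑ ks (length ∘ z)
    length-concatMap []       = refl
    length-concatMap (k ∷ ks) =
      trans (length-++ (z k)) (cong (length (z k) +_) (length-concatMap ks))
    unique : ∀ {ks} → Unique ks → (∀ {k} → k ∈ ks → Unique (z k)) →
             (∀ {k k′ v} → k ∈ ks → k′ ∈ ks → v ∈ z k → v ∈ z k′ → k ≡ k′) →
             Unique (concatMap z ks)
    unique []           z! disj = []
    unique {k ∷ ks} (k∉ks ∷ ks!) z! disj = Uniqueₚ.++⁺ (z! (here refl))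
      (unique ks! (z! ∘ there) (λ p q → disj (there p) (there q)))
      λ { (v∈zk , v∈rest) → let k′ , k′∈ks , v∈zk′ = find (∈-concatMap⁻ z {xs = ks} v∈rest) in
          All.lookup k∉ks k′∈ks (disj (here refl) (there k′∈ks) v∈zk v∈zk′) }
    into : ∀ {v} → v ∈ concatMap z ks → v ∈ ys
    into v∈ = let k , k∈ks , v∈zk = find (∈-concatMap⁻ z {xs = ks} v∈) in z⊆ys k∈ks v∈zk
  module _ {R : B → A → Set} (R? : ∀ b a → Dec (R b a)) where

    count-swap : ∀ (xs : List A) (ys : List B) →
      ∑ xs (λ x → length (filter (λ y → R? y x) ys)) ≡ ∑ ys (λ y → length (filter (R? y) xs))
    count-swap []       ys = sym (trans (∑-const ys 0) (*-zeroʳ (length ys)))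
    count-swap (x ∷ xs) ys =
      trans (cong (length (filter (λ y → R? y x) ys) +_) (count-swap xs ys)) (step ys)
      where
      step : ∀ ys → length (filter (λ y → R? y x) ys) + ∑ ys (λ y → length (filter (R? y) xs)) ≡
                    ∑ ys (λ y → length (filter (R? y) (x ∷ xs)))
      step []       = refl
      step (y ∷ ys) with R? y x
      ... | yes _ = cong suc (trans (+-exchange (length (filter (λ y → R? y x) ys)) (length (filter (R? y) xs)) _)
                                    (cong (length (filter (R? y) xs) +_) (step ys)))
      ... | no  _ = trans (+-exchange (length (filter (λ y → R? y x) ys)) (length (filter (R? y) xs)) _)
                          (cong (length (filter (R? y) xs) +_) (step ys))

-- The greedy covering argument

module Greedy {A B : Set} {R : B → A → Set} (R? : ∀ b a → Dec (R b a))
              (b₀ : B) (bs₀ : List B) (T : ℕ) where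

  -- `T` stands for |P|/S: by averaging, some element of the pool covers at least a fraction 1/T of
  -- any rich set.
  Rich : List A → Set
  Rich X = ∀ {x} → x ∈ X → length (b₀ ∷ bs₀) ≤ T * length (filter (λ b → R? b x) (b₀ ∷ bs₀))

  Partial : List A → List B → List A → Set
  Partial X bs X′ = (∀ {x} → x ∈ X′ → x ∈ X) × (∀ {x} → x ∈ X → x ∈ X′ ⊎ Any (λ b → R b x) bs)

  pick : ∀ X → Rich X → ∃[ b ] length X ≤ T * length (filter (R? b) X)
  pick X rich = ∃-≥average b₀ bs₀ _ (length X) (begin
    length P * length X                                    ≡⟨ *-comm (length P) (length X) ⟩
    length X * length P                                    ≡⟨ ∑-const X (length P) ⟨
    ∑ X (λ _ → length P)                                   ≤⟨ ∑-mono X rich ⟩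
    ∑ X (λ x → T * length (filter (λ b → R? b x) P))       ≡⟨ T-out X (λ x → length (filter (λ b → R? b x) P)) ⟩
    T * ∑ X (λ x → length (filter (λ b → R? b x) P))       ≡⟨ cong (T *_) (count-swap R? X P) ⟩
    T * ∑ P (λ b → length (filter (R? b) X))               ≡⟨ T-out P (λ b → length (filter (R? b) X)) ⟨
    ∑ P (λ b → T * length (filter (R? b) X))               ∎)
    where
    open ≤-Reasoning
    P = b₀ ∷ bs₀
    T-out : ∀ {C : Set} (xs : List C) g → ∑ xs (λ x → T * g x) ≡ T * ∑ xs g
    T-out []       g = sym (*-zeroʳ T)
    T-out (x ∷ xs) g = trans (cong (T * g x +_) (T-out xs g)) (sym (*-distribˡ-+ T (g x) _))

  -- Each pick covers at least 1/T of what is uncovered at that moment, hence at least |X′|/T for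
  -- the final remainder X′. Adding up t picks gives this linear invariant, which for t = T already
  -- halves X and avoids powers of 1 - 1/T.
  picks : ∀ t X → Rich X → ∃₂ λ bs X′ → length bs ≡ t × Partial X bs X′ ×
          T * length X′ + t * length X′ ≤ T * length X
  picks zero    X rich = [] , X , refl , (id , inj₁) , ≤-reflexive (+-identityʳ _)
  picks (suc t) X rich with picks t X rich
  ... | bs , X′ , refl , (sub , cov) , bound with pick X′ (rich ∘ sub)
  ... | b , gain = b ∷ bs , X″ , refl , (sub ∘ proj₁ ∘ ∈-filter⁻ _ , cov′) , (begin
      T * length X″ + (length X″ + t * length X″)   ≤⟨ +-monoʳ-≤ (T * length X″) (+-mono-≤ X″≤X′ (*-monoʳ-≤ t X″≤X′)) ⟩
      T * length X″ + (length X′ + t * length X′)   ≤⟨ +-monoʳ-≤ (T * length X″) (+-monoˡ-≤ _ gain) ⟩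
      T * length X″ + (T * covered + t * length X′) ≡⟨ lemma T (length X″) covered (t * length X′) ⟩
      T * (covered + length X″) + t * length X′     ≡⟨ cong (λ l → T * l + t * length X′) (length-split (R? b) X′) ⟨
      T * length X′ + t * length X′                 ≤⟨ bound ⟩
      T * length X                                  ∎)
    where
    open ≤-Reasoning
    X″ = filter (¬? ∘ R? b) X′
    covered = length (filter (R? b) X′)
    X″≤X′ : length X″ ≤ length X′
    X″≤X′ = length-filter (¬? ∘ R? b) X′
    lemma : ∀ T u c r → T * u + (T * c + r) ≡ T * (c + u) + r
    lemma = solve-∀
    cov′ : ∀ {x} → x ∈ X → x ∈ X″ ⊎ Any (λ b → R b x) (b ∷ bs)
    cov′ {x} x∈X with cov x∈X
    ... | inj₂ any = inj₂ (there any)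
    ... | inj₁ x∈X′ with R? b x
    ...   | yes r = inj₂ (here r)
    ...   | no ¬r = inj₁ (∈-filter⁺ (¬? ∘ R? b) x∈X′ ¬r)

  halve : .{{NonZero T}} → ∀ X → Rich X → ∃₂ λ bs X′ → length bs ≡ T × Partial X bs X′ ×
          2 * length X′ ≤ length X
  halve X rich with picks T X rich
  ... | bs , X′ , eq , part , bound = bs , X′ , eq , part ,
    *-cancelˡ-≤ T (≤-trans (≤-reflexive (lemma T (length X′))) bound)
    where
    lemma : ∀ T u → T * (2 * u) ≡ T * u + T * u
    lemma = solve-∀

  halvings : .{{NonZero T}} → ∀ k X → Rich X → ∃₂ λ bs X′ → length bs ≡ k * T × Partial X bs X′ ×
             2 ^ k * length X′ ≤ length X
  halvings zero    X rich = [] , X , refl , (id , inj₁) , ≤-reflexive (+-identityʳ _)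
  halvings (suc k) X rich with halve X rich
  ... | bs , X′ , eq , (sub , cov) , bound with halvings k X′ (rich ∘ sub)
  ... | bs′ , X″ , eq′ , (sub′ , cov′) , bound′ =
    bs ++ bs′ , X″ , trans (length-++ bs) (cong₂ _+_ eq eq′) , (sub ∘ sub′ , cov″) , (begin
      2 * 2 ^ k * length X″     ≡⟨ *-assoc 2 (2 ^ k) _ ⟩
      2 * (2 ^ k * length X″)   ≤⟨ *-monoʳ-≤ 2 bound′ ⟩
      2 * length X′             ≤⟨ bound ⟩
      length X                  ∎)
    where
    open ≤-Reasoning
    cov″ : ∀ {x} → x ∈ X → x ∈ X″ ⊎ Any (λ b → R b x) (bs ++ bs′)
    cov″ x∈X with cov x∈X
    ... | inj₂ any = inj₂ (Anyₚ.++⁺ˡ any)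
    ... | inj₁ x∈X′ with cov′ x∈X′
    ...   | inj₁ x∈X″ = inj₁ x∈X″
    ...   | inj₂ any  = inj₂ (Anyₚ.++⁺ʳ bs any)

-- Primes and prime components

∃-prime-factor : ∀ n → 2 ≤ n → ∃[ p ] (Prime p × p ∣ n)
∃-prime-factor n@(suc _) 2≤n with Factorisation.factorise n
... | record { factors = [] ; isFactorisation = eq } = contradiction 2≤n (λ le → <-irrefl (sym eq) le)
... | record { factors = p ∷ ps ; isFactorisation = eq ; factorsPrime = prime-p ∷ _ } =
  p , prime-p , subst (p ∣_) (sym eq) (m∣m*n _)

prime⇒2≤ : ∀ {p} → Prime p → 2 ≤ p
prime⇒2≤ prime-p = nonTrivial⇒n>1 _ {{prime⇒nonTrivial prime-p}}

prime∣prime⇒≡ : ∀ {p q} → Prime p → Prime q → p ∣ q → p ≡ q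
prime∣prime⇒≡ prime-p prime-q p∣q with prime⇒irreducible prime-q p∣q
... | inj₁ refl = contradiction prime-p ¬prime[1]
... | inj₂ p≡q  = p≡q

∤⇒coprime : ∀ {n a} .{{_ : NonZero n}} → (∀ {p} → Prime p → p ∣ n → ¬ p ∣ a) → Coprime a n
∤⇒coprime {n} {a} h {d} (d∣a , d∣n) with d ≤? 1
∤⇒coprime {n} {a} h {0} (d∣a , d∣n) | yes _ = contradiction (0∣⇒≡0 d∣n) (≢-nonZero⁻¹ n)
∤⇒coprime {n} {a} h {1} (d∣a , d∣n) | yes _ = refl
∤⇒coprime {n} {a} h {suc (suc d)} (d∣a , d∣n) | yes (s≤s ())
... | no d≰1 with ∃-prime-factor d (≰⇒> d≰1)
...   | p , prime-p , p∣d = contradiction (∣-trans p∣d d∣a) (h prime-p (∣-trans p∣d d∣n))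

prime∣product⇒∈ : ∀ {p} ps → Prime p → All Prime ps → p ∣ product ps → p ∈ ps
prime∣product⇒∈ [] prime-p [] p∣1 = contradiction (subst Prime (∣1⇒≡1 p∣1) prime-p) ¬prime[1]
prime∣product⇒∈ (q ∷ ps) prime-p (prime-q ∷ primes) p∣ with euclidsLemma q (product ps) prime-p p∣
... | inj₁ p∣q = here (prime∣prime⇒≡ prime-p prime-q p∣q)
... | inj₂ p∣ps = there (prime∣product⇒∈ ps prime-p primes p∣ps)

product∣ : ∀ {n} ps → Unique ps → All Prime ps → All (_∣ n) ps → product ps ∣ n
product∣ {n} [] _ _ _ = 1∣ n
product∣ {n} (p ∷ ps) (p∉ps ∷ ps!) (prime-p ∷ primes) (p∣n ∷ ps∣n) with product∣ ps ps! primes ps∣n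
... | divides c refl with euclidsLemma c (product ps) prime-p p∣n
...   | inj₁ p∣c  = *-pres-∣ p∣c ∣-refl
...   | inj₂ p∣ps = contradiction refl (All.lookup p∉ps (prime∣product⇒∈ ps prime-p primes p∣ps))

m<2^m : ∀ m → m < 2 ^ m
m<2^m zero    = s≤s z≤n
m<2^m (suc m) = begin-strict
  suc m            ≤⟨ m<2^m m ⟩
  2 ^ m            <⟨ m<m+n (2 ^ m) (m^n>0 2 m) ⟩
  2 ^ m + 2 ^ m    ≡⟨ cong (2 ^ m +_) (+-identityʳ _) ⟨
  2 * 2 ^ m        ∎
  where open ≤-Reasoning

n<p^n : ∀ {p} n → 2 ≤ p → n < p ^ n
n<p^n n 2≤p = <-≤-trans (m<2^m n) (^-monoˡ-≤ n 2≤p)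

stripPrime : ∀ {p} → Prime p → ∀ a → .{{NonZero a}} →
             ∃₂ λ v r → a ≡ p ^ v * r × ¬ p ∣ r
stripPrime {p} prime-p = <-rec (λ a → .{{NonZero a}} → ∃₂ λ v r → a ≡ p ^ v * r × ¬ p ∣ r) go
  where
  go : ∀ a → (∀ {b} → b < a → .{{NonZero b}} → ∃₂ λ v r → b ≡ p ^ v * r × ¬ p ∣ r) →
       .{{NonZero a}} → ∃₂ λ v r → a ≡ p ^ v * r × ¬ p ∣ r
  go a rec with p ∣? a
  ... | no  p∤a = 0 , a , sym (+-identityʳ a) , p∤a
  ... | yes (divides zero refl) = contradiction refl (≢-nonZero⁻¹ 0)
  ... | yes (divides b@(suc _) refl) with rec {b} (m<m*n b p (prime⇒2≤ prime-p))
  ...   | v , r , eq , p∤r = suc v , r , trans (cong (_* p) eq) (lemma (p ^ v) r p) , p∤r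
    where
    lemma : ∀ a r p → a * r * p ≡ p * a * r
    lemma = solve-∀

largestExponent : ℕ → ℕ → ℕ → ℕ
largestExponent X p zero    = 0
largestExponent X p (suc j) with p ^ suc j ≤? X
... | yes _ = suc j
... | no  _ = largestExponent X p j

-- The fuel X suffices because X < p ^ X when p ≥ 2.
primePower : ℕ → ℕ → ℕ
primePower X p = p ^ largestExponent X p X

module _ (X p : ℕ) where

  largestExponent-≤ : ∀ j → 1 ≤ X → p ^ largestExponent X p j ≤ X
  largestExponent-≤ zero    1≤X = 1≤X
  largestExponent-≤ (suc j) 1≤X with p ^ suc j ≤? X
  ... | yes le = le
  ... | no  _  = largestExponent-≤ j 1≤X

  largestExponent-max : ∀ {i} j → i ≤ j → p ^ i ≤ X → i ≤ largestExponent X p j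
  largestExponent-max zero    i≤j le = i≤j
  largestExponent-max {i} (suc j) i≤j le with p ^ suc j ≤? X
  ... | yes _ = i≤j
  ... | no ¬le = largestExponent-max j (s≤s⁻¹ (≤∧≢⇒< i≤j λ { refl → ¬le le })) le

  primePower-≤ : 1 ≤ X → primePower X p ≤ X
  primePower-≤ = largestExponent-≤ X

  primePower-max : ∀ i → 2 ≤ p → p ^ i ≤ X → i ≤ largestExponent X p X
  primePower-max i 2≤p le = largestExponent-max X (<⇒≤ (<-≤-trans (n<p^n i 2≤p) le)) le

  primePower-> : 2 ≤ p → X < p * primePower X p
  primePower-> 2≤p = ≰⇒> λ le → <-irrefl refl (primePower-max (suc (largestExponent X p X)) 2≤p le)

^-∣ : ∀ p {i j} → i ≤ j → p ^ i ∣ p ^ j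
^-∣ p {i} {j} i≤j = subst (p ^ i ∣_)
  (trans (sym (^-distribˡ-+-* p i (j ∸ i))) (cong (p ^_) (m+[n∸m]≡n i≤j))) (m∣m*n _)

-- Compare exponents prime by prime: either one of them exceeds that of `primePower X p`, or all
-- fit. For a ≤ X the first alternative is impossible, so the product is a common multiple of 1,
-- ..., X; for a gcd it exhibits a large prime power.
∣product-primePower : ∀ X ps → All Prime ps → ∀ a → .{{NonZero a}} →
  (∀ {q} → Prime q → q ∣ a → q ∈ ps) →
  Any (λ p → p * primePower X p ∣ a) ps ⊎ a ∣ product (map (primePower X) ps)
∣product-primePower X [] [] a only with a ≤? 1
∣product-primePower X [] [] 1 only | yes _ = inj₂ ∣-refl
∣product-primePower X [] [] (suc (suc _)) only | yes (s≤s ())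
... | no a≰1 with ∃-prime-factor a (≰⇒> a≰1)
...   | q , prime-q , q∣a with only prime-q q∣a
...     | ()
∣product-primePower X (p ∷ ps) (prime-p ∷ primes) a only with stripPrime prime-p a
... | v , r , refl , p∤r with v ≤? largestExponent X p X
...   | no v≰ = inj₁ (here (∣-trans (^-∣ p (≰⇒> v≰)) (m∣m*n r)))
...   | yes v≤ = combine (∣product-primePower X ps primes r {{r≢0}} only′)
  where
  r≢0 : NonZero r
  r≢0 = ≢-nonZero λ { refl → p∤r (p ∣0) }
  only′ : ∀ {q} → Prime q → q ∣ r → q ∈ ps
  only′ prime-q q∣r with only prime-q (∣n⇒∣m*n (p ^ v) q∣r)
  ... | here refl = contradiction q∣r p∤r
  ... | there q∈  = q∈
  combine : Any (λ q → q * primePower X q ∣ r) ps ⊎ r ∣ product (map (primePower X) ps) →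
            Any (λ q → q * primePower X q ∣ p ^ v * r) (p ∷ ps) ⊎
            p ^ v * r ∣ product (map (primePower X) (p ∷ ps))
  combine (inj₁ any) = inj₁ (there (Any.map (∣n⇒∣m*n (p ^ v)) any))
  combine (inj₂ r∣)  = inj₂ (*-pres-∣ (^-∣ p v≤) r∣)

-- Chebyshev's lower bound, for primes not dividing a given number

-- (m + 1)(m + 2)⋯(m + k + 1), that is (m + k + 1)!/m!.
rising : ℕ → ℕ → ℕ
rising m zero    = suc m
rising m (suc k) = rising m k * (2 + m + k)

rising-sucˡ : ∀ m k → rising m (suc k) ≡ suc m * rising (suc m) k
rising-sucˡ m zero    = cong (λ t → suc m * suc (suc t)) (+-identityʳ m)
rising-sucˡ m (suc k) = begin
  rising m (suc k) * (2 + m + suc k)          ≡⟨ cong (_* (2 + m + suc k)) (rising-sucˡ m k) ⟩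
  suc m * rising (suc m) k * (2 + m + suc k)  ≡⟨ *-assoc (suc m) (rising (suc m) k) _ ⟩
  suc m * (rising (suc m) k * (2 + m + suc k)) ≡⟨ cong (λ t → suc m * (rising (suc m) k * (2 + t))) (+-suc m k) ⟩
  suc m * (rising (suc m) k * (2 + suc m + k)) ∎
  where open ≡-Reasoning

-- With 1/B(m,k) = ∫₀¹ x^m (1-x)^k dx, that is B(m,k) = rising m k / k!, this
-- says B(m,k) ∣ M; the induction is 1/B(m,k+1) = 1/B(m,k) - 1/B(m+1,k).
rising∣ : ∀ {X M} → (∀ {a} → 1 ≤ a → a ≤ X → a ∣ M) →
          ∀ k m → suc (m + k) ≤ X → rising m k ∣ M * k !
rising∣ h zero    m le = subst (_ ∣_) (sym (*-identityʳ _))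
  (h (s≤s z≤n) (≤-trans (s≤s (≤-reflexive (sym (+-identityʳ m)))) le))
rising∣ {X} {M} h (suc k) m le =
  subst (rising m (suc k) ∣_) (lemma₃ M k (k !))
    (∣m+n∣m⇒∣n {m = M * k ! * suc m} (subst (rising m (suc k) ∣_) (lemma₂ M (k !) m k) d₁) d₂)
  where
  d₁ : rising m (suc k) ∣ M * k ! * (2 + m + k)
  d₁ = *-pres-∣ (rising∣ h k m (≤-trans (s≤s (+-monoʳ-≤ m (n≤1+n k))) le)) ∣-refl
  d₂ : rising m (suc k) ∣ M * k ! * suc m
  d₂ = subst₂ _∣_ (sym (rising-sucˡ m k)) (*-comm (suc m) (M * k !))
    (*-pres-∣ (∣-refl {suc m}) (rising∣ h k (suc m) (subst (λ t → suc t ≤ X) (+-suc m k) le)))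
  lemma₂ : ∀ M f m k → M * f * (2 + m + k) ≡ M * f * suc m + M * f * suc k
  lemma₂ = solve-∀
  lemma₃ : ∀ M k f → M * f * suc k ≡ M * (f + k * f)
  lemma₃ = solve-∀

-- The quotient `rising N N` / N! is (2N + 1)!/N!², and its successive ratio (2N + 2)(2N + 3)/(N +
-- 1)² is at least 4. In integral form: x(1 - x) ≤ 1/4 on [0,1].
4^N*N!≤rising : ∀ N → 4 ^ N * N ! ≤ rising N N
4^N*N!≤rising zero    = ≤-refl
4^N*N!≤rising (suc N) = *-cancelˡ-≤ (suc N) (begin
  suc N * (4 * 4 ^ N * (N ! + N * N !))           ≡⟨ lemma₁ N (4 ^ N) (N !) ⟩
  4 ^ N * N ! * ((2 + N + N) * (2 + N + N))       ≤⟨ ℕₚ.*-mono-≤ (4^N*N!≤rising N) (*-monoʳ-≤ (2 + N + N) (n≤1+n (2 + N + N))) ⟩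
  rising N N * ((2 + N + N) * (3 + N + N))        ≡⟨ *-assoc (rising N N) _ _ ⟨
  rising N (suc N) * (3 + N + N)                  ≡⟨ cong (_* (3 + N + N)) (rising-sucˡ N N) ⟩
  suc N * rising (suc N) N * (2 + suc N + N)      ≡⟨ *-assoc (suc N) (rising (suc N) N) _ ⟩
  suc N * (rising (suc N) N * (2 + suc N + N))    ∎)
  where
  open ≤-Reasoning
  lemma₁ : ∀ N q f → suc N * (4 * q * (f + N * f)) ≡ q * f * ((2 + N + N) * (2 + N + N))
  lemma₁ = solve-∀

-- Nair's bound for lcm(1, ..., 2N + 1), from the Beta integral with m = k = N.
4^N≤commonMultiple : ∀ N {M} → 1 ≤ M → (∀ {a} → 1 ≤ a → a ≤ suc (N + N) → a ∣ M) → 4 ^ N ≤ M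
4^N≤commonMultiple N {M@(suc _)} 1≤M h = *-cancelʳ-≤ (4 ^ N) M (N !) {{N !≢0}} (begin
  4 ^ N * N !   ≤⟨ 4^N*N!≤rising N ⟩
  rising N N    ≤⟨ ∣⇒≤ {{m*n≢0 M (N !) {{_}} {{N !≢0}}}} (rising∣ h N N ≤-refl) ⟩
  M * N !       ∎)
  where open ≤-Reasoning

-- Bounding a common multiple by the number of primes not dividing n

primesUpTo : ℕ → List ℕ
primesUpTo X = filter prime? (downFrom (suc X))

∈-primesUpTo⁺ : ∀ {X p} → Prime p → p ≤ X → p ∈ primesUpTo X
∈-primesUpTo⁺ prime-p p≤X = ∈-filter⁺ prime? (∈-downFrom⁺ (s≤s p≤X)) prime-p

∈-primesUpTo⁻ : ∀ {X p} → p ∈ primesUpTo X → Prime p × p ≤ X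
∈-primesUpTo⁻ {X} p∈ with ∈-filter⁻ prime? {xs = downFrom (suc X)} p∈
... | p∈down , prime-p = prime-p , s≤s⁻¹ (∈-downFrom⁻ p∈down)

primesUpTo-unique : ∀ X → Unique (primesUpTo X)
primesUpTo-unique X = Uniqueₚ.filter⁺ prime? (Uniqueₚ.downFrom⁺ (suc X))

-- The condition p > √X keeps `primePower X p` down to p, and in `PrimeMultiples` makes p exceed its
-- cofactor k.
FreshLargePrime : ℕ → ℕ → ℕ → Set
FreshLargePrime n X p = X < p * p × ¬ p ∣ n

freshLargePrime? : ∀ n X → Decidable (FreshLargePrime n X)
freshLargePrime? n X p = X <? p * p ×-dec ¬? (p ∣? n)

freshLargePrimes : ℕ → ℕ → List ℕ
freshLargePrimes n X = filter (freshLargePrime? n X) (primesUpTo X)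

small? : ∀ X → Decidable (λ p → p * p ≤ X)
small? X p = p * p ≤? X

∃-sqrt : ∀ X → ∃[ s ] (s * s ≤ X × X < suc s * suc s)
∃-sqrt zero    = 0 , z≤n , s≤s z≤n
∃-sqrt (suc X) with ∃-sqrt X
... | s , s²≤X , X<s⁺² with suc X <? suc s * suc s
...   | yes lt = s , m≤n⇒m≤1+n s²≤X , lt
...   | no ¬lt = suc s , ≮⇒≥ ¬lt , ≤-<-trans X<s⁺² (ℕₚ.*-mono-< (n<1+n (suc s)) (n<1+n (suc s)))

smallPrimes-bound : ∀ X → let s = length (filter (small? X) (primesUpTo X)) in s * s ≤ X
smallPrimes-bound X with ∃-sqrt X
... | t , t²≤X , X<t⁺² = ≤-trans (ℕₚ.*-mono-≤ s≤t s≤t) t²≤X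
  where
  s≤t : length (filter (small? X) (primesUpTo X)) ≤ t
  s≤t = s≤s⁻¹ (begin
    -- The non-prime 0 is adjoined to the small primes, which sharpens the bound from t + 1 to t.
    suc (length (filter (small? X) (primesUpTo X)))  ≤⟨ length-⊆ {ys = downFrom (suc t)}
      (All.tabulate (λ { p∈ refl → ¬prime[0] (proj₁ (∈-primesUpTo⁻ {X} (proj₁ (∈-filter⁻ (small? X) p∈)))) })
        ∷ Uniqueₚ.filter⁺ (small? X) (primesUpTo-unique X))
      (λ { (here refl) → ∈-downFrom⁺ (s≤s z≤n)
         ; (there p∈) → ∈-downFrom⁺ (≮⇒≥ λ t⁺<p → <-irrefl refl (<-≤-trans X<t⁺²
             (≤-trans (ℕₚ.*-mono-≤ (s≤s⁻¹ t⁺<p) (s≤s⁻¹ t⁺<p)) (proj₂ (∈-filter⁻ (small? X) {xs = primesUpTo X} p∈))))) }) ⟩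
    length (downFrom (suc t))                        ≡⟨ length-downFrom (suc t) ⟩
    suc t                                            ∎)
    where open ≤-Reasoning

-- Primes up to √X contribute at most X each, the larger ones contribute
-- themselves, and those of the latter that divide n multiply to at most n.
product-primePower-≤ : ∀ n X .{{_ : NonZero n}} → 1 ≤ X →
  product (map (primePower X) (primesUpTo X)) ≤
  X ^ (length (filter (small? X) (primesUpTo X)) + length (freshLargePrimes n X)) * n
product-primePower-≤ n X 1≤X = begin
  product (map (primePower X) ps)   ≤⟨ go ps (All.tabulate (proj₁ ∘ ∈-primesUpTo⁻ {X})) ⟩
  X ^ (length (filter (small? X) ps) + length (filter (freshLargePrime? n X) ps)) * product (filter (_∣? n) ps)
    ≤⟨ *-monoʳ-≤ (X ^ (length (filter (small? X) ps) + length (filter (freshLargePrime? n X) ps)))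
        (∣⇒≤ (product∣ (filter (_∣? n) ps) (Uniqueₚ.filter⁺ (_∣? n) (primesUpTo-unique X))
          (All.tabulate (λ p∈ → proj₁ (∈-primesUpTo⁻ {X} (proj₁ (∈-filter⁻ (_∣? n) p∈)))))
          (All.tabulate (λ p∈ → proj₂ (∈-filter⁻ (_∣? n) {xs = ps} p∈))))) ⟩
  X ^ (length (filter (small? X) ps) + length (freshLargePrimes n X)) * n   ∎
  where
  open ≤-Reasoning
  ps = primesUpTo X
  S F : List ℕ → ℕ
  S qs = length (filter (small? X) qs)
  F qs = length (filter (freshLargePrime? n X) qs)
  D : List ℕ → ℕ
  D qs = product (filter (_∣? n) qs)
  instance
    X≢0 : NonZero X
    X≢0 = >-nonZero 1≤X
  large : ∀ {p} → Prime p → X < p * p → primePower X p ≤ p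
  large {p} prime-p X<p² = ≤-trans (^-monoʳ-≤ p {{prime⇒nonZero prime-p}} e≤1) (≤-reflexive (*-identityʳ p))
    where
    e≤1 : largestExponent X p X ≤ 1
    e≤1 = ≮⇒≥ λ 2≤e → <-irrefl refl (<-≤-trans X<p²
      (≤-trans (≤-reflexive (cong (p *_) (sym (*-identityʳ p))))
        (≤-trans (^-monoʳ-≤ p {{prime⇒nonZero prime-p}} 2≤e) (primePower-≤ X p 1≤X))))
  S≤ : ∀ q qs → S qs ≤ S (q ∷ qs)
  S≤ = length-filter-∷ (small? X)
  F≤ : ∀ q qs → F qs ≤ F (q ∷ qs)
  F≤ = length-filter-∷ (freshLargePrime? n X)
  D≤ : ∀ {q} qs → Prime q → D qs ≤ D (q ∷ qs)
  D≤ {q} qs prime-q with q ∣? n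
  ... | yes _ = m≤n*m (D qs) q {{prime⇒nonZero prime-q}}
  ... | no  _ = ≤-refl
  go : ∀ qs → All Prime qs → product (map (primePower X) qs) ≤ X ^ (S qs + F qs) * D qs
  step : ∀ q qs → Prime q → All Prime qs → Dec (q * q ≤ X) → Dec (q ∣ n) →
         primePower X q * product (map (primePower X) qs) ≤ X ^ (S (q ∷ qs) + F (q ∷ qs)) * D (q ∷ qs)
  plain : ∀ q qs → Prime q → All Prime qs → suc (S qs + F qs) ≤ S (q ∷ qs) + F (q ∷ qs) →
          primePower X q * product (map (primePower X) qs) ≤ X ^ (S (q ∷ qs) + F (q ∷ qs)) * D (q ∷ qs)
  go []       []                 = s≤s z≤n
  go (q ∷ qs) (prime-q ∷ primes) = step q qs prime-q primes (small? X q) (q ∣? n)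
  step q qs prime-q primes (no ¬small) (yes q∣n) = begin
    primePower X q * product (map (primePower X) qs)  ≤⟨ ℕₚ.*-mono-≤ (large prime-q (≰⇒> ¬small)) (go qs primes) ⟩
    q * (X ^ (S qs + F qs) * D qs)                    ≡⟨ swap q (X ^ (S qs + F qs)) (D qs) ⟩
    X ^ (S qs + F qs) * (q * D qs)                    ≡⟨ cong (λ ds → X ^ (S qs + F qs) * product ds) (filter-accept (_∣? n) q∣n) ⟨
    X ^ (S qs + F qs) * D (q ∷ qs)                    ≤⟨ *-monoˡ-≤ (D (q ∷ qs)) (^-monoʳ-≤ X (+-mono-≤ (S≤ q qs) (F≤ q qs))) ⟩
    X ^ (S (q ∷ qs) + F (q ∷ qs)) * D (q ∷ qs)        ∎
    where
    swap : ∀ q a d → q * (a * d) ≡ a * (q * d)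
    swap = solve-∀
  step q qs prime-q primes (yes le) _ = plain q qs prime-q primes
    (+-mono-≤ {suc (S qs)} (≤-reflexive (cong length (sym (filter-accept (small? X) {q} {qs} le)))) (F≤ q qs))
  step q qs prime-q primes (no ¬le) (no q∤n) = plain q qs prime-q primes
    (subst (_≤ S (q ∷ qs) + F (q ∷ qs)) (+-suc (S qs) (F qs))
      (+-mono-≤ (S≤ q qs) (≤-reflexive (cong length (sym (filter-accept (freshLargePrime? n X) {q} {qs} (≰⇒> ¬le , q∤n)))))))
  plain q qs prime-q primes counted = begin
    primePower X q * product (map (primePower X) qs)  ≤⟨ ℕₚ.*-mono-≤ (primePower-≤ X q 1≤X) (go qs primes) ⟩
    X * (X ^ (S qs + F qs) * D qs)                    ≡⟨ *-assoc X _ _ ⟨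
    X ^ suc (S qs + F qs) * D qs                      ≤⟨ ℕₚ.*-mono-≤ (^-monoʳ-≤ X counted) (D≤ qs prime-q) ⟩
    X ^ (S (q ∷ qs) + F (q ∷ qs)) * D (q ∷ qs)        ∎

2^-cancel-≤ : ∀ {i j} → 2 ^ i ≤ 2 ^ j → i ≤ j
2^-cancel-≤ {i} {j} h = ≮⇒≥ λ j<i → <-irrefl refl (<-≤-trans (^-monoʳ-< 2 (s≤s (s≤s z≤n)) j<i) h)

m*m≤n*n⇒m≤n : ∀ {m n} → m * m ≤ n * n → m ≤ n
m*m≤n*n⇒m≤n h = ≮⇒≥ λ n<m → <-irrefl refl (<-≤-trans (ℕₚ.*-mono-< n<m n<m) h)

∃-half : ∀ X → 2 ≤ X → ∃[ N ] (suc (N + N) ≤ X × X ≤ 2 + (N + N))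
∃-half (suc zero) (s≤s ())
∃-half (suc (suc zero)) _ = 0 , s≤s z≤n , ≤-refl
∃-half (suc (suc (suc zero))) _ = 1 , ≤-refl , n≤1+n 3
∃-half (suc (suc X@(suc (suc _)))) _ with ∃-half X (s≤s (s≤s z≤n))
... | N , le , le′ = suc N , subst (λ t → suc (suc t) ≤ suc (suc X)) (sym (+-suc N N)) (s≤s (s≤s le))
                           , subst (λ t → suc (suc X) ≤ suc (suc (suc t))) (sym (+-suc N N)) (s≤s (s≤s le′))

-- Take logarithms in 4^N ≤ X^(s + K) n, where 2N + 2 ≥ X, s ≤ √X counts the primes up to √X and K
-- the fresh large ones: X ≤ 2 + μ s + μ K + l. The two hypotheses on X give μ s ≤ X/2 and l + 2 ≤
-- X/8, so at least 3X/8 is left for μ K.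
chebyshev : ∀ n X μ l .{{_ : NonZero n}} → n ≤ 2 ^ l → X ≤ 2 ^ μ → 8 * (l + 2) ≤ X → 4 * (μ * μ) ≤ X →
            X ≤ 4 * μ * length (freshLargePrimes n X)
chebyshev n X μ l n≤ X≤ 8l≤X 4μ²≤X with ∃-half X (≤-trans (≤-trans (m≤n+m 2 l) (m≤n*m (l + 2) 8)) 8l≤X)
... | N , le , le′ = *-cancelˡ-≤ 2 (+-cancelʳ-≤ (6 * X) _ _ (begin
    2 * X + 6 * X                              ≡⟨ e₁ X ⟩
    8 * X                                      ≤⟨ *-monoʳ-≤ 8 le′ ⟩
    8 * (2 + (N + N))                          ≤⟨ *-monoʳ-≤ 8 (+-monoʳ-≤ 2 exponents) ⟩
    8 * (2 + (μ * (s + K) + l))                ≡⟨ e₂ μ s K l ⟩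
    4 * (2 * (μ * s)) + 8 * (μ * K) + 8 * (l + 2)  ≤⟨ +-mono-≤ (+-monoˡ-≤ (8 * (μ * K)) (*-monoʳ-≤ 4 2μs≤X)) 8l≤X ⟩
    4 * X + 8 * (μ * K) + X                    ≤⟨ m≤m+n _ X ⟩
    4 * X + 8 * (μ * K) + X + X                ≡⟨ e₃ X μ K ⟩
    2 * (4 * μ * K) + 6 * X                    ∎))
  where
  open ≤-Reasoning
  s = length (filter (small? X) (primesUpTo X))
  K = length (freshLargePrimes n X)
  1≤X : 1 ≤ X
  1≤X = ≤-trans (s≤s z≤n) le
  instance
    X≢0 : NonZero X
    X≢0 = >-nonZero 1≤X
  e₁ : ∀ X → 2 * X + 6 * X ≡ 8 * X
  e₁ = solve-∀
  e₂ : ∀ μ s K l → 8 * (2 + (μ * (s + K) + l)) ≡ 4 * (2 * (μ * s)) + 8 * (μ * K) + 8 * (l + 2)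
  e₂ = solve-∀
  e₃ : ∀ X μ K → 4 * X + 8 * (μ * K) + X + X ≡ 2 * (4 * μ * K) + 6 * X
  e₃ = solve-∀
  e₄ : ∀ μ s → 2 * (μ * s) * (2 * (μ * s)) ≡ 4 * (μ * μ) * (s * s)
  e₄ = solve-∀
  2μs≤X : 2 * (μ * s) ≤ X
  2μs≤X = m*m≤n*n⇒m≤n (≤-trans (≤-reflexive (e₄ μ s)) (ℕₚ.*-mono-≤ 4μ²≤X (smallPrimes-bound X)))
  M = product (map (primePower X) (primesUpTo X))
  positive : ∀ ps → All Prime ps → 1 ≤ product (map (primePower X) ps)
  positive []       _ = s≤s z≤n
  positive (p ∷ ps) (prime-p ∷ primes) =
    ℕₚ.*-mono-≤ (m^n>0 p {{prime⇒nonZero prime-p}} (largestExponent X p X)) (positive ps primes)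
  primes : All Prime (primesUpTo X)
  primes = All.tabulate (proj₁ ∘ ∈-primesUpTo⁻ {X})
  multiple : ∀ {a} → 1 ≤ a → a ≤ suc (N + N) → a ∣ M
  multiple {a} 1≤a a≤ with ∣product-primePower X (primesUpTo X) primes a {{>-nonZero 1≤a}}
      (λ prime-q q∣a → ∈-primesUpTo⁺ prime-q (≤-trans (∣⇒≤ {{>-nonZero 1≤a}} q∣a) (≤-trans a≤ le)))
  ... | inj₂ a∣M = a∣M
  ... | inj₁ any with find any
  -- A power of p above X cannot divide a ≤ X.
  ...   | p , p∈ , pP∣a = contradiction
    (<-≤-trans (primePower-> X p (prime⇒2≤ (proj₁ (∈-primesUpTo⁻ {X} p∈)))) (≤-trans (∣⇒≤ {{>-nonZero 1≤a}} pP∣a) (≤-trans a≤ le)))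
    (<-irrefl refl)
  exponents : N + N ≤ μ * (s + K) + l
  exponents = 2^-cancel-≤ (begin
    2 ^ (N + N)                ≡⟨ cong (λ t → 2 ^ (N + t)) (+-identityʳ N) ⟨
    2 ^ (2 * N)                ≡⟨ ^-*-assoc 2 2 N ⟨
    4 ^ N                      ≤⟨ 4^N≤commonMultiple N (positive (primesUpTo X) primes) multiple ⟩
    M                          ≤⟨ product-primePower-≤ n X 1≤X ⟩
    X ^ (s + K) * n            ≤⟨ ℕₚ.*-mono-≤ (^-monoˡ-≤ (s + K) X≤) n≤ ⟩
    (2 ^ μ) ^ (s + K) * 2 ^ l  ≡⟨ cong (_* 2 ^ l) (^-*-assoc 2 μ (s + K)) ⟩
    2 ^ (μ * (s + K)) * 2 ^ l  ≡⟨ ^-distribˡ-+-* 2 (μ * (s + K)) l ⟨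
    2 ^ (μ * (s + K) + l)      ∎)

-- Sieving arithmetic progressions

-- Multiples of m are added on both sides, so that no subtraction occurs in ℕ.
Congruent : ℕ → ℕ → ℕ → Set
Congruent m x y = ∃₂ λ i j → x + i * m ≡ y + j * m

inverse : ∀ {a n} .{{_ : NonZero n}} → Coprime a n → ∃[ a′ ] Congruent n (a′ * a) 1
inverse {a} {n@(suc n′)} coprime with coprime-Bézout coprime
... | Bézout.+- x y eq = x , 0 , y , trans (+-identityʳ _) (sym eq)
-- Here 1 + x a = y n, so the inverse is -x, represented by x (n - 1).
... | Bézout.-+ x y eq = x * n′ , y , x * a , (begin
  x * n′ * a + y * n        ≡⟨ cong (x * n′ * a +_) eq ⟨
  x * n′ * a + (1 + x * a)  ≡⟨ lemma x n′ a ⟩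
  1 + x * a * n             ∎)
  where
  open ≡-Reasoning
  lemma : ∀ x n′ a → x * n′ * a + (1 + x * a) ≡ 1 + x * a * suc n′
  lemma = solve-∀

prime⇒coprime : ∀ {p m} → Prime p → ¬ p ∣ m → Coprime m p
prime⇒coprime prime-p p∤m (d∣m , d∣p) with prime⇒irreducible prime-p d∣p
... | inj₁ d≡1  = d≡1
... | inj₂ refl = contradiction d∣m p∤m

linearRoot : ∀ {p m} w → Prime p → ¬ p ∣ m → ∃[ t ] (t < p × p ∣ w + m * t)
linearRoot {zero} w prime-p _ = contradiction prime-p ¬prime[0]
linearRoot {p@(suc p′)} {m} w prime-p p∤m with inverse (prime⇒coprime prime-p p∤m)
... | a , i , j , eq = t DM.% p , DM.m%n<n t p , reduced
  where
  -- This is -w/m modulo p, with p′ = p - 1 in the role of -1.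
  t = a * w * p′
  e₁ : ∀ i w p′ a m → i * w * p′ * suc p′ + (w + m * (a * w * p′)) ≡ w + w * p′ * (a * m + i * suc p′)
  e₁ = solve-∀
  e₂ : ∀ w p′ j → w + w * p′ * (1 + j * suc p′) ≡ (w + w * p′ * j) * suc p′
  e₂ = solve-∀
  root : p ∣ w + m * t
  root = ∣m+n∣m⇒∣n
    (subst (p ∣_) (sym (trans (e₁ i w p′ a m) (trans (cong (λ z → w + w * p′ * z) eq) (e₂ w p′ j))))
      (n∣m*n (w + w * p′ * j)))
    (n∣m*n (i * w * p′))
  e₃ : ∀ w m r q p → w + m * (r + q * p) ≡ m * q * p + (w + m * r)
  e₃ = solve-∀
  reduced : p ∣ w + m * (t DM.% p)
  reduced = ∣m+n∣m⇒∣n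
    (subst (p ∣_) (trans (cong (λ z → w + m * z) (DM.m≡m%n+[m/n]*n t p)) (e₃ w m (t DM.% p) (t DM./ p) p)) root)
    (n∣m*n (m * (t DM./ p)))

linearRoot-unique : ∀ {p m w t u} → Prime p → ¬ p ∣ m → t < p → u < p →
                    p ∣ w + m * t → p ∣ w + m * u → t ≡ u
linearRoot-unique {p} {m} {w} prime-p p∤m t<p u<p p∣t p∣u =
  ≤-antisym (half u<p t<p p∣u p∣t) (half t<p u<p p∣t p∣u)
  where
  e : ∀ w m u d → w + m * (u + d) ≡ w + m * u + m * d
  e = solve-∀
  half : ∀ {u t} → u < p → t < p → p ∣ w + m * u → p ∣ w + m * t → t ≤ u
  half {u} {t} u<p t<p p∣u p∣t with t ≤? u
  ... | yes t≤u = t≤u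
  ... | no  t≰u with t ∸ u in eq | m+[n∸m]≡n (<⇒≤ (≰⇒> t≰u))
  ...   | zero  | eq′ = contradiction (≤-reflexive (trans (sym eq′) (+-identityʳ u))) t≰u
  ...   | suc d | refl with euclidsLemma m (suc d) prime-p (∣m+n∣m⇒∣n (subst (p ∣_) (e w m u (suc d)) p∣t) p∣u)
  ...     | inj₁ p∣m = contradiction p∣m p∤m
  ...     | inj₂ p∣d = contradiction (≤-trans (s≤s (≤-trans (∣⇒≤ p∣d) (m≤n+m (suc d) u))) t<p) (<-irrefl refl)

Avoids : List ℕ → ℕ → Set
Avoids ps b = All (λ p → ¬ p ∣ b) ps

avoids? : ∀ ps → Decidable (Avoids ps)
avoids? ps b = all? (λ p → ¬? (p ∣? b)) ps

length-≡ : ∀ {xs ys : List ℕ} → Unique xs → Unique ys →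
           (∀ {x} → x ∈ xs → x ∈ ys) → (∀ {x} → x ∈ ys → x ∈ xs) → length xs ≡ length ys
length-≡ xs! ys! sub sup = ≤-antisym (length-⊆ xs! sub) (length-⊆ ys! sup)

-- For distinct primes this is Euler's φ of `product ps`; its ratio to `product ps` is ∏ (1 - 1/p).
totient : List ℕ → ℕ
totient ps = product (map pred ps)

-- Among the t counted for ps, those with p ∣ w + m t form, by the substitution
-- t = t₀ + p s, a progression of the same kind with modulus m p.
module SieveStep (p : ℕ) .{{p≢0 : NonZero p}} (ps : List ℕ) (prime-p : Prime p) (w m t₀ T T′ : ℕ)
                 (p∤m : ¬ p ∣ m) (t₀<p : t₀ < p) (p∣root : p ∣ w + m * t₀)
                 (T-decomp : T ≡ p * T′) where

  g : ℕ → ℕ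
  g t = w + m * t
  shift : ℕ → ℕ
  shift s = t₀ + p * s
  P? : Decidable (λ t → Avoids ps (g t))
  P? t = avoids? ps (g t)
  P⁺? : Decidable (λ t → Avoids (p ∷ ps) (g t))
  P⁺? t = avoids? (p ∷ ps) (g t)
  D? : Decidable (λ t → p ∣ g t)
  D? t = p ∣? g t
  Q? : Decidable (λ s → Avoids ps (w + m * t₀ + m * p * s))
  Q? s = avoids? ps (w + m * t₀ + m * p * s)
  all new old hit : List ℕ
  all = filter P? (downFrom T)
  new = filter P⁺? (downFrom T)
  hit = filter D? all
  old = filter Q? (downFrom T′)
  all! : Unique all
  all! = Uniqueₚ.filter⁺ P? (Uniqueₚ.downFrom⁺ T)
  g-shift : ∀ s → g (shift s) ≡ w + m * t₀ + m * p * s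
  g-shift s = lemma w m t₀ p s
    where
    lemma : ∀ w m t p s → w + m * (t + p * s) ≡ w + m * t + m * p * s
    lemma = solve-∀
  hit⇒ : ∀ {t} → t ∈ hit → t ∈ map shift old
  hit⇒ {t} t∈ with ∈-filter⁻ D? {xs = all} t∈
  ... | t∈all , p∣gt with ∈-filter⁻ P? {xs = downFrom T} t∈all
  ...   | t∈T , avoids = subst (_∈ map shift old) t-eq
    (∈-map⁺ shift (∈-filter⁺ Q? (∈-downFrom⁺ s<T′) (subst (Avoids ps) (trans (cong g (sym t-eq)) (g-shift s)) avoids)))
    where
    s = t DM./ p
    r = t DM.% p
    lemma : ∀ w m r s p → w + m * (r + s * p) ≡ m * s * p + (w + m * r)
    lemma = solve-∀
    r≡t₀ : r ≡ t₀
    r≡t₀ = linearRoot-unique {w = w} prime-p p∤m (DM.m%n<n t p) t₀<p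
      (∣m+n∣m⇒∣n (subst (p ∣_) (trans (cong g (DM.m≡m%n+[m/n]*n t p)) (lemma w m r s p)) p∣gt) (n∣m*n (m * s))) p∣root
    t-eq : shift s ≡ t
    t-eq = trans (cong₂ _+_ (sym r≡t₀) (*-comm p s)) (sym (DM.m≡m%n+[m/n]*n t p))
    s<T′ : s < T′
    s<T′ = DM.m<n*o⇒m/o<n (<-≤-trans (∈-downFrom⁻ t∈T) (≤-reflexive (trans T-decomp (*-comm p T′))))
  ⇒hit : ∀ {s} → s ∈ old → shift s ∈ hit
  ⇒hit {s} s∈ with ∈-filter⁻ Q? {xs = downFrom T′} s∈
  ... | s∈T′ , avoids = ∈-filter⁺ D? (∈-filter⁺ P? (∈-downFrom⁺ shift<T) (subst (Avoids ps) (sym (g-shift s)) avoids))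
    (subst (p ∣_) (sym (g-shift s)) (∣m∣n⇒∣m+n p∣root (∣m⇒∣m*n s (n∣m*n m))))
    where
    shift<T : shift s < T
    shift<T = <-≤-trans (+-monoˡ-< (p * s) t₀<p)
      (≤-trans (≤-reflexive (sym (*-suc p s))) (≤-trans (*-monoʳ-≤ p (∈-downFrom⁻ s∈T′)) (≤-reflexive (sym T-decomp))))
  hit≡old : length hit ≡ length old
  hit≡old = ≤-antisym
    (≤-trans (length-⊆ (Uniqueₚ.filter⁺ D? all!) hit⇒) (≤-reflexive (length-map shift old)))
    (length-inj shift (Uniqueₚ.filter⁺ Q? (Uniqueₚ.downFrom⁺ T′)) ⇒hit
      (λ _ _ eq → *-cancelˡ-≡ _ _ p (+-cancelˡ-≡ t₀ _ _ eq)))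
  rest≡new : length (filter (¬? ∘ D?) all) ≡ length new
  rest≡new = length-≡ (Uniqueₚ.filter⁺ (¬? ∘ D?) all!) (Uniqueₚ.filter⁺ P⁺? (Uniqueₚ.downFrom⁺ T))
    (λ t∈ → let t∈all , p∤ = ∈-filter⁻ (¬? ∘ D?) {xs = all} t∈
                t∈T , avoids = ∈-filter⁻ P? {xs = downFrom T} t∈all
            in ∈-filter⁺ P⁺? t∈T (p∤ ∷ avoids))
    (λ t∈ → let t∈T , avoids = ∈-filter⁻ P⁺? {xs = downFrom T} t∈
            in ∈-filter⁺ (¬? ∘ D?) (∈-filter⁺ P? t∈T (All.tail avoids)) (All.head avoids))
  split : length all ≡ length old + length new
  split = trans (length-split D? all) (cong₂ _+_ hit≡old rest≡new)

-- Legendre's sieve, free of error terms because `product ps` divides `T`. The induction hypothesis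
-- counts both `all`, over T terms, and `old`, over T/p terms of a progression modulo m p; the count
-- wanted is their difference, a share (p - 1)/p of `all`.
progressionSieve : ∀ ps → Unique ps → All Prime ps → ∀ w m T → Avoids ps m → product ps ∣ T →
  length (filter (λ t → avoids? ps (w + m * t)) (downFrom T)) * product ps ≡ T * totient ps
progressionSieve [] _ _ w m T _ _ =
  cong (_* 1) (trans (length-≡ (Uniqueₚ.filter⁺ P? (Uniqueₚ.downFrom⁺ T)) (Uniqueₚ.downFrom⁺ T)
    (proj₁ ∘ ∈-filter⁻ P?) (λ t∈ → ∈-filter⁺ P? t∈ [])) (length-downFrom T))
  where
  P? : Decidable (λ t → Avoids [] (w + m * t))
  P? t = avoids? [] (w + m * t)
progressionSieve (p ∷ ps) (p∉ps ∷ ps!) (prime-p ∷ primes) w m T (p∤m ∷ ps∤m) (divides c T-eq)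
  with linearRoot w prime-p p∤m
... | t₀ , t₀<p , p∣root = begin
  N * (p * Π)                 ≡⟨ e₁ N p Π ⟩
  p * (N * Π)                 ≡⟨ cong (p *_) new*Π ⟩
  p * (pred p * (T′ * V))     ≡⟨ e₂ p (pred p) T′ V ⟩
  p * T′ * (pred p * V)       ≡⟨ cong (_* (pred p * V)) T-decomp ⟨
  T * (pred p * V)            ∎
  where
  open ≡-Reasoning
  instance
    p≢0 : NonZero p
    p≢0 = prime⇒nonZero prime-p
  Π = product ps
  V = totient ps
  T′ = c * Π
  e₁ : ∀ a p Π → a * (p * Π) ≡ p * (a * Π)
  e₁ = solve-∀
  e₂ : ∀ p p′ T′ V → p * (p′ * (T′ * V)) ≡ p * T′ * (p′ * V)
  e₂ = solve-∀
  T-decomp : T ≡ p * T′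
  T-decomp = trans T-eq (e₁ c p Π)
  open SieveStep p ps prime-p w m t₀ T T′ p∤m t₀<p p∣root T-decomp using (all; old; new; split)
  N = length new
  q∤mp : Avoids ps (m * p)
  q∤mp = All.tabulate λ {q} q∈ q∣mp → case q∈ (euclidsLemma m p (All.lookup primes q∈) q∣mp)
    where
    case : ∀ {q} → q ∈ ps → q ∣ m ⊎ q ∣ p → ⊥
    case q∈ (inj₁ q∣m) = All.lookup ps∤m q∈ q∣m
    case q∈ (inj₂ q∣p) = All.lookup p∉ps q∈ (sym (prime∣prime⇒≡ (All.lookup primes q∈) prime-p q∣p))
  all*Π : length all * Π ≡ p * T′ * V
  all*Π = trans (progressionSieve ps ps! primes w m T ps∤m (divides (c * p) (trans T-eq (sym (*-assoc c p Π))))) (cong (_* V) T-decomp)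
  old*Π : length old * Π ≡ T′ * V
  old*Π = progressionSieve ps ps! primes (w + m * t₀) (m * p) T′ q∤mp (divides c refl)
  new*Π : N * Π ≡ pred p * (T′ * V)
  new*Π = +-cancelˡ-≡ (T′ * V) _ _ (begin
    T′ * V + N * Π                 ≡⟨ cong (_+ N * Π) old*Π ⟨
    length old * Π + N * Π         ≡⟨ *-distribʳ-+ Π (length old) N ⟨
    (length old + N) * Π           ≡⟨ cong (_* Π) split ⟨
    length all * Π                 ≡⟨ all*Π ⟩
    p * T′ * V                     ≡⟨ *-assoc p T′ V ⟩
    p * (T′ * V)                   ≡⟨ cong (_* (T′ * V)) (suc-pred p) ⟨
    T′ * V + pred p * (T′ * V)     ∎)

-- Reciprocal sums over integers avoiding given primes

oneTo : ℕ → List ℕ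
oneTo κ = map suc (downFrom κ)

∈-oneTo⁺ : ∀ {κ k} → 1 ≤ k → k ≤ κ → k ∈ oneTo κ
∈-oneTo⁺ {k = suc k} _ k≤κ = ∈-map⁺ suc (∈-downFrom⁺ k≤κ)

∈-oneTo⁻ : ∀ {κ k} → k ∈ oneTo κ → 1 ≤ k × k ≤ κ
∈-oneTo⁻ k∈ with ∈-map⁻ suc k∈
... | i , i∈ , refl = s≤s z≤n , ∈-downFrom⁻ i∈

oneTo-unique : ∀ κ → Unique (oneTo κ)
oneTo-unique κ = Uniqueₚ.map⁺ suc-injective (Uniqueₚ.downFrom⁺ κ)

length-oneTo : ∀ κ → length (oneTo κ) ≡ κ
length-oneTo κ = trans (length-map suc (downFrom κ)) (length-downFrom κ)

-- In this section q k stands for 1/k, scaled by the common factor W.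
module _ (κ W : ℕ) (q : ℕ → ℕ) (qk≡W : ∀ {k} → 1 ≤ k → k ≤ κ → q k * k ≡ W) where

  avoidingSum : List ℕ → ℕ
  avoidingSum ps = ∑ (filter (avoids? ps) (oneTo κ)) q

  -- Dividing by p sends the multiples of p among the k that avoid `ps` injectively into those same
  -- k, and 1/k = (1/p) · 1/(k/p). So the multiples carry at most 1/p of the sum, and discarding
  -- them leaves at least 1 - 1/p of it.
  avoidingSum-≥ : ∀ ps → All Prime ps → Unique ps →
    totient ps * ∑ (oneTo κ) q ≤ product ps * avoidingSum ps
  avoidingSum-≥ [] _ _ = *-monoʳ-≤ 1 (∑-⊆ (oneTo-unique κ) (λ k∈ → ∈-filter⁺ (avoids? []) k∈ []))
  avoidingSum-≥ (zero ∷ _) (prime-0 ∷ _) _ = contradiction prime-0 ¬prime[0]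
  avoidingSum-≥ (p@(suc p′) ∷ ps) (prime-p ∷ primes) (p∉ps ∷ ps!) = begin
    p′ * V * H              ≡⟨ *-assoc p′ V H ⟩
    p′ * (V * H)            ≤⟨ *-monoʳ-≤ p′ (avoidingSum-≥ ps primes ps!) ⟩
    p′ * (Π * S)            ≡⟨ e₁ p′ Π S ⟩
    Π * (p′ * S)            ≤⟨ *-monoʳ-≤ Π (+-cancelˡ-≤ S _ _ pS≤) ⟩
    Π * (p * S⁺)            ≡⟨ e₂ p Π S⁺ ⟩
    p * Π * S⁺              ∎
    where
    open ≤-Reasoning
    Π = product ps
    V = totient ps
    H = ∑ (oneTo κ) q
    S = avoidingSum ps
    S⁺ = avoidingSum (p ∷ ps)
    e₁ : ∀ p Π S → p * (Π * S) ≡ Π * (p * S)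
    e₁ = solve-∀
    e₂ : ∀ p Π S → Π * (p * S) ≡ p * Π * S
    e₂ = solve-∀
    ks = filter (avoids? ps) (oneTo κ)
    ks! : Unique ks
    ks! = Uniqueₚ.filter⁺ (avoids? ps) (oneTo-unique κ)
    ks⁻ : ∀ {k} → k ∈ ks → (1 ≤ k × k ≤ κ) × Avoids ps k
    ks⁻ k∈ = let k∈κ , av = ∈-filter⁻ (avoids? ps) {xs = oneTo κ} k∈ in ∈-oneTo⁻ k∈κ , av
    M = filter (p ∣?_) ks
    M⁻ : ∀ {k} → k ∈ M → k ∈ ks × p ∣ k
    M⁻ = ∈-filter⁻ (p ∣?_) {xs = ks}
    exact : ∀ {k} → k ∈ M → k DM./ p * p ≡ k
    exact k∈ = DM.m/n*n≡m (proj₂ (M⁻ k∈))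
    positive : ∀ {k} → k ∈ M → 1 ≤ k DM./ p
    positive {k} k∈ = n≢0⇒n>0 λ eq → <-irrefl (trans (sym (cong (_* p) eq)) (exact k∈)) (proj₁ (proj₁ (ks⁻ (proj₁ (M⁻ k∈)))))
    bounded : ∀ {k} → k ∈ M → k DM./ p ≤ κ
    bounded {k} k∈ = ≤-trans (DM.m/n≤m k p) (proj₂ (proj₁ (ks⁻ (proj₁ (M⁻ k∈)))))
    into : ∀ {k} → k ∈ M → k DM./ p ∈ ks
    into {k} k∈ = ∈-filter⁺ (avoids? ps) (∈-oneTo⁺ (positive k∈) (bounded k∈))
      (All.map (λ r∤k r∣ → r∤k (subst (_ ∣_) (exact k∈) (∣m⇒∣m*n p r∣))) (proj₂ (ks⁻ (proj₁ (M⁻ k∈)))))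
    weight : ∀ {k} → k ∈ M → q k * p ≤ q (k DM./ p)
    weight {k} k∈ = ≤-reflexive (*-cancelʳ-≡ _ _ k′ {{>-nonZero (positive k∈)}} (begin-equality
      q k * p * k′      ≡⟨ *-assoc (q k) p k′ ⟩
      q k * (p * k′)    ≡⟨ cong (q k *_) (trans (*-comm p k′) (exact k∈)) ⟩
      q k * k           ≡⟨ qk≡W (proj₁ (proj₁ (ks⁻ (proj₁ (M⁻ k∈))))) (proj₂ (proj₁ (ks⁻ (proj₁ (M⁻ k∈))))) ⟩
      W                 ≡⟨ qk≡W (positive k∈) (bounded k∈) ⟨
      q k′ * k′         ∎))
      where k′ = k DM./ p
    multiples : ∑ M q * p ≤ S
    multiples = ≤-trans (≤-reflexive (sym (∑-*ʳ M q p)))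
      (∑-inj (DM._/ p) (Uniqueₚ.filter⁺ (p ∣?_) ks!) into
        (λ k∈ k′∈ eq → trans (sym (exact k∈)) (trans (cong (_* p) eq) (exact k′∈))) weight)
    rest : ∑ (filter (¬? ∘ (p ∣?_)) ks) q ≤ S⁺
    rest = ∑-⊆ (Uniqueₚ.filter⁺ (¬? ∘ (p ∣?_)) ks!) λ k∈ →
      let k∈ks , p∤k = ∈-filter⁻ (¬? ∘ (p ∣?_)) {xs = ks} k∈
          k∈κ , av   = ∈-filter⁻ (avoids? ps) {xs = oneTo κ} k∈ks
      in ∈-filter⁺ (avoids? (p ∷ ps)) k∈κ (p∤k ∷ av)
    pS≤ : S + p′ * S ≤ S + p * S⁺
    pS≤ = begin
      p * S                                            ≡⟨ cong (p *_) (∑-split (p ∣?_) ks q) ⟩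
      p * (∑ M q + ∑ (filter (¬? ∘ (p ∣?_)) ks) q)     ≤⟨ *-monoʳ-≤ p (+-monoʳ-≤ (∑ M q) rest) ⟩
      p * (∑ M q + S⁺)                                 ≡⟨ *-distribˡ-+ p (∑ M q) S⁺ ⟩
      p * ∑ M q + p * S⁺                               ≡⟨ cong (_+ p * S⁺) (*-comm p (∑ M q)) ⟩
      ∑ M q * p + p * S⁺                               ≤⟨ +-monoˡ-≤ (p * S⁺) multiples ⟩
      S + p * S⁺                                       ∎

-- Oresme's argument: each block (2^i, 2^(i+1)] contributes at least 1/2.
harmonicSum-≥ : ∀ η W q → (∀ {k} → 1 ≤ k → k ≤ 2 ^ η → q k * k ≡ W) → W * η ≤ 2 * ∑ (oneTo (2 ^ η)) q
harmonicSum-≥ zero    W q qk≡W = ≤-trans (≤-reflexive (*-zeroʳ W)) z≤n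
harmonicSum-≥ (suc η) W q qk≡W = *-cancelʳ-≤ _ _ a {{m^n≢0 2 η}} (begin
  W * suc η * a                          ≡⟨ e₁ W η a ⟩
  a * W + W * η * a                      ≤⟨ +-monoʳ-≤ (a * W) (*-monoˡ-≤ a (harmonicSum-≥ η W q
                                              (λ 1≤k k≤ → qk≡W 1≤k (≤-trans k≤ (m≤m+n a _))))) ⟩
  a * W + 2 * ∑ (oneTo a) q * a          ≤⟨ top a ≤-refl ⟩
  2 * ∑ (oneTo (a + a)) q * a            ≡⟨ cong (λ t → 2 * ∑ (oneTo (a + t)) q * a) (+-identityʳ a) ⟨
  2 * ∑ (oneTo (2 ^ suc η)) q * a        ∎)
  where
  open ≤-Reasoning
  a = 2 ^ η
  e₁ : ∀ W η a → W * suc η * a ≡ a * W + W * η * a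
  e₁ = solve-∀
  e₂ : ∀ W b s a → W + b * W + s ≡ W + (b * W + s)
  e₂ = solve-∀
  e₃ : ∀ x s a → x * (2 * a) + 2 * s * a ≡ 2 * (x + s) * a
  e₃ = solve-∀
  top : ∀ b → b ≤ a → b * W + 2 * ∑ (oneTo a) q * a ≤ 2 * ∑ (oneTo (a + b)) q * a
  top zero    _   = ≤-reflexive (cong (λ t → 2 * ∑ (oneTo t) q * a) (sym (+-identityʳ a)))
  top (suc b) b<a = begin
    W + b * W + 2 * ∑ (oneTo a) q * a                ≡⟨ +-assoc W (b * W) _ ⟩
    W + (b * W + 2 * ∑ (oneTo a) q * a)              ≤⟨ +-mono-≤ W≤ (top b (<⇒≤ b<a)) ⟩
    q k * (2 * a) + 2 * ∑ (oneTo (a + b)) q * a      ≡⟨ e₃ (q k) _ a ⟩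
    2 * (q k + ∑ (oneTo (a + b)) q) * a              ≡⟨ cong (λ t → 2 * ∑ (oneTo t) q * a) (+-suc a b) ⟨
    2 * ∑ (oneTo (a + suc b)) q * a                  ∎
    where
    k = suc (a + b)
    k≤2a : k ≤ 2 * a
    k≤2a = subst₂ _≤_ (+-suc a b) (cong (a +_) (sym (+-identityʳ a))) (+-monoʳ-≤ a b<a)
    W≤ : W ≤ q k * (2 * a)
    W≤ = ≤-trans (≤-reflexive (sym (qk≡W (s≤s z≤n) k≤2a))) (*-monoʳ-≤ (q k) k≤2a)

-- Integers up to y avoiding given primes

2^-floor : ∀ n → .{{NonZero n}} → ∃[ l ] (2 ^ l ≤ n × n < 2 ^ suc l)
2^-floor (suc zero)    = 0 , s≤s z≤n , s≤s (s≤s z≤n)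
2^-floor (suc n@(suc _)) with 2^-floor n
... | l , 2^l≤n , n<2^l⁺ with suc n <? 2 ^ suc l
...   | yes lt = l , m≤n⇒m≤1+n 2^l≤n , lt
...   | no ¬lt = suc l , ≮⇒≥ ¬lt , ≤-<-trans n<2^l⁺ (^-monoʳ-< 2 (s≤s (s≤s z≤n)) (n<1+n (suc l)))

-- Supplies 2^η as a cube root of n up to a factor 2.
8^-floor : ∀ n → .{{NonZero n}} → ∃[ η ] (2 ^ (3 * η) ≤ n × n < 2 ^ (3 * η + 3))
8^-floor n with 2^-floor n
... | l , 2^l≤n , n<2^l⁺ = l DM./ 3 ,
  ≤-trans (^-monoʳ-≤ 2 (≤-trans (≤-reflexive (*-comm 3 (l DM./ 3))) (DM.m/n*n≤m l 3))) 2^l≤n ,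
  <-≤-trans n<2^l⁺ (^-monoʳ-≤ 2 (begin
    suc l                            ≡⟨ cong suc (DM.m≡m%n+[m/n]*n l 3) ⟩
    suc (l DM.% 3) + l DM./ 3 * 3    ≤⟨ +-monoˡ-≤ _ (DM.m%n<n l 3) ⟩
    3 + l DM./ 3 * 3                 ≡⟨ +-comm 3 _ ⟩
    l DM./ 3 * 3 + 3                 ≡⟨ cong (_+ 3) (*-comm (l DM./ 3) 3) ⟩
    3 * (l DM./ 3) + 3               ∎))
  where open ≤-Reasoning

6[η+1]≤2^η : ∀ η → 6 ≤ η → 6 * suc η ≤ 2 ^ η
6[η+1]≤2^η η 6≤η = subst (λ η → 6 * suc η ≤ 2 ^ η) (m+[n∸m]≡n 6≤η) (go (η ∸ 6))
  where
  open ≤-Reasoning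
  e₁ : ∀ d → 6 * suc (6 + suc d) ≡ 6 * suc (6 + d) + 6
  e₁ = solve-∀
  go : ∀ d → 6 * suc (6 + d) ≤ 2 ^ (6 + d)
  go zero    = ≤ᵇ⇒≤ 42 64 _
  go (suc d) = begin
    6 * suc (6 + suc d)           ≡⟨ e₁ d ⟩
    6 * suc (6 + d) + 6           ≤⟨ +-mono-≤ (go d) (≤-trans (*-monoʳ-≤ 6 {1} {suc (6 + d)} (s≤s z≤n)) (go d)) ⟩
    2 ^ (6 + d) + 2 ^ (6 + d)     ≡⟨ cong (2 ^ (6 + d) +_) (+-identityʳ _) ⟨
    2 * 2 ^ (6 + d)               ≡⟨ cong (2 ^_) (+-suc 6 d) ⟨
    2 ^ (6 + suc d)               ∎

≤⇒≤/ : ∀ {a b c} .{{_ : NonZero b}} → a * b ≤ c → a ≤ c DM./ b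
≤⇒≤/ {a} {b} {c} ab≤c = subst (_≤ c DM./ b) (DM.m*n/n≡m a b) (DM./-monoˡ-≤ b ab≤c)

m<[1+m/n]*n : ∀ m n .{{_ : NonZero n}} → m < suc (m DM./ n) * n
m<[1+m/n]*n m n = ≤-<-trans (≤-reflexive (DM.m≡m%n+[m/n]*n m n)) (+-monoˡ-< _ (DM.m%n<n m n))

-- Opaque, lest 2 ^ θ be evaluated during type checking.
opaque
  θ : ℕ
  θ = 16

  16≤θ : 16 ≤ θ
  16≤θ = ≤-refl

avoidCount : List ℕ → ℕ → ℕ
avoidCount ps y = length (filter (avoids? ps) (oneTo y))

-- Each p k with k ≤ 2^η avoiding ps and p ∤ m a prime with p² > y/k is counted
-- by avoidCount; since p > k, the pair (p , k) is determined by p k.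
module PrimeMultiples (m l y η : ℕ) .{{m≢0 : NonZero m}} (ps : List ℕ)
  (m≤2^l : m ≤ 2 ^ l) (primes : All Prime ps) (ps∣m : All (_∣ m) ps)
  (2^3η≤y : 2 ^ (3 * η) ≤ y) (y<2^3η+3 : y < 2 ^ (3 * η + 3))
  (8l≤ : 8 * (l + 2) ≤ 2 ^ η * 2 ^ η) (6η≤ : 6 * suc η ≤ 2 ^ η) where

  κ μ : ℕ
  κ = 2 ^ η
  μ = 3 * η + 3

  κ³≤y : κ * κ * κ ≤ y
  κ³≤y = ≤-trans (≤-reflexive (trans (sym (trans (^-distribˡ-+-* 2 (η + η) η) (cong (_* κ) (^-distribˡ-+-* 2 η η))))
                                     (cong (2 ^_) (lemma η)))) 2^3η≤y
    where
    lemma : ∀ η → η + η + η ≡ 3 * η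
    lemma = solve-∀

  ks : List ℕ
  ks = filter (avoids? ps) (oneTo κ)

  ks⁻ : ∀ {k} → k ∈ ks → (1 ≤ k × k ≤ κ) × Avoids ps k
  ks⁻ k∈ = let k∈κ , av = ∈-filter⁻ (avoids? ps) {xs = oneTo κ} k∈ in ∈-oneTo⁻ k∈κ , av

  -- y / k, extended by an irrelevant value at k = 0
  quot : ℕ → ℕ
  quot zero    = 0
  quot (suc k) = y DM./ suc k

  quot*k≤y : ∀ k → quot k * k ≤ y
  quot*k≤y zero    = z≤n
  quot*k≤y (suc k) = DM.m/n*n≤m y (suc k)

  y<suc-quot*k : ∀ {k} → 1 ≤ k → y < suc (quot k) * k
  y<suc-quot*k {suc k} _ = m<[1+m/n]*n y (suc k)

  κ²≤quot : ∀ {k} → 1 ≤ k → k ≤ κ → κ * κ ≤ quot k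
  κ²≤quot {suc k} _ k≤κ = ≤⇒≤/ (≤-trans (*-monoʳ-≤ (κ * κ) k≤κ) κ³≤y)

  quot≤y : ∀ {k} → 1 ≤ k → quot k ≤ y
  quot≤y {suc k} _ = DM.m/n≤m y (suc k)

  fresh : ℕ → List ℕ
  fresh k = freshLargePrimes m (quot k)

  fresh⁻ : ∀ {k p} → p ∈ fresh k → Prime p × p ≤ quot k × quot k < p * p × ¬ p ∣ m
  fresh⁻ {k} p∈ with ∈-filter⁻ (freshLargePrime? m (quot k)) {xs = primesUpTo (quot k)} p∈
  ... | p∈primes , large , p∤m with ∈-primesUpTo⁻ {quot k} p∈primes
  ...   | prime-p , p≤ = prime-p , p≤ , large , p∤m

  k<p : ∀ {k p} → k ∈ ks → p ∈ fresh k → k < p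
  k<p {k} {p} k∈ p∈ with ks⁻ k∈ | fresh⁻ {k} p∈
  ... | (1≤k , k≤κ) , _ | _ , _ , large , _ = ≰⇒> λ p≤k → <-irrefl refl
    (<-≤-trans large (≤-trans (ℕₚ.*-mono-≤ p≤k p≤k) (≤-trans (ℕₚ.*-mono-≤ k≤κ k≤κ) (κ²≤quot 1≤k k≤κ))))

  multiples : ℕ → List ℕ
  multiples k = map (_* k) (fresh k)

  fresh-≥ : ∀ {k} → 1 ≤ k → k ≤ κ → y ≤ 8 * μ * length (fresh k) * k
  fresh-≥ {k} 1≤k k≤κ = begin
    y                                       ≤⟨ <⇒≤ (y<suc-quot*k 1≤k) ⟩
    suc (quot k) * k                        ≤⟨ *-monoˡ-≤ k (+-monoˡ-≤ (quot k) 1≤quot) ⟩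
    (quot k + quot k) * k                   ≤⟨ *-monoˡ-≤ k (+-mono-≤ cheb cheb) ⟩
    (4 * μ * K + 4 * μ * K) * k             ≡⟨ cong (_* k) (lemma μ K) ⟩
    8 * μ * K * k                           ∎
    where
    open ≤-Reasoning
    K = length (fresh k)
    lemma : ∀ μ K → 4 * μ * K + 4 * μ * K ≡ 8 * μ * K
    lemma = solve-∀
    lemma₂ : ∀ η → 4 * ((3 * η + 3) * (3 * η + 3)) ≡ 6 * suc η * (6 * suc η)
    lemma₂ = solve-∀
    1≤quot : 1 ≤ quot k
    1≤quot = ≤-trans (ℕₚ.*-mono-≤ (m^n>0 2 η) (m^n>0 2 η)) (κ²≤quot 1≤k k≤κ)
    -- Chebyshev's bound is applied at y/k ≥ κ²; its second hypothesis holds since 4 μ² = (6 (η +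
    -- 1))² ≤ κ².
    cheb : quot k ≤ 4 * μ * K
    cheb = chebyshev m (quot k) μ l m≤2^l (≤-trans (quot≤y 1≤k) (<⇒≤ y<2^3η+3))
      (≤-trans 8l≤ (κ²≤quot 1≤k k≤κ))
      (≤-trans (≤-reflexive (lemma₂ η)) (≤-trans (ℕₚ.*-mono-≤ 6η≤ 6η≤) (κ²≤quot 1≤k k≤κ)))

  count : ∑ ks (λ k → length (fresh k)) ≤ avoidCount ps y
  count = ≤-trans (∑-mono ks (λ {k} _ → ≤-reflexive (sym (length-map (_* k) (fresh k)))))
    (∑-disjoint multiples (Uniqueₚ.filter⁺ (avoids? ps) (oneTo-unique κ)) unique into disjoint)
    where
    unique : ∀ {k} → k ∈ ks → Unique (multiples k)
    unique {k} k∈ = Uniqueₚ.map⁺ (λ eq → *-cancelʳ-≡ _ _ k {{>-nonZero (proj₁ (proj₁ (ks⁻ k∈)))}} eq)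
      (Uniqueₚ.filter⁺ (freshLargePrime? m (quot k)) (primesUpTo-unique (quot k)))
    into : ∀ {k v} → k ∈ ks → v ∈ multiples k → v ∈ filter (avoids? ps) (oneTo y)
    into {k} k∈ v∈ with ∈-map⁻ (_* k) v∈
    ... | p , p∈ , refl with fresh⁻ {k} p∈ | ks⁻ k∈
    ...   | prime-p , p≤ , _ , p∤m | (1≤k , _) , k-avoids = ∈-filter⁺ (avoids? ps)
      (∈-oneTo⁺ (ℕₚ.*-mono-≤ (<⇒≤ (prime⇒2≤ prime-p)) 1≤k) (≤-trans (*-monoˡ-≤ k p≤) (quot*k≤y k)))
      (All.tabulate λ {r} r∈ r∣pk → case r∈ (euclidsLemma p k (All.lookup primes r∈) r∣pk))
      where
      case : ∀ {r} → r ∈ ps → r ∣ p ⊎ r ∣ k → ⊥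
      case r∈ (inj₁ r∣p) = p∤m (subst (_∣ m) (prime∣prime⇒≡ (All.lookup primes r∈) prime-p r∣p) (All.lookup ps∣m r∈))
      case r∈ (inj₂ r∣k) = All.lookup k-avoids r∈ r∣k
    disjoint : ∀ {k k′ v} → k ∈ ks → k′ ∈ ks → v ∈ multiples k → v ∈ multiples k′ → k ≡ k′
    disjoint {k} {k′} k∈ k′∈ v∈ v∈′ with ∈-map⁻ (_* k) v∈ | ∈-map⁻ (_* k′) v∈′
    ... | p , p∈ , refl | p′ , p′∈ , eq with fresh⁻ {k} p∈ | fresh⁻ {k′} p′∈
    ...   | prime-p , _ | prime-p′ , _ = same
      (euclidsLemma p′ k′ prime-p (subst (p ∣_) eq (m∣m*n k)))
      (euclidsLemma p k prime-p′ (subst (p′ ∣_) (sym eq) (m∣m*n k′)))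
      where
      cancel : p ≡ p′ → k ≡ k′
      cancel refl = *-cancelˡ-≡ k k′ p {{prime⇒nonZero prime-p}} eq
      same : p ∣ p′ ⊎ p ∣ k′ → p′ ∣ p ⊎ p′ ∣ k → k ≡ k′
      same (inj₁ p∣p′) _ = cancel (prime∣prime⇒≡ prime-p prime-p′ p∣p′)
      same (inj₂ _) (inj₁ p′∣p) = cancel (sym (prime∣prime⇒≡ prime-p′ prime-p p′∣p))
      -- Otherwise k < p ≤ k′ < p′ ≤ k.
      same (inj₂ p∣k′) (inj₂ p′∣k) = contradiction
        (<-≤-trans (k<p k∈ p∈) (≤-trans (∣⇒≤ {{>-nonZero (proj₁ (proj₁ (ks⁻ k′∈)))}} p∣k′)
          (<⇒≤ (<-≤-trans (k<p k′∈ p′∈) (∣⇒≤ {{>-nonZero (proj₁ (proj₁ (ks⁻ k∈)))}} p′∣k)))))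
        (<-irrefl refl)

  -- Each k contributes at least y/(8 μ k) products. Summing over the k that avoid `ps` gives y/(8
  -- μ) · ∏ (1 - 1/p) · η/2: the harmonic sum of length 2^η makes up for the logarithm μ lost to the
  -- density of primes, and μ = 3η + 3 ≤ 6η yields 96.
  bound : 1 ≤ η → Unique ps → y * totient ps ≤ 96 * (product ps * avoidCount ps y)
  bound 1≤η ps! = *-cancelˡ-≤ (W * η) {{m*n≢0 W η {{κ !≢0}} {{>-nonZero 1≤η}}}} (begin
    W * η * (y * V)                   ≡⟨ e₁ W η y V ⟩
    y * V * (W * η)                   ≤⟨ *-monoʳ-≤ (y * V) (harmonicSum-≥ η W q (λ 1≤k k≤κ → qk≡W 1≤k k≤κ)) ⟩
    y * V * (2 * H)                   ≡⟨ e₂ y V H ⟩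
    2 * y * (V * H)                   ≤⟨ *-monoʳ-≤ (2 * y) (avoidingSum-≥ κ W q qk≡W ps primes ps!) ⟩
    2 * y * (Π * ∑ ks q)              ≡⟨ e₃ y Π (∑ ks q) ⟩
    2 * Π * (∑ ks q * y)              ≤⟨ *-monoʳ-≤ (2 * Π) weighted ⟩
    2 * Π * (A * (8 * μ * W))         ≡⟨ e₄ Π A η W ⟩
    W * (48 * η + 48 * 1) * (Π * A)   ≤⟨ *-monoˡ-≤ (Π * A) (*-monoʳ-≤ W (+-monoʳ-≤ (48 * η) (*-monoʳ-≤ 48 1≤η))) ⟩
    W * (48 * η + 48 * η) * (Π * A)   ≡⟨ e₅ W η (Π * A) ⟩
    W * η * (96 * (Π * A))            ∎)
    where
    open ≤-Reasoning
    W = κ !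
    V = totient ps
    Π = product ps
    A = avoidCount ps y
    q : ℕ → ℕ
    q zero    = 0
    q (suc k) = W DM./ suc k
    H = ∑ (oneTo κ) q
    qk≡W : ∀ {k} → 1 ≤ k → k ≤ κ → q k * k ≡ W
    qk≡W {suc k} _ k≤κ = DM.m/n*n≡m (∣-trans (m∣m*n (k !)) (m≤n⇒m!∣n! k≤κ))
    e₁ : ∀ W η y V → W * η * (y * V) ≡ y * V * (W * η)
    e₁ = solve-∀
    e₂ : ∀ y V H → y * V * (2 * H) ≡ 2 * y * (V * H)
    e₂ = solve-∀
    e₃ : ∀ y Π S → 2 * y * (Π * S) ≡ 2 * Π * (S * y)
    e₃ = solve-∀
    e₄ : ∀ Π A η W → 2 * Π * (A * (8 * (3 * η + 3) * W)) ≡ W * (48 * η + 48 * 1) * (Π * A)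
    e₄ = solve-∀
    e₅ : ∀ W η B → W * (48 * η + 48 * η) * B ≡ W * η * (96 * B)
    e₅ = solve-∀
    e₆ : ∀ q μ K k → q * (8 * μ * K * k) ≡ K * (8 * μ * (q * k))
    e₆ = solve-∀
    weighted : ∑ ks q * y ≤ A * (8 * μ * W)
    weighted = begin
      ∑ ks q * y                                       ≡⟨ ∑-*ʳ ks q y ⟨
      ∑ ks (λ k → q k * y)                             ≤⟨ ∑-mono ks (λ {k} k∈ → let (1≤k , k≤κ) , _ = ks⁻ k∈ in
                                                            ≤-trans (*-monoʳ-≤ (q k) (fresh-≥ 1≤k k≤κ))
                                                              (≤-reflexive (trans (e₆ (q k) μ (length (fresh k)) k)
                                                                (cong (λ t → length (fresh k) * (8 * μ * t)) (qk≡W 1≤k k≤κ))))) ⟩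
      ∑ ks (λ k → length (fresh k) * (8 * μ * W))      ≡⟨ ∑-*ʳ ks (λ k → length (fresh k)) (8 * μ * W) ⟩
      ∑ ks (λ k → length (fresh k)) * (8 * μ * W)      ≤⟨ *-monoˡ-≤ (8 * μ * W) count ⟩
      A * (8 * μ * W)                                  ∎

-- The lower bound on y keeps y/k ≥ κ² above 8 (l + 2), so that the primes dividing m do little harm
-- in Chebyshev's bound. The factor 2³ beside 2^θ is lost when y is rounded down to a power of 8.
avoidCount-≥ : ∀ m l y ps .{{_ : NonZero m}} → m ≤ 2 ^ l → Unique ps → All Prime ps → All (_∣ m) ps →
  2 ^ (3 + θ) * ((l + 2) * (l + 2)) ≤ y → y * totient ps ≤ 96 * (product ps * avoidCount ps y)
avoidCount-≥ m l y ps m≤2^l ps! primes ps∣m large = finish (8^-floor y {{>-nonZero 1≤y}})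
  where
  open ≤-Reasoning
  1≤y : 1 ≤ y
  1≤y = ≤-trans (ℕₚ.*-mono-≤ (m^n>0 2 (3 + θ)) (ℕₚ.*-mono-≤ 1≤l+2 1≤l+2)) large
    where
    1≤l+2 : 1 ≤ l + 2
    1≤l+2 = m≤n⇒m≤o+n l (s≤s z≤n)
  finish : ∃[ η ] (2 ^ (3 * η) ≤ y × y < 2 ^ (3 * η + 3)) → y * totient ps ≤ 96 * (product ps * avoidCount ps y)
  finish (η , lo , hi) =
    PrimeMultiples.bound m l y η ps m≤2^l primes ps∣m lo hi 8l≤ (6[η+1]≤2^η η 6≤η) (≤-trans (s≤s z≤n) 6≤η) ps!
    where
    cubic : 2 ^ θ * ((l + 2) * (l + 2)) ≤ 2 ^ (3 * η)
    cubic = *-cancelˡ-≤ 8 (begin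
      8 * (2 ^ θ * ((l + 2) * (l + 2)))    ≡⟨ *-assoc 8 (2 ^ θ) _ ⟨
      8 * 2 ^ θ * ((l + 2) * (l + 2))      ≡⟨ cong (_* ((l + 2) * (l + 2))) (^-distribˡ-+-* 2 3 θ) ⟨
      2 ^ (3 + θ) * ((l + 2) * (l + 2))    ≤⟨ large ⟩
      y                                    ≤⟨ <⇒≤ hi ⟩
      2 ^ (3 * η + 3)                      ≡⟨ ^-distribˡ-+-* 2 (3 * η) 3 ⟩
      2 ^ (3 * η) * 8                      ≡⟨ *-comm (2 ^ (3 * η)) 8 ⟩
      8 * 2 ^ (3 * η)                      ∎)
    2≤l+2 : 2 ≤ l + 2
    2≤l+2 = m≤n+m 2 l
    -- From 2^16 · 2² ≤ 2^(3η); the resulting η ≥ 6 is the range in which 6 (η + 1) ≤ 2^η. This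
    -- fixes the value of `θ`.
    18≤3η : 18 ≤ 3 * η
    18≤3η = 2^-cancel-≤ (≤-trans (≤-trans (≤-reflexive (^-distribˡ-+-* 2 16 2))
      (ℕₚ.*-mono-≤ (^-monoʳ-≤ 2 16≤θ) (ℕₚ.*-mono-≤ 2≤l+2 2≤l+2))) cubic)
    6≤η : 6 ≤ η
    6≤η = *-cancelˡ-≤ 3 18≤3η
    e₁ : ∀ l → 8 * (l + 2) * (8 * (l + 2)) ≡ 64 * ((l + 2) * (l + 2))
    e₁ = solve-∀
    e₂ : ∀ η → 3 * η + η ≡ η + η + (η + η)
    e₂ = solve-∀
    8l≤ : 8 * (l + 2) ≤ 2 ^ η * 2 ^ η
    8l≤ = m*m≤n*n⇒m≤n (begin
      8 * (l + 2) * (8 * (l + 2))          ≡⟨ e₁ l ⟩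
      64 * ((l + 2) * (l + 2))             ≤⟨ *-monoˡ-≤ _ (^-monoʳ-≤ 2 (≤-trans (m≤m+n 6 10) 16≤θ)) ⟩
      2 ^ θ * ((l + 2) * (l + 2))          ≤⟨ cubic ⟩
      2 ^ (3 * η)                          ≤⟨ ^-monoʳ-≤ 2 (m≤m+n (3 * η) η) ⟩
      2 ^ (3 * η + η)                      ≡⟨ cong (2 ^_) (e₂ η) ⟩
      2 ^ (η + η + (η + η))                ≡⟨ ^-distribˡ-+-* 2 (η + η) (η + η) ⟩
      2 ^ (η + η) * 2 ^ (η + η)            ≡⟨ cong (λ t → t * t) (^-distribˡ-+-* 2 η η) ⟩
      2 ^ η * 2 ^ η * (2 ^ η * 2 ^ η)      ∎)

-- Integers with a large common factor with n are rare

primeDivisors : ℕ → List ℕ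
primeDivisors n = filter (_∣? n) (primesUpTo n)

∈-primeDivisors⁺ : ∀ {n p} .{{_ : NonZero n}} → Prime p → p ∣ n → p ∈ primeDivisors n
∈-primeDivisors⁺ {n} prime-p p∣n = ∈-filter⁺ (_∣? n) (∈-primesUpTo⁺ prime-p (∣⇒≤ p∣n)) p∣n

primeDivisors-prime : ∀ n → All Prime (primeDivisors n)
primeDivisors-prime n = All.tabulate λ p∈ → proj₁ (∈-primesUpTo⁻ {n} (proj₁ (∈-filter⁻ (_∣? n) p∈)))

primeDivisors-∣ : ∀ n → All (_∣ n) (primeDivisors n)
primeDivisors-∣ n = All.tabulate λ p∈ → proj₂ (∈-filter⁻ (_∣? n) {xs = primesUpTo n} p∈)

primeDivisors-unique : ∀ n → Unique (primeDivisors n)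
primeDivisors-unique n = Uniqueₚ.filter⁺ (_∣? n) (primesUpTo-unique n)

Decreasing : List ℕ → Set
Decreasing = AllPairs (λ p q → q < p)

primeDivisors-decreasing : ∀ n → Decreasing (primeDivisors n)
primeDivisors-decreasing n = AllPairsₚ.filter⁺ (_∣? n) (AllPairsₚ.filter⁺ prime?
  (AllPairsₚ.applyDownFrom⁺₁ id (suc n) (λ j<i _ → j<i)))

decreasing⇒unique : ∀ {ps} → Decreasing ps → Unique ps
decreasing⇒unique = AllPairs.map (λ q<p p≡q → <-irrefl (sym p≡q) q<p)

length-primeDivisors : ∀ n L .{{_ : NonZero n}} → n < 2 ^ suc L → length (primeDivisors n) ≤ L
length-primeDivisors n L n< = ≮⇒≥ λ L<len → <-irrefl refl (begin-strict
  n                                    <⟨ n< ⟩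
  2 ^ suc L                            ≤⟨ ^-monoʳ-≤ 2 L<len ⟩
  2 ^ length (primeDivisors n)         ≤⟨ go (primeDivisors n) (primeDivisors-prime n) ⟩
  product (primeDivisors n)            ≤⟨ ∣⇒≤ (product∣ (primeDivisors n) (primeDivisors-unique n) (primeDivisors-prime n) (primeDivisors-∣ n)) ⟩
  n                                    ∎)
  where
  open ≤-Reasoning
  go : ∀ ps → All Prime ps → 2 ^ length ps ≤ product ps
  go []       []                 = ≤-refl
  go (p ∷ ps) (prime-p ∷ primes) = ℕₚ.*-mono-≤ (prime⇒2≤ prime-p) (go ps primes)

module _ (T e : ℕ) .{{e≢0 : NonZero e}} where

  multiplesUpTo : List ℕ
  multiplesUpTo = filter (e ∣?_) (oneTo T)

  multiplesUpTo-unique : Unique multiplesUpTo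
  multiplesUpTo-unique = Uniqueₚ.filter⁺ (e ∣?_) (oneTo-unique T)

  multiple-exact : ∀ {x} → x ∈ multiplesUpTo → x DM./ e * e ≡ x
  multiple-exact x∈ = DM.m/n*n≡m (proj₂ (∈-filter⁻ (e ∣?_) {xs = oneTo T} x∈))

  multiple-into : ∀ {x} → x ∈ multiplesUpTo → x DM./ e ∈ oneTo (T DM./ e)
  multiple-into {x} x∈ with ∈-oneTo⁻ {T} (proj₁ (∈-filter⁻ (e ∣?_) {xs = oneTo T} x∈))
  ... | 1≤x , x≤T = ∈-oneTo⁺
    (n≢0⇒n>0 λ eq → <-irrefl (trans (sym (cong (_* e) eq)) (multiple-exact x∈)) 1≤x)
    (DM./-monoˡ-≤ e x≤T)

  multiple-injective : ∀ {x x′} → x ∈ multiplesUpTo → x′ ∈ multiplesUpTo → x DM./ e ≡ x′ DM./ e → x ≡ x′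
  multiple-injective x∈ x′∈ eq =
    trans (sym (multiple-exact x∈)) (trans (cong (_* e) eq) (multiple-exact x′∈))

  length-multiplesUpTo : length multiplesUpTo * e ≤ T
  length-multiplesUpTo = ≤-trans
    (*-monoˡ-≤ e (≤-trans (length-inj (DM._/ e) multiplesUpTo-unique multiple-into multiple-injective)
                         (≤-reflexive (length-oneTo (T DM./ e)))))
    (DM.m/n*n≤m T e)

ω : List ℕ → ℕ → ℕ
ω ps x = length (filter (_∣? x) ps)

-- 2^(ω ps x) has mean at most ∏ (1 + 1/p) ≤ ∏ (1 + 1/(i+1)) = (k + 2)/2 over x ≤ T.
2^ω-mean : ∀ ps → Decreasing ps → All Prime ps → ∀ T →
           2 * ∑ (oneTo T) (λ x → 2 ^ ω ps x) ≤ T * (length ps + 2)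
2^ω-mean []       _ _ T = ≤-reflexive (trans (cong (2 *_) (trans (∑-1 (oneTo T)) (length-oneTo T))) (*-comm 2 T))
2^ω-mean (p ∷ ps) (ps<p ∷ dec) (prime-p ∷ primes) T = begin
  2 * ∑ xs w⁺                                       ≡⟨ cong (2 *_) split ⟩
  2 * (∑ xs w + ∑ M w)                              ≤⟨ *-monoʳ-≤ 2 (+-monoʳ-≤ (∑ xs w) quotients) ⟩
  2 * (∑ xs w + ∑ (oneTo (T DM./ p)) w)             ≡⟨ *-distribˡ-+ 2 (∑ xs w) _ ⟩
  2 * ∑ xs w + 2 * ∑ (oneTo (T DM./ p)) w           ≤⟨ +-mono-≤ (2^ω-mean ps dec primes T) (2^ω-mean ps dec primes (T DM./ p)) ⟩
  T * (k + 2) + T DM./ p * (k + 2)                  ≤⟨ +-monoʳ-≤ (T * (k + 2)) (≤-trans (*-monoʳ-≤ (T DM./ p) k+2≤p) (DM.m/n*n≤m T p)) ⟩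
  T * (k + 2) + T                                   ≡⟨ +-comm (T * (k + 2)) T ⟩
  T + T * (k + 2)                                   ≡⟨ *-suc T (k + 2) ⟨
  T * (suc k + 2)                                   ∎
  where
  open ≤-Reasoning
  instance
    p≢0 : NonZero p
    p≢0 = prime⇒nonZero prime-p
  k = length ps
  xs = oneTo T
  w w⁺ : ℕ → ℕ
  w x = 2 ^ ω ps x
  w⁺ x = 2 ^ ω (p ∷ ps) x
  M N : List ℕ
  M = filter (p ∣?_) xs
  N = filter (¬? ∘ (p ∣?_)) xs
  -- Below p lie 0, 1 and the k smaller primes. Hence the term (T/p)(k + 2) coming from the
  -- multiples of p is at most T.
  k+2≤p : k + 2 ≤ p
  k+2≤p = subst₂ _≤_ (+-comm 2 k) (length-downFrom p) (length-⊆ {xs = 1 ∷ 0 ∷ ps} {ys = downFrom p}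
    (((λ ()) ∷ All.tabulate (λ { q∈ refl → ¬prime[1] (All.lookup primes q∈) }))
      ∷ All.tabulate (λ { q∈ refl → ¬prime[0] (All.lookup primes q∈) }) ∷ decreasing⇒unique dec)
    (λ { (here refl) → ∈-downFrom⁺ (prime⇒2≤ prime-p)
       ; (there (here refl)) → ∈-downFrom⁺ (≤-trans (s≤s z≤n) (prime⇒2≤ prime-p))
       ; (there (there q∈)) → ∈-downFrom⁺ (All.lookup ps<p q∈) }))
  on-M : ∀ {x} → x ∈ M → w⁺ x ≡ w x + w x
  on-M {x} x∈ = trans
    (cong (λ l → 2 ^ length l) (filter-accept (_∣? x) {p} {ps} (proj₂ (∈-filter⁻ (p ∣?_) {xs = xs} x∈))))
    (cong (w x +_) (+-identityʳ (w x)))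
  on-N : ∀ {x} → x ∈ N → w⁺ x ≡ w x
  on-N {x} x∈ = cong (λ l → 2 ^ length l)
    (filter-reject (_∣? x) {p} {ps} (proj₂ (∈-filter⁻ (¬? ∘ (p ∣?_)) {xs = xs} x∈)))
  arrange : ∀ a b → a + a + b ≡ a + b + a
  arrange = solve-∀
  split : ∑ xs w⁺ ≡ ∑ xs w + ∑ M w
  split = begin-equality
    ∑ xs w⁺                        ≡⟨ ∑-split (p ∣?_) xs w⁺ ⟩
    ∑ M w⁺ + ∑ N w⁺                ≡⟨ cong₂ _+_ (≤-antisym (∑-mono M (≤-reflexive ∘ on-M)) (∑-mono M (≤-reflexive ∘ sym ∘ on-M)))
                                               (≤-antisym (∑-mono N (≤-reflexive ∘ on-N)) (∑-mono N (≤-reflexive ∘ sym ∘ on-N))) ⟩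
    ∑ M (λ x → w x + w x) + ∑ N w  ≡⟨ cong (_+ ∑ N w) (∑-+ M w w) ⟩
    ∑ M w + ∑ M w + ∑ N w          ≡⟨ arrange (∑ M w) (∑ N w) ⟩
    ∑ M w + ∑ N w + ∑ M w          ≡⟨ cong (_+ ∑ M w) (∑-split (p ∣?_) xs w) ⟨
    ∑ xs w + ∑ M w                 ∎
  quotients : ∑ M w ≤ ∑ (oneTo (T DM./ p)) w
  quotients = ∑-inj (DM._/ p) (multiplesUpTo-unique T p) (multiple-into T p) (multiple-injective T p) λ {x} x∈ →
    ^-monoʳ-≤ 2 (length-⊆ (Uniqueₚ.filter⁺ (_∣? x) (decreasing⇒unique dec)) λ {q} q∈ →
      let q∈ps , q∣x = ∈-filter⁻ (_∣? x) {xs = ps} q∈ in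
      ∈-filter⁺ (_∣? (x DM./ p)) q∈ps (strip q∈ps
        (euclidsLemma (x DM./ p) p (All.lookup primes q∈ps) (subst (q ∣_) (sym (multiple-exact T p x∈)) q∣x))))
    where
    strip : ∀ {q y} → q ∈ ps → q ∣ y ⊎ q ∣ p → q ∣ y
    strip q∈ (inj₁ q∣y) = q∣y
    strip q∈ (inj₂ q∣p) = contradiction (All.lookup ps<p q∈)
      (<-irrefl (prime∣prime⇒≡ (All.lookup primes q∈) prime-p q∣p))

-- If gcd x n > 2^(r²) then either x is divisible by a prime power q > 2^r from
-- a set of at most ω(n) such powers, or more than r primes divide both x and n.
module LargeGCD (n r : ℕ) .{{n≢0 : NonZero n}} where

  D Z : ℕ
  D = 2 ^ (r * r)
  Z = 2 ^ r

  ps : List ℕ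
  ps = primeDivisors n

  largeGCD? : Decidable (λ x → D < gcd x n)
  largeGCD? x = D <? gcd x n

  -- For a prime p, the least power of p above `Z`.
  heavy : ℕ → ℕ
  heavy p = p * primePower Z p

  Divides? : ∀ x p → Dec (heavy p ∣ x)
  Divides? x p = heavy p ∣? x

  heavies : ℕ → ℕ
  heavies x = length (filter (Divides? x) ps)

  -- Both cases are merged into one bound for `Z` by quantities of small mean, ready for Markov's
  -- inequality. If no `heavy p` divides gcd x n, then gcd x n is at most a product of ω powers not
  -- above `Z`, so ω ≤ r would give gcd x n ≤ Z^r = D.
  dichotomy : ∀ x → D < gcd x n → Z ≤ 2 ^ ω ps x + heavies x * Z
  dichotomy x D<g with ∣product-primePower Z (filter (_∣? x) ps)
      (All.tabulate (λ p∈ → All.lookup (primeDivisors-prime n) (proj₁ (∈-filter⁻ (_∣? x) p∈))))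
      (gcd x n) {{>-nonZero (≤-trans (s≤s z≤n) D<g)}}
      (λ prime-q q∣g → ∈-filter⁺ (_∣? x) (∈-primeDivisors⁺ prime-q (∣-trans q∣g (gcd[m,n]∣n x n)))
        (∣-trans q∣g (gcd[m,n]∣m x n)))
  ... | inj₁ any with find any
  ...   | p , p∈ , h∣g = m≤n⇒m≤o+n _ (≤-trans (≤-reflexive (sym (+-identityʳ Z))) (*-monoˡ-≤ Z 1≤))
    where
    1≤ : 1 ≤ heavies x
    1≤ = length-⊆ {xs = p ∷ []} ([] ∷ []) λ { (here refl) →
      ∈-filter⁺ (Divides? x) (proj₁ (∈-filter⁻ (_∣? x) {xs = ps} p∈)) (∣-trans h∣g (gcd[m,n]∣m x n)) }
  dichotomy x D<g | inj₂ g∣Π = m≤n⇒m≤n+o _ (^-monoʳ-≤ 2 (<⇒≤ r<ω))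
    where
    open ≤-Reasoning
    qs = filter (_∣? x) ps
    Π≤ : ∀ qs → product (map (primePower Z) qs) ≤ Z ^ length qs
    Π≤ []       = ≤-refl
    Π≤ (q ∷ qs) = ℕₚ.*-mono-≤ (primePower-≤ Z q (m^n>0 2 r)) (Π≤ qs)
    positive : ∀ qs → All Prime qs → 1 ≤ product (map (primePower Z) qs)
    positive []       _ = s≤s z≤n
    positive (q ∷ qs) (prime-q ∷ primes) =
      ℕₚ.*-mono-≤ (m^n>0 q {{prime⇒nonZero prime-q}} (largestExponent Z q Z)) (positive qs primes)
    r<ω : r < ω ps x
    r<ω = ≰⇒> λ ω≤r → <-irrefl refl (begin-strict
      D                            <⟨ D<g ⟩
      gcd x n                      ≤⟨ ∣⇒≤ {{>-nonZero (positive qs (All.tabulate (λ p∈ →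
                                        All.lookup (primeDivisors-prime n) (proj₁ (∈-filter⁻ (_∣? x) p∈)))))}} g∣Π ⟩
      product (map (primePower Z) qs) ≤⟨ Π≤ qs ⟩
      Z ^ ω ps x                   ≤⟨ ^-monoʳ-≤ Z {{m^n≢0 2 r}} ω≤r ⟩
      Z ^ r                        ≡⟨ ^-*-assoc 2 r r ⟩
      D                            ∎)

  -- Sum `dichotomy` over x: the mean of 2^ω is controlled by `2^ω-mean`, and each of the k numbers
  -- `heavy p`, being above `Z`, divides at most T/Z of the x.
  density : ∀ T → length (filter largeGCD? (oneTo T)) * Z ≤ T * (2 * length ps + 1)
  density T = *-cancelˡ-≤ 2 (begin
    2 * (length G * Z)                                        ≡⟨ cong (2 *_) (∑-const G Z) ⟨
    2 * ∑ G (λ _ → Z)                                         ≤⟨ *-monoʳ-≤ 2 (∑-mono G (λ {x} x∈ → dichotomy x (proj₂ (∈-filter⁻ largeGCD? {xs = xs} x∈)))) ⟩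
    2 * ∑ G (λ x → 2 ^ ω ps x + heavies x * Z)                ≤⟨ *-monoʳ-≤ 2 (∑-⊆ (Uniqueₚ.filter⁺ largeGCD? (oneTo-unique T)) (proj₁ ∘ ∈-filter⁻ largeGCD? {xs = xs})) ⟩
    2 * ∑ xs (λ x → 2 ^ ω ps x + heavies x * Z)               ≡⟨ cong (2 *_) (∑-+ xs (λ x → 2 ^ ω ps x) (λ x → heavies x * Z)) ⟩
    2 * (∑ xs (λ x → 2 ^ ω ps x) + ∑ xs (λ x → heavies x * Z)) ≡⟨ cong (λ t → 2 * (∑ xs (λ x → 2 ^ ω ps x) + t)) (∑-*ʳ xs heavies Z) ⟩
    2 * (∑ xs (λ x → 2 ^ ω ps x) + ∑ xs heavies * Z)          ≡⟨ *-distribˡ-+ 2 (∑ xs (λ x → 2 ^ ω ps x)) _ ⟩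
    2 * ∑ xs (λ x → 2 ^ ω ps x) + 2 * (∑ xs heavies * Z)      ≤⟨ +-mono-≤ (2^ω-mean ps (primeDivisors-decreasing n) (primeDivisors-prime n) T) (*-monoʳ-≤ 2 total) ⟩
    T * (k + 2) + 2 * (k * T)                                 ≤⟨ m≤m+n _ (T * k) ⟩
    T * (k + 2) + 2 * (k * T) + T * k                         ≡⟨ arrange T k ⟩
    2 * (T * (2 * k + 1))                                     ∎)
    where
    open ≤-Reasoning
    xs = oneTo T
    k = length ps
    G = filter largeGCD? xs
    arrange : ∀ T k → T * (k + 2) + 2 * (k * T) + T * k ≡ 2 * (T * (2 * k + 1))
    arrange = solve-∀
    few : ∀ {p} → p ∈ ps → length (filter (λ x → Divides? x p) xs) * Z ≤ T
    few {p} p∈ = ≤-trans (*-monoʳ-≤ (length (filter (λ x → Divides? x p) xs)) (<⇒≤ Z<heavy))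
      (length-multiplesUpTo T (heavy p) {{>-nonZero (≤-<-trans z≤n Z<heavy)}})
      where
      Z<heavy : Z < heavy p
      Z<heavy = primePower-> Z p (prime⇒2≤ (All.lookup (primeDivisors-prime n) p∈))
    total : ∑ xs heavies * Z ≤ k * T
    total = begin
      ∑ xs heavies * Z                                               ≡⟨ cong (_* Z) (count-swap (λ p x → Divides? x p) xs ps) ⟩
      ∑ ps (λ p → length (filter (λ x → Divides? x p) xs)) * Z       ≡⟨ ∑-*ʳ ps (λ p → length (filter (λ x → Divides? x p) xs)) Z ⟨
      ∑ ps (λ p → length (filter (λ x → Divides? x p) xs) * Z)       ≤⟨ ∑-mono ps few ⟩
      ∑ ps (λ _ → T)                                                 ≡⟨ ∑-const ps T ⟩
      k * T                                                          ∎

-- Congruences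

congruent-% : ∀ {m} x .{{_ : NonZero m}} → Congruent m x (x DM.% m)
congruent-% {m} x = 0 , x DM./ m , trans (+-identityʳ x) (DM.m≡m%n+[m/n]*n x m)

congruent-sym : ∀ {m x y} → Congruent m x y → Congruent m y x
congruent-sym (i , j , eq) = j , i , sym eq

congruent-trans : ∀ {m x y z} → Congruent m x y → Congruent m y z → Congruent m x z
congruent-trans {m} {x} {y} {z} (i , j , eq) (k , l , eq′) = i + k , l + j , (begin
  x + (i + k) * m       ≡⟨ e₁ x i k m ⟩
  x + i * m + k * m     ≡⟨ cong (_+ k * m) eq ⟩
  y + j * m + k * m     ≡⟨ e₂ y j k m ⟩
  y + k * m + j * m     ≡⟨ cong (_+ j * m) eq′ ⟩
  z + l * m + j * m     ≡⟨ e₁ z l j m ⟨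
  z + (l + j) * m       ∎)
  where
  open ≡-Reasoning
  e₁ : ∀ x i k m → x + (i + k) * m ≡ x + i * m + k * m
  e₁ = solve-∀
  e₂ : ∀ y j k m → y + j * m + k * m ≡ y + k * m + j * m
  e₂ = solve-∀

congruent-*ˡ : ∀ {m x y} c → Congruent m x y → Congruent m (c * x) (c * y)
congruent-*ˡ {m} {x} {y} c (i , j , eq) = c * i , c * j ,
  trans (e c x i m) (trans (cong (c *_) eq) (sym (e c y j m)))
  where
  e : ∀ c x i m → c * x + c * i * m ≡ c * (x + i * m)
  e = solve-∀

congruent-scale : ∀ {m x y} d → Congruent m x y → Congruent (m * d) (x * d) (y * d)
congruent-scale {m} {x} {y} d (i , j , eq) = i , j ,
  trans (e x i m d) (trans (cong (_* d) eq) (sym (e y j m d)))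
  where
  e : ∀ x i m d → x * d + i * (m * d) ≡ (x + i * m) * d
  e = solve-∀

congruent-unscale : ∀ {m x y} d .{{_ : NonZero d}} → Congruent (m * d) (x * d) (y * d) → Congruent m x y
congruent-unscale {m} {x} {y} d (i , j , eq) = i , j ,
  *-cancelʳ-≡ _ _ d (trans (e x i m d) (trans eq (sym (e y j m d))))
  where
  e : ∀ x i m d → (x + i * m) * d ≡ x * d + i * (m * d)
  e = solve-∀

congruent⇒%≡ : ∀ {m x y} .{{_ : NonZero m}} → Congruent m x y → x DM.% m ≡ y DM.% m
congruent⇒%≡ {m} {x} {y} (i , j , eq) =
  trans (sym (DM.[m+kn]%n≡m%n x i m)) (trans (cong (DM._% m) eq) (DM.[m+kn]%n≡m%n y j m))

congruent⇒≡ : ∀ {m x y} .{{_ : NonZero m}} → x < m → y < m → Congruent m x y → x ≡ y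
congruent⇒≡ x<m y<m c = trans (sym (DM.m<n⇒m%n≡m x<m)) (trans (congruent⇒%≡ c) (DM.m<n⇒m%n≡m y<m))

∣-congruent : ∀ {m x y d} → d ∣ m → Congruent m x y → d ∣ x → d ∣ y
∣-congruent {m} {x} {y} {d} d∣m (i , j , eq) d∣x = ∣m+n∣m⇒∣n
  (subst (d ∣_) (trans eq (+-comm y (j * m))) (∣m∣n⇒∣m+n d∣x (∣n⇒∣m*n i d∣m))) (∣n⇒∣m*n j d∣m)

congruent-cancel : ∀ {m a a′ b} .{{_ : NonZero m}} → Coprime b m → a < m → a′ < m →
                   Congruent m (a * b) (a′ * b) → a ≡ a′
congruent-cancel {m} {a} {a′} {b} coprime a<m a′<m c with inverse coprime
... | b′ , c₁ = congruent⇒≡ a<m a′<m (congruent-trans (congruent-sym (unit a)) (congruent-trans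
    (subst₂ (Congruent m) (e b′ a b) (e b′ a′ b) (congruent-*ˡ b′ c)) (unit a′)))
  where
  e : ∀ c a b → c * (a * b) ≡ a * (c * b)
  e = solve-∀
  unit : ∀ a → Congruent m (a * (b′ * b)) a
  unit a = subst (Congruent m (a * (b′ * b))) (*-identityʳ a) (congruent-*ˡ a c₁)

-- Partial coverings

module Covering (n ℓ : ℕ) .{{n≢0 : NonZero n}} where

  Covers : ℕ → ℕ → Set
  Covers b x = ∃[ a ] (a < suc ℓ × (a * b) DM.% n ≡ x)

  covers? : ∀ b x → Dec (Covers b x)
  covers? b x = anyUpTo? (λ a → (a * b) DM.% n ≟ x) (suc ℓ)

  CoveredBy : List ℕ → ℕ → Set
  CoveredBy bs x = Any (λ b → Covers b x) bs

  coverers : List ℕ → ℕ → List ℕ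
  coverers P x = filter (λ b → covers? b x) P

  module _ (λ′ Q T b₀ : ℕ) (bs₀ : List ℕ) .{{T≢0 : NonZero T}} (1≤ℓ : 1 ≤ ℓ)
           (2^λ≤ℓ : 2 ^ λ′ ≤ ℓ) (ℓ<2^λ⁺ : ℓ < 2 ^ suc λ′) (Tℓ≤ : T * ℓ ≤ Q + ℓ) where

    open Greedy covers? b₀ bs₀ T

    -- After λ halvings of T picks each, at most |X|/2^λ < 2|X|/ℓ or no elements remain, and these
    -- cover themselves with multiplier 1.
    completeGreedily : ∀ X → Rich X → (∀ {x} → x ∈ X → x < n) →
      ∃[ bs ] ((∀ {x} → x ∈ X → CoveredBy bs x) × ℓ * length bs ≤ λ′ * (Q + ℓ) + 2 * length X)
    completeGreedily X rich X<n with halvings λ′ X rich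
    ... | bs , X′ , len , (_ , cover) , small = bs ++ X′ , covered , (begin
      ℓ * length (bs ++ X′)                          ≡⟨ cong (ℓ *_) (trans (length-++ bs) (cong (_+ length X′) len)) ⟩
      ℓ * (λ′ * T + length X′)                       ≡⟨ e₁ ℓ λ′ T (length X′) ⟩
      λ′ * (T * ℓ) + ℓ * length X′                   ≤⟨ +-mono-≤ (*-monoʳ-≤ λ′ Tℓ≤) (*-monoˡ-≤ (length X′) (<⇒≤ ℓ<2^λ⁺)) ⟩
      λ′ * (Q + ℓ) + 2 * 2 ^ λ′ * length X′          ≡⟨ cong (λ′ * (Q + ℓ) +_) (*-assoc 2 (2 ^ λ′) (length X′)) ⟩
      λ′ * (Q + ℓ) + 2 * (2 ^ λ′ * length X′)        ≤⟨ +-monoʳ-≤ (λ′ * (Q + ℓ)) (*-monoʳ-≤ 2 small) ⟩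
      λ′ * (Q + ℓ) + 2 * length X                    ∎)
      where
      open ≤-Reasoning
      e₁ : ∀ ℓ k T u → ℓ * (k * T + u) ≡ k * (T * ℓ) + ℓ * u
      e₁ = solve-∀
      covered : ∀ {x} → x ∈ X → CoveredBy (bs ++ X′) x
      covered {x} x∈X with cover x∈X
      ... | inj₂ any = Anyₚ.++⁺ˡ any
      ... | inj₁ x∈X′ = Anyₚ.++⁺ʳ bs (Any.map (λ { refl → 1 , s≤s 1≤ℓ ,
        trans (cong (DM._% n) (*-identityˡ x)) (DM.m<n⇒m%n≡m (X<n x∈X)) }) x∈X′)

  -- A pool P in which each x ∈ X has at least ℓ|P|/Q coverers yields, by the
  -- greedy argument, a covering of X with about (log ℓ) Q/ℓ + n/ℓ elements.
  fromPool : ∀ λ′ Q X P → 1 ≤ ℓ → 2 ^ λ′ ≤ ℓ → ℓ < 2 ^ suc λ′ → (∀ {x} → x ∈ X → x < n) →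
    (X ≢ [] → P ≢ []) → (∀ {x} → x ∈ X → ℓ * length P ≤ Q * length (coverers P x)) →
    ∃[ bs ] ((∀ {x} → x ∈ X → CoveredBy bs x) × ℓ * length bs ≤ λ′ * (Q + ℓ) + 2 * length X)
  fromPool λ′ Q [] P _ _ _ _ _ _ = [] , (λ ()) , ≤-trans (≤-reflexive (*-zeroʳ ℓ)) z≤n
  fromPool λ′ Q (_ ∷ _) [] _ _ _ _ P≢[] _ = contradiction refl (P≢[] (λ ()))
  fromPool λ′ Q X@(_ ∷ _) (b₀ ∷ bs₀) 1≤ℓ 2^λ≤ℓ ℓ<2^λ⁺ X<n _ enough = go (suc (Q DM./ ℓ))
      (≤-trans (+-monoʳ-≤ ℓ (DM.m/n*n≤m Q ℓ)) (≤-reflexive (+-comm ℓ Q))) (<⇒≤ (m<[1+m/n]*n Q ℓ))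
    where
    instance
      ℓ≢0 : NonZero ℓ
      ℓ≢0 = >-nonZero 1≤ℓ
    e₂ : ∀ ℓ T N → T * ℓ * N ≡ ℓ * (T * N)
    e₂ = solve-∀
    go : ∀ T .{{_ : NonZero T}} → T * ℓ ≤ Q + ℓ → Q ≤ T * ℓ →
      ∃[ bs ] ((∀ {x} → x ∈ X → CoveredBy bs x) × ℓ * length bs ≤ λ′ * (Q + ℓ) + 2 * length X)
    go T Tℓ≤ Q≤ = completeGreedily λ′ Q T b₀ bs₀ 1≤ℓ 2^λ≤ℓ ℓ<2^λ⁺ Tℓ≤ X
      (λ {x} x∈X → *-cancelˡ-≤ ℓ (≤-trans (enough x∈X) (≤-trans
        (*-monoˡ-≤ (length (coverers (b₀ ∷ bs₀) x)) Q≤) (≤-reflexive (e₂ ℓ T (length (coverers (b₀ ∷ bs₀) x))))))) X<n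

  -- n / m, extended by an irrelevant value at m = 0
  cofactor : ℕ → ℕ
  cofactor zero    = 0
  cofactor (suc m) = n DM./ suc m

  cofactor-gcd : ∀ {m d} → m * d ≡ n → cofactor m ≡ d
  cofactor-gcd {zero}  refl = contradiction refl (≢-nonZero⁻¹ 0)
  cofactor-gcd {suc m} {d} md≡n = trans (cong (DM._/ suc m) (trans (sym md≡n) (*-comm (suc m) d))) (DM.m*n/n≡m d (suc m))

  opaque

    modulus : ℕ → ℕ
    modulus x = quotient (gcd[m,n]∣n x n)

    modulus*gcd : ∀ x → modulus x * gcd x n ≡ n
    modulus*gcd x = sym (m∣n⇒n≡quotient*m (gcd[m,n]∣n x n))

    part : ℕ → ℕ
    part x = quotient (gcd[m,n]∣m x n)

    part*gcd : ∀ x → part x * gcd x n ≡ x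
    part*gcd x = sym (m∣n⇒n≡quotient*m (gcd[m,n]∣m x n))

  gcd≢0 : ∀ x → NonZero (gcd x n)
  gcd≢0 x = ≢-nonZero λ eq → ≢-nonZero⁻¹ n (0∣⇒≡0 (subst (_∣ n) eq (gcd[m,n]∣n x n)))

  modulus≢0 : ∀ x → NonZero (modulus x)
  modulus≢0 x = ≢-nonZero λ eq → ≢-nonZero⁻¹ n (trans (sym (modulus*gcd x)) (cong (_* gcd x n) eq))

  part-coprime : ∀ x → Coprime (part x) (modulus x)
  part-coprime x {c} (c∣part , c∣mod) = *-cancelʳ-≡ c 1 (gcd x n) {{gcd≢0 x}}
    (trans (∣-antisym
      (gcd-greatest (subst (c * gcd x n ∣_) (part*gcd x) (*-pres-∣ c∣part ∣-refl))
                    (subst (c * gcd x n ∣_) (modulus*gcd x) (*-pres-∣ c∣mod ∣-refl)))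
      (n∣m*n c)) (sym (*-identityˡ _)))

  part<modulus : ∀ {x} → x < n → part x < modulus x
  part<modulus {x} x<n = *-cancelʳ-< (gcd x n) _ _ (subst₂ _<_ (sym (part*gcd x)) (sym (modulus*gcd x)) x<n)

  -- The covering element depends on x only through `modulus x`, so the number of moduli bounds the
  -- number of elements used.
  cofactor-covers : ∀ {x} → x < n → modulus x ≤ ℓ → Covers (cofactor (modulus x)) x
  cofactor-covers {x} x<n m≤ℓ = part x , s≤s (≤-trans (<⇒≤ (part<modulus x<n)) m≤ℓ) ,
    trans (cong (λ d → (part x * d) DM.% n) (cofactor-gcd {modulus x} (modulus*gcd x)))
      (trans (cong (DM._% n) (part*gcd x)) (DM.m<n⇒m%n≡m x<n))

  gcd-transfer : ∀ {a b x} → Congruent n (a * b) x → gcd b n ∣ gcd x n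
  gcd-transfer {a} {b} c = gcd-greatest (∣-congruent (gcd[m,n]∣n b n) c (∣n⇒∣m*n a (gcd[m,n]∣m b n))) (gcd[m,n]∣n b n)

  -- Multiplication by the inverse of a prime p ∤ n preserves gcd(·,n), and
  -- distinct p ≤ ℓ give distinct elements when ℓ < n / gcd x n.
  module PrimeCoverers {S : ℕ → Set} (S? : Decidable S) (S⇒ : ∀ {g} → S g → ℓ * g < n) where

    -- Both the set to be covered and the pool: dividing by a prime not dividing n preserves the
    -- gcd, so the coverers stay in the class.
    class : List ℕ
    class = filter (λ x → S? (gcd x n)) (downFrom n)

    class⁻ : ∀ {x} → x ∈ class → x < n × S (gcd x n)
    class⁻ x∈ = let x∈n , s = ∈-filter⁻ (λ x → S? (gcd x n)) {xs = downFrom n} x∈ in ∈-downFrom⁻ x∈n , s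

    opaque

      -- junk value 0 when p has no inverse
      divide : ℕ → ℕ → ℕ
      divide x p with prime? p | p ∣? n
      ... | yes prime-p | no p∤n = (x * proj₁ (inverse (Coprimality.sym (prime⇒coprime prime-p p∤n)))) DM.% n
      ... | _ | _ = 0

      divide-spec : ∀ x {p} → Prime p → ¬ p ∣ n →
        ∃[ c ] (Congruent n (c * p) 1 × divide x p ≡ (x * c) DM.% n)
      divide-spec x {p} prime-p p∤n with prime? p | p ∣? n
      ... | no ¬prime | _ = contradiction prime-p ¬prime
      ... | yes _ | yes p∣n = contradiction p∣n p∤n
      ... | yes prime-p′ | no p∤n′ =
        let c , cong = inverse (Coprimality.sym (prime⇒coprime prime-p′ p∤n′)) in c , cong , refl

    many : ∀ {x} → x ∈ class → length (freshLargePrimes n ℓ) ≤ length (coverers class x)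
    many {x} x∈ with class⁻ x∈
    ... | x<n , s = length-inj (divide x)
      (Uniqueₚ.filter⁺ (freshLargePrime? n ℓ) (primesUpTo-unique ℓ))
      into injective
      where
      fresh⁻ : ∀ {p} → p ∈ freshLargePrimes n ℓ → Prime p × p ≤ ℓ × ¬ p ∣ n
      fresh⁻ p∈ with ∈-filter⁻ (freshLargePrime? n ℓ) {xs = primesUpTo ℓ} p∈
      ... | p∈primes , _ , p∤n with ∈-primesUpTo⁻ {ℓ} p∈primes
      ...   | prime-p , p≤ℓ = prime-p , p≤ℓ , p∤n
      multiply : ∀ {p} → Prime p → ¬ p ∣ n → Congruent n (p * divide x p) x
      multiply {p} prime-p p∤n with divide x p | divide-spec x prime-p p∤n
      ... | _ | c , cong , refl = congruent-trans
        (congruent-*ˡ p (congruent-sym (congruent-% (x * c))))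
        (subst₂ (Congruent n) (e x c p) (*-identityʳ x) (congruent-*ˡ x cong))
        where
        e : ∀ x c p → x * (c * p) ≡ p * (x * c)
        e = solve-∀
      divide<n : ∀ {p} → Prime p → ¬ p ∣ n → divide x p < n
      divide<n {p} prime-p p∤n with divide x p | divide-spec x prime-p p∤n
      ... | _ | c , _ , refl = DM.m%n<n (x * c) n
      gcd-divide : ∀ {p} → Prime p → ¬ p ∣ n → gcd (divide x p) n ≡ gcd x n
      gcd-divide {p} prime-p p∤n = ∣-antisym (gcd-transfer {p} (multiply prime-p p∤n)) (back (divide-spec x prime-p p∤n))
        where
        back : ∃[ c ] (Congruent n (c * p) 1 × divide x p ≡ (x * c) DM.% n) → gcd x n ∣ gcd (divide x p) n
        back (c , _ , eq) = gcd-transfer {c} (subst₂ (Congruent n) (*-comm x c) (sym eq) (congruent-% (x * c)))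
      into : ∀ {p} → p ∈ freshLargePrimes n ℓ → divide x p ∈ coverers class x
      into {p} p∈ with fresh⁻ p∈
      ... | prime-p , p≤ℓ , p∤n = ∈-filter⁺ (λ b → covers? b x)
        (∈-filter⁺ (λ x → S? (gcd x n)) (∈-downFrom⁺ (divide<n prime-p p∤n)) (subst S (sym (gcd-divide prime-p p∤n)) s))
        (p , s≤s p≤ℓ , trans (congruent⇒%≡ (multiply prime-p p∤n)) (DM.m<n⇒m%n≡m x<n))
      injective : ∀ {p p′} → p ∈ freshLargePrimes n ℓ → p′ ∈ freshLargePrimes n ℓ → divide x p ≡ divide x p′ → p ≡ p′
      injective {p} {p′} p∈ p′∈ eq with fresh⁻ p∈ | fresh⁻ p′∈
      ... | prime-p , p≤ℓ , p∤n | prime-p′ , p′≤ℓ , p′∤n =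
        -- From p b ≡ p′ b modulo n, cancelling gcd b n and then the part of b prime to `modulus b`
        -- gives p ≡ p′ modulo `modulus b`, which exceeds ℓ.
        congruent-cancel {{modulus≢0 b}} (part-coprime b) (small p≤ℓ) (small p′≤ℓ)
          (congruent-unscale (gcd b n) {{gcd≢0 b}} (subst₂ (λ N → Congruent N (p * part b * gcd b n)) (sym (modulus*gcd b)) (sym (assoc p′))
            (subst (λ t → Congruent n t (p′ * b)) (sym (assoc p))
              (congruent-trans (multiply prime-p p∤n) (congruent-sym (subst (λ t → Congruent n (p′ * t) x) (sym eq) (multiply prime-p′ p′∤n)))))))
        where
        b = divide x p
        assoc : ∀ p → p * part b * gcd b n ≡ p * b
        assoc p = trans (*-assoc p (part b) (gcd b n)) (cong (p *_) (part*gcd b))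
        small : ∀ {p} → p ≤ ℓ → p < modulus b
        small p≤ℓ = ≤-<-trans p≤ℓ (*-cancelʳ-< (gcd b n) _ _
          (<-≤-trans (subst (λ g → ℓ * g < n) (sym (gcd-divide prime-p p∤n)) (S⇒ s)) (≤-reflexive (sym (modulus*gcd b)))))

-- Coverers among the units

product-filter : ∀ {P : Pred ℕ 0ℓ} (P? : Decidable P) (g : ℕ → ℕ) xs →
  product (map g xs) ≡ product (map g (filter P? xs)) * product (map g (filter (¬? ∘ P?) xs))
product-filter P? g []       = refl
product-filter P? g (x ∷ xs) with P? x
... | yes _ = trans (cong (g x *_) (product-filter P? g xs)) (sym (*-assoc (g x) _ _))
... | no  _ = trans (cong (g x *_) (product-filter P? g xs))
                (e (g x) (product (map g (filter P? xs))) (product (map g (filter (¬? ∘ P?) xs))))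
  where
  e : ∀ a b c → a * (b * c) ≡ b * (a * c)
  e = solve-∀

module UnitPool (n ℓ : ℕ) .{{n≢0 : NonZero n}} where

  open Covering n ℓ

  ps : List ℕ
  ps = primeDivisors n

  primes : All Prime ps
  primes = primeDivisors-prime n

  units : List ℕ
  units = filter (avoids? ps) (downFrom n)

  units-bound : length units * product ps ≤ n * totient ps
  units-bound = ≤-trans (*-monoˡ-≤ (product ps) (length-⊆ (Uniqueₚ.filter⁺ (avoids? ps) (Uniqueₚ.downFrom⁺ n))
      λ {b} b∈ → let b<n , av = ∈-filter⁻ (avoids? ps) {xs = downFrom n} b∈ in
        ∈-filter⁺ (λ t → avoids? ps (0 + 1 * t)) b<n (subst (Avoids ps) (sym (*-identityˡ b)) av)))
    (≤-reflexive (progressionSieve ps (primeDivisors-unique n) primes 0 1 n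
      (All.map (λ prime-p p∣1 → ¬prime[1] (subst Prime (∣1⇒≡1 p∣1) prime-p)) primes)
      (product∣ ps (primeDivisors-unique n) primes (primeDivisors-∣ n))))

  -- The units b with a d b ≡ x = y₀ d (mod n), for a coprime to m = n/d, are
  -- the members avoiding ps₂ of a progression modulo m.
  module _ (x d m y₀ l : ℕ) .{{d≢0 : NonZero d}} .{{m≢0 : NonZero m}} (md≡n : m * d ≡ n) (y₀d≡x : y₀ * d ≡ x)
           (y₀⊥m : Coprime y₀ m) (x<n : x < n) (ℓ<n : ℓ < n) (m≤2^l : m ≤ 2 ^ l)
           (good : 2 ^ (3 + θ) * ((l + 2) * (l + 2)) * d ≤ ℓ) where

    -- The congruence a b ≡ y₀ with y₀ prime to m already forces b to avoid `ps₁`, so only `ps₂` has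
    -- to be sieved from b; `ps₁` is what a must avoid to be invertible.
    ps₁ ps₂ : List ℕ
    ps₁ = filter (_∣? m) ps
    ps₂ = filter (¬? ∘ (_∣? m)) ps

    ps₁⁻ : ∀ {p} → p ∈ ps₁ → p ∈ ps × p ∣ m
    ps₁⁻ = ∈-filter⁻ (_∣? m) {xs = ps}

    ps₂⁻ : ∀ {p} → p ∈ ps₂ → p ∈ ps × ¬ p ∣ m
    ps₂⁻ = ∈-filter⁻ (¬? ∘ (_∣? m)) {xs = ps}

    m∣n : m ∣ n
    m∣n = divides d (trans (sym md≡n) (*-comm m d))

    y : ℕ
    y = ℓ DM./ d

    y<m : y < m
    y<m = DM.m<n*o⇒m/o<n (<-≤-trans ℓ<n (≤-reflexive (sym md≡n)))

    as : List ℕ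
    as = filter (avoids? ps₁) (oneTo y)

    as⁻ : ∀ {a} → a ∈ as → a ≤ y × Coprime a m
    as⁻ a∈ = let a∈y , av = ∈-filter⁻ (avoids? ps₁) {xs = oneTo y} a∈ in proj₂ (∈-oneTo⁻ a∈y) ,
      ∤⇒coprime λ prime-p p∣m → All.lookup av
        (∈-filter⁺ (_∣? m) (∈-primeDivisors⁺ prime-p (∣-trans p∣m m∣n)) p∣m)

    opaque
      solution : ∀ a → ∃[ b ] (b < m × (Coprime a m → Congruent m (a * b) y₀))
      solution a with Coprimality.coprime? a m
      -- A placeholder below m: the congruence is promised only for a prime to m.
      ... | no ¬coprime = 0 , >-nonZero⁻¹ m , λ coprime → ⊥-elim (¬coprime coprime)
      ... | yes coprime with inverse coprime
      ...   | a′ , c = (a′ * y₀) DM.% m , DM.m%n<n (a′ * y₀) m , λ _ → congruent-trans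
        (congruent-*ˡ a (congruent-sym (congruent-% (a′ * y₀))))
        (subst₂ (Congruent m) (e y₀ a′ a) (*-identityʳ y₀) (congruent-*ˡ y₀ c))
        where
        e : ∀ y c a → y * (c * a) ≡ a * (c * y)
        e = solve-∀

    base : ℕ → ℕ
    base a = proj₁ (solution a)

    base<m : ∀ a → base a < m
    base<m a = proj₁ (proj₂ (solution a))

    progression : ℕ → ℕ → ℕ
    progression a t = base a + m * t

    progression-% : ∀ a t → Congruent m (progression a t) (base a)
    progression-% a t = 0 , t , trans (+-identityʳ _) (cong (base a +_) (*-comm m t))

    progression-solves : ∀ {a} t → a ∈ as → Congruent m (a * progression a t) y₀
    progression-solves {a} t a∈ =
      congruent-trans (congruent-*ˡ a (progression-% a t)) (proj₂ (proj₂ (solution a)) (proj₂ (as⁻ a∈)))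

    steps : ℕ → List ℕ
    steps a = filter (λ t → avoids? ps₂ (progression a t)) (downFrom d)

    candidates : ℕ → List ℕ
    candidates a = map (progression a) (steps a)

    -- Each p in `ps₂` divides m d but not m, hence d, so the sieve over d terms is exact. The
    -- common length is d ∏ (1 - 1/p) over `ps₂`, that is φ(n)/φ(m).
    length-candidates : ∀ a → length (candidates a) * product ps₂ ≡ d * totient ps₂
    length-candidates a = trans (cong (_* product ps₂) (length-map (progression a) (steps a)))
      (progressionSieve ps₂ ps₂! ps₂-prime (base a) m d
        (All.tabulate (proj₂ ∘ ps₂⁻))
        (product∣ ps₂ ps₂! ps₂-prime (All.tabulate λ {p} p∈ →
          divides-d (proj₂ (ps₂⁻ p∈)) (euclidsLemma m d (All.lookup primes (proj₁ (ps₂⁻ p∈)))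
            (subst (p ∣_) (sym md≡n) (All.lookup (primeDivisors-∣ n) (proj₁ (ps₂⁻ p∈))))))))
      where
      ps₂! : Unique ps₂
      ps₂! = Uniqueₚ.filter⁺ (¬? ∘ (_∣? m)) (primeDivisors-unique n)
      ps₂-prime : All Prime ps₂
      ps₂-prime = All.tabulate (All.lookup primes ∘ proj₁ ∘ ps₂⁻)
      divides-d : ∀ {p} → ¬ p ∣ m → p ∣ m ⊎ p ∣ d → p ∣ d
      divides-d p∤m (inj₁ p∣m) = contradiction p∣m p∤m
      divides-d p∤m (inj₂ p∣d) = p∣d

    candidate-avoids : ∀ {a t} → a ∈ as → t ∈ steps a → Avoids ps (progression a t)
    candidate-avoids {a} {t} a∈ t∈ = All.tabulate λ {p} p∈ → case p∈ (p ∣? m)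
      where
      case : ∀ {p} → p ∈ ps → Dec (p ∣ m) → ¬ p ∣ progression a t
      case p∈ (no p∤m) = All.lookup (proj₂ (∈-filter⁻ (λ t → avoids? ps₂ (progression a t)) {xs = downFrom d} t∈))
        (∈-filter⁺ (¬? ∘ (_∣? m)) p∈ p∤m)
      case {p} p∈ (yes p∣m) p∣b = ¬prime[1] (subst Prime
        (y₀⊥m (∣-congruent p∣m (progression-solves t a∈) (∣n⇒∣m*n a p∣b) , p∣m)) (All.lookup primes p∈))

    candidate-covers : ∀ {a t} → a ∈ as → t ∈ steps a → progression a t ∈ coverers units x
    candidate-covers {a} {t} a∈ t∈ = ∈-filter⁺ (λ b → covers? b x)
      (∈-filter⁺ (avoids? ps) (∈-downFrom⁺ b<n) (candidate-avoids a∈ t∈))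
      (a * d , s≤s (≤-trans (*-monoˡ-≤ d (proj₁ (as⁻ a∈))) (DM.m/n*n≤m ℓ d)) ,
        trans (congruent⇒%≡ (subst₂ (λ N z → Congruent N z x) md≡n (e a (progression a t) d)
          (subst (Congruent (m * d) (a * progression a t * d)) y₀d≡x (congruent-scale d (progression-solves t a∈)))))
          (DM.m<n⇒m%n≡m x<n))
      where
      e : ∀ a b d → a * b * d ≡ a * d * b
      e = solve-∀
      t<d : t < d
      t<d = ∈-downFrom⁻ (proj₁ (∈-filter⁻ (λ t → avoids? ps₂ (progression a t)) {xs = downFrom d} t∈))
      b<n : progression a t < n
      b<n = <-≤-trans (+-monoˡ-< (m * t) (base<m a))
        (≤-trans (≤-reflexive (sym (*-suc m t))) (≤-trans (*-monoʳ-≤ m t<d) (≤-reflexive md≡n)))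

    candidates-count : ∑ as (λ a → length (candidates a)) ≤ length (coverers units x)
    candidates-count = ∑-disjoint candidates (Uniqueₚ.filter⁺ (avoids? ps₁) (oneTo-unique y)) unique into disjoint
      where
      unique : ∀ {a} → a ∈ as → Unique (candidates a)
      unique {a} _ = Uniqueₚ.map⁺ (λ eq → *-cancelˡ-≡ _ _ m (+-cancelˡ-≡ (base a) _ _ eq))
        (Uniqueₚ.filter⁺ (λ t → avoids? ps₂ (progression a t)) (Uniqueₚ.downFrom⁺ d))
      into : ∀ {a b} → a ∈ as → b ∈ candidates a → b ∈ coverers units x
      into {a} a∈ b∈ with ∈-map⁻ (progression a) b∈
      ... | t , t∈ , refl = candidate-covers a∈ t∈
      disjoint : ∀ {a a′ b} → a ∈ as → a′ ∈ as → b ∈ candidates a → b ∈ candidates a′ → a ≡ a′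
      disjoint {a} {a′} a∈ a′∈ b∈ b∈′ with ∈-map⁻ (progression a) b∈ | ∈-map⁻ (progression a′) b∈′
      -- As b is a unit, a b ≡ y₀ determines a modulo m, and a ≤ y < m because ℓ < n.
      ... | t , t∈ , refl | t′ , t′∈ , eq = congruent-cancel {b = progression a t}
        (∤⇒coprime λ prime-p p∣m → All.lookup (candidate-avoids a∈ t∈) (∈-primeDivisors⁺ prime-p (∣-trans p∣m m∣n)))
        (≤-<-trans (proj₁ (as⁻ a∈)) y<m) (≤-<-trans (proj₁ (as⁻ a′∈)) y<m)
        (congruent-trans (progression-solves t a∈)
          (congruent-sym (subst (λ b → Congruent m (a′ * b) y₀) (sym eq) (progression-solves t′ a′∈))))

    -- There are at least (y/96) φ(m)/m admissible a, each with φ(n)/φ(m) coverers, together y d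
    -- φ(n)/(96 n). Replacing y d by ℓ costs the factor 2 in 192 = 2 · 96.
    enough : ℓ * length units ≤ 192 * n * length (coverers units x)
    enough = *-cancelʳ-≤ _ _ (product ps) {{productOfPrimes≢0 primes}} (begin
      ℓ * length units * Π              ≡⟨ *-assoc ℓ (length units) Π ⟩
      ℓ * (length units * Π)            ≤⟨ ℕₚ.*-mono-≤ ℓ≤2yd units-bound ⟩
      2 * (y * d) * (n * totient ps)    ≡⟨ cong (λ v → 2 * (y * d) * (n * v)) (product-filter (_∣? m) pred ps) ⟩
      2 * (y * d) * (n * (V₁ * V₂))     ≡⟨ e₁ y d n V₁ V₂ ⟩
      2 * n * (d * V₂) * (y * V₁)       ≤⟨ *-monoʳ-≤ (2 * n * (d * V₂)) sieve ⟩
      2 * n * (d * V₂) * (96 * (Π₁ * length as)) ≡⟨ e₂ n (d * V₂) Π₁ (length as) ⟩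
      192 * n * Π₁ * (length as * (d * V₂)) ≤⟨ *-monoʳ-≤ (192 * n * Π₁) total ⟩
      192 * n * Π₁ * (N * Π₂)           ≡⟨ e₃ n Π₁ N Π₂ ⟩
      192 * n * N * (Π₁ * Π₂)           ≡⟨ cong (192 * n * N *_) Π-split ⟨
      192 * n * N * Π                   ∎)
      where
      open ≤-Reasoning
      Π = product ps
      Π₁ = product ps₁
      Π₂ = product ps₂
      V₁ = totient ps₁
      V₂ = totient ps₂
      N = length (coverers units x)
      Π-split : Π ≡ Π₁ * Π₂
      Π-split = trans (cong product (sym (map-id ps))) (trans (product-filter (_∣? m) id ps)
        (cong₂ (λ a b → product a * product b) (map-id ps₁) (map-id ps₂)))
      large : 2 ^ (3 + θ) * ((l + 2) * (l + 2)) ≤ y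
      large = ≤⇒≤/ good
      sieve : y * V₁ ≤ 96 * (Π₁ * length as)
      sieve = avoidCount-≥ m l y ps₁ m≤2^l (Uniqueₚ.filter⁺ (_∣? m) (primeDivisors-unique n))
        (All.tabulate (All.lookup primes ∘ proj₁ ∘ ps₁⁻)) (All.tabulate (proj₂ ∘ ps₁⁻)) large
      1≤y : 1 ≤ y
      1≤y = ≤-trans (ℕₚ.*-mono-≤ (m^n>0 2 (3 + θ)) (ℕₚ.*-mono-≤ {1} (m≤n⇒m≤o+n l (s≤s z≤n)) (m≤n⇒m≤o+n l (s≤s z≤n)))) large
      ℓ≤2yd : ℓ ≤ 2 * (y * d)
      ℓ≤2yd = begin
        ℓ                    ≤⟨ <⇒≤ (m<[1+m/n]*n ℓ d) ⟩
        suc y * d            ≤⟨ *-monoˡ-≤ d (+-monoˡ-≤ y 1≤y) ⟩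
        (y + y) * d          ≡⟨ e₀ y d ⟩
        2 * (y * d)          ∎
        where
        e₀ : ∀ y d → (y + y) * d ≡ 2 * (y * d)
        e₀ = solve-∀
      total : length as * (d * V₂) ≤ N * Π₂
      total = begin
        length as * (d * V₂)                           ≡⟨ ∑-const as (d * V₂) ⟨
        ∑ as (λ _ → d * V₂)                            ≤⟨ ∑-mono as (λ {a} _ → ≤-reflexive (sym (length-candidates a))) ⟩
        ∑ as (λ a → length (candidates a) * Π₂)        ≡⟨ ∑-*ʳ as (λ a → length (candidates a)) Π₂ ⟩
        ∑ as (λ a → length (candidates a)) * Π₂        ≤⟨ *-monoˡ-≤ Π₂ candidates-count ⟩
        N * Π₂                                         ∎
      e₁ : ∀ y d n V₁ V₂ → 2 * (y * d) * (n * (V₁ * V₂)) ≡ 2 * n * (d * V₂) * (y * V₁)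
      e₁ = solve-∀
      e₂ : ∀ n D Π A → 2 * n * D * (96 * (Π * A)) ≡ 192 * n * Π * (A * D)
      e₂ = solve-∀
      e₃ : ∀ n Π₁ N Π₂ → 192 * n * Π₁ * (N * Π₂) ≡ 192 * n * N * (Π₁ * Π₂)
      e₃ = solve-∀

-- Assembling a covering

4ab≤[a+b]² : ∀ a b → 4 * (a * b) ≤ (a + b) * (a + b)
4ab≤[a+b]² a b with ≤-total a b
... | inj₁ a≤b = subst (λ b → 4 * (a * b) ≤ (a + b) * (a + b)) (m+[n∸m]≡n a≤b)
  (subst (4 * (a * (a + (b ∸ a))) ≤_) (e a (b ∸ a)) (m≤m+n _ _))
  where
  e : ∀ a d → 4 * (a * (a + d)) + d * d ≡ (a + (a + d)) * (a + (a + d))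
  e = solve-∀
... | inj₂ b≤a = subst (λ a → 4 * (a * b) ≤ (a + b) * (a + b)) (m+[n∸m]≡n b≤a)
  (subst (4 * ((b + (a ∸ b)) * b) ≤_) (e b (a ∸ b)) (m≤m+n _ _))
  where
  e : ∀ b d → 4 * ((b + d) * b) + d * d ≡ (b + d + b) * (b + d + b)
  e = solve-∀

-- Serves the hypothesis 4 μ² ≤ X of `chebyshev` with μ = i + 1. It fails at i = 8; hence the
-- threshold 512 = 2⁹ for ℓ/L.
4[i+1]²≤2^i : ∀ i → 9 ≤ i → 4 * (suc i * suc i) ≤ 2 ^ i
4[i+1]²≤2^i i 9≤i = subst (λ i → 4 * (suc i * suc i) ≤ 2 ^ i) (m+[n∸m]≡n 9≤i) (go (i ∸ 9))
  where
  open ≤-Reasoning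
  e : ∀ d → 4 * ((10 + suc d) * (10 + suc d)) + 4 * (d * d + 18 * d + 79) ≡ 2 * (4 * ((10 + d) * (10 + d)))
  e = solve-∀
  go : ∀ d → 4 * (suc (9 + d) * suc (9 + d)) ≤ 2 ^ (9 + d)
  go zero    = ≤ᵇ⇒≤ 400 512 _
  go (suc d) = begin
    4 * ((10 + suc d) * (10 + suc d))                                 ≤⟨ m≤m+n _ (4 * (d * d + 18 * d + 79)) ⟩
    4 * ((10 + suc d) * (10 + suc d)) + 4 * (d * d + 18 * d + 79)     ≡⟨ e d ⟩
    2 * (4 * ((10 + d) * (10 + d)))                                   ≤⟨ *-monoʳ-≤ 2 (go d) ⟩
    2 * 2 ^ (9 + d)                                                   ≡⟨ cong (2 ^_) (+-suc 9 d) ⟨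
    2 ^ (9 + suc d)                                                   ∎

-- The quotient (j + 1)⁴/2^j peaks at j = 5 with the value 40.5. Only from there on does the left
-- side grow by less than a factor 2 per step, so the smaller j are checked one by one.
[j+1]⁴≤41*2^j : ∀ j → let q = suc j * suc j in q * q ≤ 41 * 2 ^ j
[j+1]⁴≤41*2^j 0 = ≤ᵇ⇒≤ 1 41 _
[j+1]⁴≤41*2^j 1 = ≤ᵇ⇒≤ 16 82 _
[j+1]⁴≤41*2^j 2 = ≤ᵇ⇒≤ 81 164 _
[j+1]⁴≤41*2^j 3 = ≤ᵇ⇒≤ 256 328 _
[j+1]⁴≤41*2^j 4 = ≤ᵇ⇒≤ 625 656 _
[j+1]⁴≤41*2^j (suc (suc (suc (suc (suc d))))) = go d
  where
  open ≤-Reasoning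
  e : ∀ d → let q = (7 + d) * (7 + d) ; p = (6 + d) * (6 + d) in
      q * q + (d * d * d * d + 20 * (d * d * d) + 138 * (d * d) + 356 * d + 191) ≡ 2 * (p * p)
  e = solve-∀
  go : ∀ d → let q = (6 + d) * (6 + d) in q * q ≤ 41 * 2 ^ (5 + d)
  go zero    = ≤ᵇ⇒≤ 1296 1312 _
  go (suc d) = begin
    q * q                  ≤⟨ m≤m+n (q * q) _ ⟩
    q * q + _              ≡⟨ e d ⟩
    2 * (p * p)            ≤⟨ *-monoʳ-≤ 2 (go d) ⟩
    2 * (41 * 2 ^ (5 + d)) ≡⟨ e′ (2 ^ (5 + d)) ⟩
    41 * (2 * 2 ^ (5 + d)) ≡⟨ cong (λ t → 41 * 2 ^ t) (+-suc 5 d) ⟨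
    41 * 2 ^ (5 + suc d)   ∎
    where
    q = (6 + suc d) * (6 + suc d)
    p = (6 + d) * (6 + d)
    e′ : ∀ x → 2 * (41 * x) ≡ 41 * (2 * x)
    e′ = solve-∀

-- `c` is the factor in the hypothesis of `avoidCount-≥`. In `scale`, with q = (j + 1)² and q² ≤ 41
-- L, the bounds r² + 2 ≤ 11 q and s ≤ (θ + 16) q give `k₁` and `k₂` by squaring.
c k₁ k₂ : ℕ
c = 2 ^ (3 + θ)
k₁ = 121 * 41
k₂ = (θ + 16) * (θ + 16) * 41

-- With r ≈ 2 log₂ L, the threshold D = 2^(r²) for large common factors.
record Scale (L : ℕ) : Set where
  field
    r s : ℕ
    density-≤ : (2 * L + 1) * (L + 1) ≤ 2 ^ r
    r-≤ : (r * r + 2) * (r * r + 2) ≤ k₁ * L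
    s-≤ : s * s ≤ k₂ * L
    threshold : c * ((L + 3) * (L + 3)) * 2 ^ (r * r) ≤ 2 ^ s

scale : ∀ L → .{{NonZero L}} → Scale L
scale L with 2^-floor L
... | j , 2^j≤L , L<2^j⁺ = record
  { r = r ; s = s
  ; density-≤ = begin
      (2 * L + 1) * (L + 1)      ≤⟨ ℕₚ.*-mono-≤ 2L+1≤ L+1≤ ⟩
      2 ^ (2 + j) * 2 ^ (1 + j)  ≡⟨ ^-distribˡ-+-* 2 (2 + j) (1 + j) ⟨
      2 ^ (2 + j + (1 + j))      ≡⟨ cong (2 ^_) (e₁ j) ⟩
      2 ^ r                      ∎
  ; r-≤ = begin
      (r * r + 2) * (r * r + 2)  ≤⟨ ℕₚ.*-mono-≤ r²≤ r²≤ ⟩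
      11 * q * (11 * q)          ≡⟨ e₂ q ⟩
      121 * (q * q)              ≤⟨ *-monoʳ-≤ 121 q²≤ ⟩
      121 * (41 * L)             ≡⟨ *-assoc 121 41 L ⟨
      k₁ * L                     ∎
  ; s-≤ = begin
      s * s                          ≤⟨ ℕₚ.*-mono-≤ s≤ s≤ ⟩
      (θ + 16) * q * ((θ + 16) * q)  ≡⟨ e₃ (θ + 16) q ⟩
      (θ + 16) * (θ + 16) * (q * q)  ≤⟨ *-monoʳ-≤ ((θ + 16) * (θ + 16)) q²≤ ⟩
      (θ + 16) * (θ + 16) * (41 * L) ≡⟨ *-assoc ((θ + 16) * (θ + 16)) 41 L ⟨
      k₂ * L                         ∎
  ; threshold = begin
      c * ((L + 3) * (L + 3)) * 2 ^ (r * r)                      ≤⟨ *-monoˡ-≤ (2 ^ (r * r)) (*-monoʳ-≤ c (ℕₚ.*-mono-≤ L+3≤ L+3≤)) ⟩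
      c * (2 ^ (2 + j) * 2 ^ (2 + j)) * 2 ^ (r * r)              ≡⟨ cong (λ t → c * t * 2 ^ (r * r)) (^-distribˡ-+-* 2 (2 + j) (2 + j)) ⟨
      c * 2 ^ (2 + j + (2 + j)) * 2 ^ (r * r)                    ≡⟨ cong (_* 2 ^ (r * r)) (^-distribˡ-+-* 2 (3 + θ) (2 + j + (2 + j))) ⟨
      2 ^ (3 + θ + (2 + j + (2 + j))) * 2 ^ (r * r)              ≡⟨ ^-distribˡ-+-* 2 (3 + θ + (2 + j + (2 + j))) (r * r) ⟨
      2 ^ s                                                      ∎
  }
  where
  open ≤-Reasoning
  -- 2^r = 2^(j+2) · 2^(j+1), where the factors bound 2L + 1 and L + 1 respectively.
  r = 2 * j + 3
  -- The exponents of `c`, of the square of the bound 2^(j+2) for L + 3, and of D.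
  s = 3 + θ + (2 + j + (2 + j)) + r * r
  q = suc j * suc j
  L+1≤ : L + 1 ≤ 2 ^ (1 + j)
  L+1≤ = subst (_≤ 2 ^ (1 + j)) (+-comm 1 L) L<2^j⁺
  2L+1≤ : 2 * L + 1 ≤ 2 ^ (2 + j)
  2L+1≤ = ≤-trans (≤-trans (m≤m+n (2 * L + 1) 1) (≤-reflexive (e L))) (*-monoʳ-≤ 2 L+1≤)
    where
    e : ∀ L → 2 * L + 1 + 1 ≡ 2 * (L + 1)
    e = solve-∀
  L+3≤ : L + 3 ≤ 2 ^ (2 + j)
  L+3≤ = ≤-trans (≤-trans (+-monoʳ-≤ L (+-monoˡ-≤ 2 (>-nonZero⁻¹ L))) (≤-reflexive (e L))) (*-monoʳ-≤ 2 L+1≤)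
    where
    e : ∀ L → L + (L + 2) ≡ 2 * (L + 1)
    e = solve-∀
  q²≤ : q * q ≤ 41 * L
  q²≤ = ≤-trans ([j+1]⁴≤41*2^j j) (*-monoʳ-≤ 41 2^j≤L)
  e₁ : ∀ j → 2 + j + (1 + j) ≡ 2 * j + 3
  e₁ = solve-∀
  e₂ : ∀ q → 11 * q * (11 * q) ≡ 121 * (q * q)
  e₂ = solve-∀
  e₃ : ∀ a q → a * q * (a * q) ≡ a * a * (q * q)
  e₃ = solve-∀
  r²≤ : r * r + 2 ≤ 11 * q
  r²≤ = ≤-trans (m≤m+n _ (7 * (j * j) + 10 * j)) (≤-reflexive (e j))
    where
    e : ∀ j → (2 * j + 3) * (2 * j + 3) + 2 + (7 * (j * j) + 10 * j) ≡ 11 * (suc j * suc j)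
    e = solve-∀
  s≤ : s ≤ (θ + 16) * q
  s≤ = ≤-trans (m≤m+n _ (θ * (j * j + 2 * j) + (12 * (j * j) + 18 * j))) (≤-reflexive (e θ j))
    where
    e : ∀ θ j → 3 + θ + (2 + j + (2 + j)) + (2 * j + 3) * (2 * j + 3) + (θ * (j * j + 2 * j) + (12 * (j * j) + 18 * j))
              ≡ (θ + 16) * (suc j * suc j)
    e = solve-∀

familyConstant : ℕ
familyConstant = 4 * k₂ + 3 + 2 ^ k₂ + (195 + (4 * 1 + 3 + (c * k₁ + c * 16)))

-- Covering families for ℓ > 512 L

module Assembly (n ℓ L λ′ : ℕ) .{{n≢0 : NonZero n}} .{{L≢0 : NonZero L}} (1≤ℓ : 1 ≤ ℓ) (ℓ<n : ℓ < n)
                (2^L≤n : 2 ^ L ≤ n) (n<2^L⁺ : n < 2 ^ suc L)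
                (2^λ≤ℓ : 2 ^ λ′ ≤ ℓ) (ℓ<2^λ⁺ : ℓ < 2 ^ suc λ′) (512L<ℓ : 512 * L < ℓ) where

  open Covering n ℓ
  open Scale (scale L)
  open LargeGCD n r using (D; largeGCD?; density)
  open UnitPool n ℓ using (units; enough)

  1≤L : 1 ≤ L
  1≤L = >-nonZero⁻¹ L

  instance
    ℓ≢0 : NonZero ℓ
    ℓ≢0 = >-nonZero 1≤ℓ

  λ≤L : λ′ ≤ L
  λ≤L = s≤s⁻¹ (≰⇒> λ L<λ → <-irrefl refl (<-≤-trans n<2^L⁺ (≤-trans (^-monoʳ-≤ 2 L<λ) (≤-trans 2^λ≤ℓ (<⇒≤ ℓ<n)))))

  -- `k` is the cost in units of n L / ℓ, so that costs add under `_∪_`.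
  record Family (X : ℕ → Set) (k : ℕ) : Set where
    constructor family-of
    field
      members : List ℕ
      cover   : ∀ {x} → X x → CoveredBy members x
      size    : ℓ * length members ≤ k * (n * L)

  _∪_ : ∀ {X Y k l} → Family X k → Family Y l → Family (λ x → X x ⊎ Y x) (k + l)
  _∪_ {k = k} {l} (family-of bs cover bound) (family-of bs′ cover′ bound′) = family-of (bs ++ bs′)
    (λ { (inj₁ X) → Anyₚ.++⁺ˡ (cover X) ; (inj₂ Y) → Anyₚ.++⁺ʳ bs (cover′ Y) }) (begin
      ℓ * length (bs ++ bs′)           ≡⟨ cong (ℓ *_) (length-++ bs) ⟩
      ℓ * (length bs + length bs′)     ≡⟨ *-distribˡ-+ ℓ (length bs) (length bs′) ⟩
      ℓ * length bs + ℓ * length bs′   ≤⟨ +-mono-≤ bound bound′ ⟩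
      k * (n * L) + l * (n * L)        ≡⟨ *-distribʳ-+ (n * L) k l ⟨
      (k + l) * (n * L)                ∎)
    where open ≤-Reasoning

  weaken : ∀ {X Y k} → (∀ {x} → Y x → X x) → Family X k → Family Y k
  weaken sub (family-of bs cover bound) = family-of bs (cover ∘ sub) bound

  enlarge : ∀ {X k l} → Family X k → k ≤ l → Family X l
  enlarge (family-of bs cover bound) k≤l = family-of bs cover (≤-trans bound (*-monoˡ-≤ (n * L) k≤l))

  n≤nL : n ≤ n * L
  n≤nL = m≤m*n n L

  λℓ≤nL : λ′ * ℓ ≤ n * L
  λℓ≤nL = ≤-trans (ℕₚ.*-mono-≤ λ≤L (<⇒≤ ℓ<n)) (≤-reflexive (*-comm L n))

  -- The assumption 512 L < ℓ enters here: it gives 8 (L + 3) ≤ ℓ and, as L ≥ 1, also λ ≥ 9.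
  fresh-≥ : ℓ ≤ 4 * suc λ′ * length (freshLargePrimes n ℓ)
  fresh-≥ = chebyshev n ℓ (suc λ′) (suc L) (<⇒≤ n<2^L⁺) (<⇒≤ ℓ<2^λ⁺) 8[L+3]≤ℓ (≤-trans (4[i+1]²≤2^i λ′ 9≤λ) 2^λ≤ℓ)
    where
    open ≤-Reasoning
    e : ∀ L → 512 * L ≡ 8 * L + 24 * L + 480 * L
    e = solve-∀
    e′ : ∀ L → 8 * (suc L + 2) ≡ 8 * L + 24 * 1
    e′ = solve-∀
    8[L+3]≤ℓ : 8 * (suc L + 2) ≤ ℓ
    8[L+3]≤ℓ = begin
      8 * (suc L + 2)             ≡⟨ e′ L ⟩
      8 * L + 24 * 1              ≤⟨ +-monoʳ-≤ (8 * L) (*-monoʳ-≤ 24 1≤L) ⟩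
      8 * L + 24 * L              ≤⟨ m≤m+n _ (480 * L) ⟩
      8 * L + 24 * L + 480 * L    ≡⟨ e L ⟨
      512 * L                     ≤⟨ <⇒≤ 512L<ℓ ⟩
      ℓ                           ∎
    9≤λ : 9 ≤ λ′
    9≤λ = s≤s⁻¹ (≰⇒> λ λ⁺≤9 → <-irrefl refl (begin-strict
      512                         ≤⟨ *-monoʳ-≤ 512 1≤L ⟩
      512 * L                     <⟨ 512L<ℓ ⟩
      ℓ                           <⟨ ℓ<2^λ⁺ ⟩
      2 ^ suc λ′                  ≤⟨ ^-monoʳ-≤ 2 λ⁺≤9 ⟩
      512                         ∎))

  module _ {S : ℕ → Set} (S? : Decidable S) (S⇒ : ∀ {g} → S g → ℓ * g < n) where

    open PrimeCoverers S? S⇒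

    -- Of the two logarithmic factors in the hypothesis, one is the number of halvings and the other
    -- comes from the density of primes up to ℓ. The summand 3 pays for rounding Q/ℓ and for the
    -- leftovers of the greedy choice.
    classFamily : ∀ k → λ′ * suc λ′ * length class ≤ k * (n * L) → Family (λ x → x < n × S (gcd x n)) (4 * k + 3)
    classFamily k bound = finish (fromPool λ′ (4 * suc λ′ * P) class class 1≤ℓ 2^λ≤ℓ ℓ<2^λ⁺ (proj₁ ∘ class⁻) id rich)
      where
      open ≤-Reasoning
      P = length class
      P≤ : P ≤ n * L
      P≤ = ≤-trans (≤-trans (length-filter (λ x → S? (gcd x n)) (downFrom n)) (≤-reflexive (length-downFrom n))) n≤nL
      e₁ : ∀ μ K P → 4 * μ * K * P ≡ 4 * μ * P * K
      e₁ = solve-∀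
      e₂ : ∀ λ′ P ℓ → λ′ * (4 * suc λ′ * P + ℓ) + 2 * P ≡ 4 * (λ′ * suc λ′ * P) + λ′ * ℓ + 2 * P
      e₂ = solve-∀
      e₃ : ∀ k N → 4 * (k * N) + N + 2 * N ≡ (4 * k + 3) * N
      e₃ = solve-∀
      rich : ∀ {x} → x ∈ class → ℓ * P ≤ 4 * suc λ′ * P * length (coverers class x)
      rich {x} x∈ = ≤-trans (≤-trans (*-monoˡ-≤ P fresh-≥) (≤-reflexive (e₁ (suc λ′) (length (freshLargePrimes n ℓ)) P)))
        (*-monoʳ-≤ (4 * suc λ′ * P) (many x∈))
      finish : ∃[ bs ] ((∀ {x} → x ∈ class → CoveredBy bs x) × ℓ * length bs ≤ λ′ * (4 * suc λ′ * P + ℓ) + 2 * P) →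
               Family (λ x → x < n × S (gcd x n)) (4 * k + 3)
      finish (bs , cover , size) = family-of bs
        (λ { (x<n , s) → cover (∈-filter⁺ (λ x → S? (gcd x n)) (∈-downFrom⁺ x<n) s) }) (begin
          ℓ * length bs                                     ≤⟨ size ⟩
          λ′ * (4 * suc λ′ * P + ℓ) + 2 * P                 ≡⟨ e₂ λ′ P ℓ ⟩
          4 * (λ′ * suc λ′ * P) + λ′ * ℓ + 2 * P            ≤⟨ +-mono-≤ (+-mono-≤ (*-monoʳ-≤ 4 bound) λℓ≤nL) (*-monoʳ-≤ 2 P≤) ⟩
          4 * (k * (n * L)) + n * L + 2 * (n * L)           ≡⟨ e₃ k (n * L) ⟩
          (4 * k + 3) * (n * L)                             ∎)

  cofactorFamily : ∀ ms k → ℓ * length ms ≤ k * (n * L) → Family (λ x → x < n × modulus x ≤ ℓ × modulus x ∈ ms) k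
  cofactorFamily ms k bound = family-of (map cofactor ms)
    (λ { (x<n , m≤ℓ , m∈) → Anyₚ.map⁺ (Any.map (λ { refl → cofactor-covers x<n m≤ℓ }) m∈) })
    (≤-trans (≤-reflexive (cong (ℓ *_) (length-map cofactor ms))) bound)

  modulus≤ℓ : ∀ {x} → n ≤ ℓ * gcd x n → modulus x ≤ ℓ
  modulus≤ℓ {x} n≤ = *-cancelʳ-≤ _ _ (gcd x n) {{gcd≢0 x}} (≤-trans (≤-reflexive (modulus*gcd x)) n≤)

  1≤modulus : ∀ x → 1 ≤ modulus x
  1≤modulus x = >-nonZero⁻¹ (modulus x) {{modulus≢0 x}}

  -- Here log² ℓ = O(log n), and Chebyshev's bound suffices for all x.
  module Short (short : ℓ < c * ((L + 3) * (L + 3)) * D) where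

    λ<s : λ′ < s
    λ<s = ≰⇒> λ s≤λ → <-irrefl refl (<-≤-trans short (≤-trans threshold (≤-trans (^-monoʳ-≤ 2 s≤λ) 2^λ≤ℓ)))

    primeFamily : Family (λ x → x < n × ℓ * gcd x n < n) (4 * k₂ + 3)
    primeFamily = classFamily (λ g → ℓ * g <? n) id k₂ (begin
      λ′ * suc λ′ * P      ≤⟨ ℕₚ.*-mono-≤ (ℕₚ.*-mono-≤ (<⇒≤ λ<s) λ<s) P≤n ⟩
      s * s * n            ≤⟨ *-monoˡ-≤ n s-≤ ⟩
      k₂ * L * n           ≡⟨ *-assoc k₂ L n ⟩
      k₂ * (L * n)         ≡⟨ cong (k₂ *_) (*-comm L n) ⟩
      k₂ * (n * L)         ∎)
      where
      open ≤-Reasoning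
      P = length (PrimeCoverers.class (λ g → ℓ * g <? n) id)
      P≤n : P ≤ n
      P≤n = ≤-trans (length-filter (λ x → ℓ * gcd x n <? n) (downFrom n)) (≤-reflexive (length-downFrom n))

    -- All moduli up to ℓ are affordable, since here ℓ² ≤ 2^(2s) ≤ 2^k₂ n.
    smallFamily : Family (λ x → x < n × modulus x ≤ ℓ × modulus x ∈ oneTo ℓ) (2 ^ k₂)
    smallFamily = cofactorFamily (oneTo ℓ) (2 ^ k₂) (begin
      ℓ * length (oneTo ℓ)     ≡⟨ cong (ℓ *_) (length-oneTo ℓ) ⟩
      ℓ * ℓ                    ≤⟨ ℕₚ.*-mono-≤ ℓ≤2^s ℓ≤2^s ⟩
      2 ^ s * 2 ^ s            ≡⟨ ^-distribˡ-+-* 2 s s ⟨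
      2 ^ (s + s)              ≤⟨ ^-monoʳ-≤ 2 s+s≤ ⟩
      2 ^ (k₂ + L)             ≡⟨ ^-distribˡ-+-* 2 k₂ L ⟩
      2 ^ k₂ * 2 ^ L           ≤⟨ *-monoʳ-≤ (2 ^ k₂) (≤-trans 2^L≤n n≤nL) ⟩
      2 ^ k₂ * (n * L)         ∎)
      where
      open ≤-Reasoning
      ℓ≤2^s : ℓ ≤ 2 ^ s
      ℓ≤2^s = <⇒≤ (<-≤-trans short threshold)
      e : ∀ s → (s + s) * (s + s) ≡ 4 * (s * s)
      e = solve-∀
      s+s≤ : s + s ≤ k₂ + L
      -- By the inequality of the means, (2s)² ≤ 4 k₂ L ≤ (k₂ + L)².
      s+s≤ = m*m≤n*n⇒m≤n (≤-trans (≤-reflexive (e s)) (≤-trans (*-monoʳ-≤ 4 s-≤) (4ab≤[a+b]² k₂ L)))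

    family : Family (_< n) (4 * k₂ + 3 + 2 ^ k₂)
    family = weaken (λ {x} x<n → classify x<n (ℓ * gcd x n <? n)) (primeFamily ∪ smallFamily)
      where
      classify : ∀ {x} → x < n → Dec (ℓ * gcd x n < n) →
        (x < n × ℓ * gcd x n < n) ⊎ (x < n × modulus x ≤ ℓ × modulus x ∈ oneTo ℓ)
      classify x<n (yes lt) = inj₁ (x<n , lt)
      classify {x} x<n (no ¬lt) = inj₂ (x<n , m≤ℓ , ∈-oneTo⁺ (1≤modulus x) m≤ℓ)
        where m≤ℓ = modulus≤ℓ (≮⇒≥ ¬lt)

  module Long (long : c * ((L + 3) * (L + 3)) * D ≤ ℓ) where

    -- Each alternative is the hypothesis of the unit pool for one bound l on log₂ m: l = r² when m
    -- ≤ D = 2^(r²), and l = L + 1 always.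
    Good : ℕ → Set
    Good x = (modulus x ≤ D × c * ((r * r + 2) * (r * r + 2)) * gcd x n ≤ ℓ)
           ⊎ c * ((suc L + 2) * (suc L + 2)) * gcd x n ≤ ℓ

    good? : Decidable Good
    good? x = (modulus x ≤? D ×-dec c * ((r * r + 2) * (r * r + 2)) * gcd x n ≤? ℓ)
        ⊎-dec (c * ((suc L + 2) * (suc L + 2)) * gcd x n ≤? ℓ)

    -- The choice of r pays off: n has at most L prime divisors, so the density (2L + 1)/2^r is at
    -- most 1/(L + 1).
    sparse : ∀ T → length (filter largeGCD? (oneTo T)) * (L + 1) ≤ T
    sparse T = *-cancelʳ-≤ _ _ (2 * L + 1) {{m+1≢0}} (begin
      G * (L + 1) * (2 * L + 1)              ≡⟨ e G L ⟩
      G * ((2 * L + 1) * (L + 1))            ≤⟨ *-monoʳ-≤ G density-≤ ⟩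
      G * 2 ^ r                              ≤⟨ density T ⟩
      T * (2 * length (primeDivisors n) + 1) ≤⟨ *-monoʳ-≤ T (+-monoˡ-≤ 1 (*-monoʳ-≤ 2 (length-primeDivisors n L n<2^L⁺))) ⟩
      T * (2 * L + 1)                        ∎)
      where
      open ≤-Reasoning
      G = length (filter largeGCD? (oneTo T))
      m+1≢0 : NonZero (2 * L + 1)
      m+1≢0 = >-nonZero (m≤n+m 1 (2 * L))
      e : ∀ G L → G * (L + 1) * (2 * L + 1) ≡ G * ((2 * L + 1) * (L + 1))
      e = solve-∀

    unitFamily : Family (λ x → x < n × Good x) 195
    unitFamily = finish (fromPool λ′ (192 * n) goods units 1≤ℓ 2^λ≤ℓ ℓ<2^λ⁺
        (proj₁ ∘ goods⁻) (λ _ → units≢[]) (λ x∈ → rich (proj₁ (goods⁻ x∈)) (proj₂ (goods⁻ x∈))))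
      where
      open ≤-Reasoning
      goods = filter good? (downFrom n)
      goods⁻ : ∀ {x} → x ∈ goods → x < n × Good x
      goods⁻ x∈ = let x∈n , good = ∈-filter⁻ good? {xs = downFrom n} x∈ in ∈-downFrom⁻ x∈n , good
      1∈units : 1 ∈ units
      1∈units = ∈-filter⁺ (avoids? (primeDivisors n)) (∈-downFrom⁺ (≤-<-trans 1≤ℓ ℓ<n))
        (All.map (λ prime-p p∣1 → ¬prime[1] (subst Prime (∣1⇒≡1 p∣1) prime-p)) (primeDivisors-prime n))
      units≢[] : units ≢ []
      units≢[] eq = nothing (subst (1 ∈_) eq 1∈units)
        where
        nothing : ¬ 1 ∈ []
        nothing ()
      rich : ∀ {x} → x < n → Good x → ℓ * length units ≤ 192 * n * length (coverers units x)
      rich {x} x<n (inj₁ (m≤D , good)) = enough x (gcd x n) (modulus x) (part x) (r * r) {{gcd≢0 x}} {{modulus≢0 x}}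
        (modulus*gcd x) (part*gcd x) (part-coprime x) x<n ℓ<n m≤D good
      rich {x} x<n (inj₂ good) = enough x (gcd x n) (modulus x) (part x) (suc L) {{gcd≢0 x}} {{modulus≢0 x}}
        (modulus*gcd x) (part*gcd x) (part-coprime x) x<n ℓ<n
        (≤-trans (≤-trans (m≤m*n (modulus x) (gcd x n) {{gcd≢0 x}}) (≤-reflexive (modulus*gcd x))) (<⇒≤ n<2^L⁺)) good
      G = length goods
      G≤ : G ≤ n * L
      G≤ = ≤-trans (≤-trans (length-filter good? (downFrom n)) (≤-reflexive (length-downFrom n))) n≤nL
      λn≤ : λ′ * n ≤ n * L
      λn≤ = ≤-trans (*-monoˡ-≤ n λ≤L) (≤-reflexive (*-comm L n))
      e₁ : ∀ λ′ n ℓ G → λ′ * (192 * n + ℓ) + 2 * G ≡ 192 * (λ′ * n) + λ′ * ℓ + 2 * G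
      e₁ = solve-∀
      e₂ : ∀ N → 192 * N + N + 2 * N ≡ 195 * N
      e₂ = solve-∀
      finish : ∃[ bs ] ((∀ {x} → x ∈ goods → CoveredBy bs x) × ℓ * length bs ≤ λ′ * (192 * n + ℓ) + 2 * G) →
               Family (λ x → x < n × Good x) 195
      finish (bs , cover , size) = family-of bs
        (λ { (x<n , good) → cover (∈-filter⁺ good? (∈-downFrom⁺ x<n) good) }) (begin
          ℓ * length bs                                     ≤⟨ size ⟩
          λ′ * (192 * n + ℓ) + 2 * G                        ≡⟨ e₁ λ′ n ℓ G ⟩
          192 * (λ′ * n) + λ′ * ℓ + 2 * G                   ≤⟨ +-mono-≤ (+-mono-≤ (*-monoʳ-≤ 192 λn≤) λℓ≤nL) (*-monoʳ-≤ 2 G≤) ⟩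
          192 * (n * L) + n * L + 2 * (n * L)               ≡⟨ e₂ (n * L) ⟩
          195 * (n * L)                                     ∎)

    primeFamily : Family (λ x → x < n × (ℓ * gcd x n < n × D < gcd x n)) (4 * 1 + 3)
    primeFamily = classFamily (λ g → ℓ * g <? n ×-dec D <? g) proj₁ 1 (begin
      λ′ * suc λ′ * P             ≡⟨ e λ′ P ⟩
      λ′ * (P * (λ′ + 1))         ≤⟨ ℕₚ.*-mono-≤ λ≤L (≤-trans (*-monoʳ-≤ P (+-monoˡ-≤ 1 λ≤L)) P≤) ⟩
      L * n                       ≡⟨ e′ L n ⟩
      1 * (n * L)                 ∎)
      where
      open ≤-Reasoning
      S? : Decidable (λ g → ℓ * g < n × D < g)
      S? g = ℓ * g <? n ×-dec D <? g
      P = length (PrimeCoverers.class S? proj₁)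
      e : ∀ λ′ P → λ′ * suc λ′ * P ≡ λ′ * (P * (λ′ + 1))
      e = solve-∀
      e′ : ∀ L n → L * n ≡ 1 * (n * L)
      e′ = solve-∀
      P≤ : P * (L + 1) ≤ n
      P≤ = ≤-trans (*-monoˡ-≤ (L + 1) (length-⊆ (Uniqueₚ.filter⁺ (λ x → S? (gcd x n)) (Uniqueₚ.downFrom⁺ n)) into)) (sparse n)
        where
        into : ∀ {x} → x ∈ PrimeCoverers.class S? proj₁ → x ∈ filter largeGCD? (oneTo n)
        into {x} x∈ with PrimeCoverers.class⁻ S? proj₁ x∈
        ... | x<n , ℓg<n , D<g = ∈-filter⁺ largeGCD? (∈-oneTo⁺ (positive x ℓg<n) (<⇒≤ x<n)) D<g
          where
          positive : ∀ x → ℓ * gcd x n < n → 1 ≤ x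
          positive (suc x) _ = s≤s z≤n
          -- `oneTo` starts at 1, so x = 0 has to be excluded: n divides gcd 0 n, against ℓ · gcd 0
          -- n < n.
          positive zero ℓg<n = contradiction (<-≤-trans ℓg<n
            (≤-trans (∣⇒≤ {{gcd≢0 0}} (gcd-greatest (n ∣0) ∣-refl)) (m≤n*m (gcd 0 n) ℓ))) (<-irrefl refl)

    -- Where x fails an inequality a g ≤ ℓ from `Good`, its modulus n/g is at most a n / ℓ.
    T₁ T₂ : ℕ
    T₁ = c * ((r * r + 2) * (r * r + 2)) * n DM./ ℓ
    T₂ = c * ((suc L + 2) * (suc L + 2)) * n DM./ ℓ

    tinyFamily : Family (λ x → x < n × modulus x ≤ ℓ × modulus x ∈ oneTo T₁) (c * k₁)
    tinyFamily = cofactorFamily (oneTo T₁) (c * k₁) (begin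
      ℓ * length (oneTo T₁)                        ≡⟨ cong (ℓ *_) (length-oneTo T₁) ⟩
      ℓ * T₁                                       ≡⟨ *-comm ℓ T₁ ⟩
      T₁ * ℓ                                       ≤⟨ DM.m/n*n≤m _ ℓ ⟩
      c * ((r * r + 2) * (r * r + 2)) * n          ≤⟨ *-monoˡ-≤ n (*-monoʳ-≤ c r-≤) ⟩
      c * (k₁ * L) * n                             ≡⟨ e c k₁ L n ⟩
      c * k₁ * (n * L)                             ∎)
      where
      open ≤-Reasoning
      e : ∀ c k L n → c * (k * L) * n ≡ c * k * (n * L)
      e = solve-∀

    -- Up to `T₂` there are of the order of L² n / ℓ numbers, too many by a factor L. The moduli
    -- concerned divide n and exceed D, so gcd m n = m > D, and `sparse` saves this factor.
    sparseFamily : Family (λ x → x < n × modulus x ≤ ℓ × modulus x ∈ filter largeGCD? (oneTo T₂)) (c * 16)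
    sparseFamily = cofactorFamily (filter largeGCD? (oneTo T₂)) (c * 16) (*-cancelʳ-≤ _ _ (L + 1) {{L+1≢0}} (begin
      ℓ * G * (L + 1)                              ≡⟨ *-assoc ℓ G (L + 1) ⟩
      ℓ * (G * (L + 1))                            ≤⟨ *-monoʳ-≤ ℓ (sparse T₂) ⟩
      ℓ * T₂                                       ≡⟨ *-comm ℓ T₂ ⟩
      T₂ * ℓ                                       ≤⟨ DM.m/n*n≤m _ ℓ ⟩
      c * ((suc L + 2) * (suc L + 2)) * n          ≤⟨ *-monoˡ-≤ n (*-monoʳ-≤ c quadratic) ⟩
      c * (16 * (L * (L + 1))) * n                 ≡⟨ e c L n ⟩
      c * 16 * (n * L) * (L + 1)                   ∎))
      where
      open ≤-Reasoning
      G = length (filter largeGCD? (oneTo T₂))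
      L+1≢0 : NonZero (L + 1)
      L+1≢0 = >-nonZero (m≤n+m 1 L)
      e : ∀ c L n → c * (16 * (L * (L + 1))) * n ≡ c * 16 * (n * L) * (L + 1)
      e = solve-∀
      e′ : ∀ L → (suc L + 2) * (suc L + 2) ≡ L * L + 6 * L + 9 * (1 * 1)
      e′ = solve-∀
      e″ : ∀ L → L * L + 6 * L + 9 * (L * L) + (6 * (L * L) + 10 * L) ≡ 16 * (L * (L + 1))
      e″ = solve-∀
      quadratic : (suc L + 2) * (suc L + 2) ≤ 16 * (L * (L + 1))
      quadratic = begin
        (suc L + 2) * (suc L + 2)                                  ≡⟨ e′ L ⟩
        L * L + 6 * L + 9 * (1 * 1)                                ≤⟨ +-monoʳ-≤ (L * L + 6 * L) (*-monoʳ-≤ 9 (ℕₚ.*-mono-≤ 1≤L 1≤L)) ⟩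
        L * L + 6 * L + 9 * (L * L)                                ≤⟨ m≤m+n _ (6 * (L * L) + 10 * L) ⟩
        L * L + 6 * L + 9 * (L * L) + (6 * (L * L) + 10 * L)       ≡⟨ e″ L ⟩
        16 * (L * (L + 1))                                         ∎

    modulus-≤ : ∀ {x} a → ℓ < a * gcd x n → modulus x ≤ a * n DM./ ℓ
    modulus-≤ {x} a lt = ≤⇒≤/ (begin
      modulus x * ℓ                ≤⟨ *-monoʳ-≤ (modulus x) (<⇒≤ lt) ⟩
      modulus x * (a * gcd x n)    ≡⟨ e (modulus x) a (gcd x n) ⟩
      a * (modulus x * gcd x n)    ≡⟨ cong (a *_) (modulus*gcd x) ⟩
      a * n                        ∎)
      where
      open ≤-Reasoning
      e : ∀ m a g → m * (a * g) ≡ a * (m * g)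
      e = solve-∀

    family : Family (_< n) (195 + (4 * 1 + 3 + (c * k₁ + c * 16)))
    family = weaken (λ {x} x<n → classify x<n (good? x) (ℓ * gcd x n <? n) (modulus x ≤? D))
      (unitFamily ∪ (primeFamily ∪ (tinyFamily ∪ sparseFamily)))
      where
      classify : ∀ {x} → x < n → Dec (Good x) → Dec (ℓ * gcd x n < n) → Dec (modulus x ≤ D) →
        (x < n × Good x) ⊎ ((x < n × (ℓ * gcd x n < n × D < gcd x n)) ⊎
        ((x < n × modulus x ≤ ℓ × modulus x ∈ oneTo T₁) ⊎
         (x < n × modulus x ≤ ℓ × modulus x ∈ filter largeGCD? (oneTo T₂))))
      classify x<n (yes good) _ _ = inj₁ (x<n , good)
      classify {x} x<n (no ¬good) (yes lt) _ = inj₂ (inj₁ (x<n , lt ,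
        -- Failing the second alternative of `Good` means ℓ < c (L + 3)² g, while ℓ ≥ c (L + 3)² D;
        -- hence g > D.
        *-cancelˡ-< (c * ((L + 3) * (L + 3))) _ _ (≤-<-trans long
          (subst (λ t → ℓ < c * (t * t) * gcd x n) (sym (+-suc L 2)) (≰⇒> (¬good ∘ inj₂))))))
      classify {x} x<n (no ¬good) (no ¬lt) (yes m≤D) = inj₂ (inj₂ (inj₁ (x<n , modulus≤ℓ (≮⇒≥ ¬lt) ,
        ∈-oneTo⁺ (1≤modulus x) (modulus-≤ (c * ((r * r + 2) * (r * r + 2))) (≰⇒> λ le → ¬good (inj₁ (m≤D , le)))))))
      classify {x} x<n (no ¬good) (no ¬lt) (no m≰D) = inj₂ (inj₂ (inj₂ (x<n , modulus≤ℓ (≮⇒≥ ¬lt) , ∈-filter⁺ largeGCD?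
        (∈-oneTo⁺ (1≤modulus x) (modulus-≤ (c * ((suc L + 2) * (suc L + 2))) (≰⇒> (¬good ∘ inj₂))))
        (<-≤-trans (≰⇒> m≰D) (∣⇒≤ {{gcd≢0 (modulus x)}} (gcd-greatest ∣-refl m∣n))))))
        where
        m∣n : modulus x ∣ n
        m∣n = divides (gcd x n) (trans (sym (modulus*gcd x)) (*-comm (modulus x) (gcd x n)))

  family : Family (_< n) familyConstant
  family = choose (ℓ <? c * ((L + 3) * (L + 3)) * D)
    where
    choose : Dec (ℓ < c * ((L + 3) * (L + 3)) * D) → Family (_< n) familyConstant
    choose (yes short) = enlarge (Short.family short) (m≤m+n _ _)
    choose (no ¬short) = enlarge (Long.family (≮⇒≥ ¬short)) (m≤n+m _ (4 * k₂ + 3 + 2 ^ k₂))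

-- Covering lists for every ℓ, with all residues taken when ℓ ≤ 512 L

opaque

  coveringConstant : ℕ
  coveringConstant = 512 + familyConstant

  512≤coveringConstant : 512 ≤ coveringConstant
  512≤coveringConstant = m≤m+n 512 familyConstant

  familyConstant≤ : familyConstant ≤ coveringConstant
  familyConstant≤ = m≤n+m familyConstant 512

coveringList : ∀ n ℓ L .{{_ : NonZero n}} → 2 ≤ n → 1 ≤ ℓ → ℓ < n → 2 ^ L ≤ n → n < 2 ^ suc L →
  ∃[ bs ] ((∀ {x} → x < n → Covering.CoveredBy n ℓ bs x) × ℓ * length bs ≤ coveringConstant * (n * L))
coveringList n ℓ zero 2≤n _ _ _ n<2 = contradiction (<-≤-trans n<2 2≤n) (<-irrefl refl)
coveringList n ℓ L@(suc _) 2≤n 1≤ℓ ℓ<n 2^L≤n n<2^L⁺ with 512 * L <? ℓ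
... | yes 512L<ℓ = large (2^-floor ℓ {{>-nonZero 1≤ℓ}})
  where
  large : ∃[ l ] (2 ^ l ≤ ℓ × ℓ < 2 ^ suc l) →
    ∃[ bs ] ((∀ {x} → x < n → Covering.CoveredBy n ℓ bs x) × ℓ * length bs ≤ coveringConstant * (n * L))
  large (l , lo , hi) = members , cover , ≤-trans size (*-monoˡ-≤ (n * L) familyConstant≤)
    where
    open Assembly n ℓ L l 1≤ℓ ℓ<n 2^L≤n n<2^L⁺ lo hi 512L<ℓ using (family; module Family)
    open Family family
... | no ℓ≤512L = downFrom n , trivial , (begin
    ℓ * length (downFrom n)      ≡⟨ cong (ℓ *_) (length-downFrom n) ⟩
    ℓ * n                        ≤⟨ *-monoˡ-≤ n (≮⇒≥ ℓ≤512L) ⟩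
    512 * L * n                  ≡⟨ trans (*-assoc 512 L n) (cong (512 *_) (*-comm L n)) ⟩
    512 * (n * L)                ≤⟨ *-monoˡ-≤ (n * L) 512≤coveringConstant ⟩
    coveringConstant * (n * L)   ∎)
  where
  open ≤-Reasoning
  trivial : ∀ {x} → x < n → Covering.CoveredBy n ℓ (downFrom n) x
  trivial {x} x<n = Any.map (λ { refl → 1 , s≤s 1≤ℓ , trans (cong (DM._% n) (*-identityˡ x)) (DM.m<n⇒m%n≡m x<n) })
    (∈-downFrom⁺ x<n)

-- From lists of residues to subsets

∣p∪q∣≤∣p∣+∣q∣ : ∀ {n} (p q : Subset n) → Subset.∣ p Subset.∪ q ∣ ≤ Subset.∣ p ∣ + Subset.∣ q ∣
∣p∪q∣≤∣p∣+∣q∣ []             []             = z≤n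
∣p∪q∣≤∣p∣+∣q∣ (outside ∷ p) (outside ∷ q) = ∣p∪q∣≤∣p∣+∣q∣ p q
∣p∪q∣≤∣p∣+∣q∣ (outside ∷ p) (inside  ∷ q) =
  ≤-trans (s≤s (∣p∪q∣≤∣p∣+∣q∣ p q)) (≤-reflexive (sym (+-suc Subset.∣ p ∣ Subset.∣ q ∣)))
∣p∪q∣≤∣p∣+∣q∣ (inside  ∷ p) (outside ∷ q) = s≤s (∣p∪q∣≤∣p∣+∣q∣ p q)
∣p∪q∣≤∣p∣+∣q∣ (inside  ∷ p) (inside  ∷ q) =
  s≤s (≤-trans (∣p∪q∣≤∣p∣+∣q∣ p q) (+-monoʳ-≤ Subset.∣ p ∣ (n≤1+n _)))

module _ (n : ℕ) .{{n≢0 : NonZero n}} where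

  residues : List ℕ → Subset n
  residues []       = Subset.⊥
  residues (b ∷ bs) = Subset.⁅ b DM.mod n ⁆ Subset.∪ residues bs

  ∣residues∣≤ : ∀ bs → Subset.∣ residues bs ∣ ≤ length bs
  ∣residues∣≤ []       = ≤-reflexive (Subsetₚ.∣⊥∣≡0 n)
  ∣residues∣≤ (b ∷ bs) = ≤-trans (∣p∪q∣≤∣p∣+∣q∣ Subset.⁅ b DM.mod n ⁆ (residues bs))
    (+-mono-≤ (≤-reflexive (Subsetₚ.∣⁅x⁆∣≡1 (b DM.mod n))) (∣residues∣≤ bs))

  toℕ-mod : ∀ a → toℕ (a DM.mod n) ≡ a DM.% n
  toℕ-mod a = toℕ-fromℕ< (DM.m%n<n a n)

  residues-isCovering : ∀ ℓ bs → (∀ {x} → x < n → Covering.CoveredBy n ℓ bs x) → IsCovering n ℓ (residues bs)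
  residues-isCovering ℓ bs cover x = go bs (cover (toℕ<n x))
    where
    go : ∀ bs → Covering.CoveredBy n ℓ bs (toℕ x) →
         ∃[ a ] (a ≤ ℓ × (∃[ b ] (b Subset.∈ residues bs × (a * toℕ b) DM.mod n ≡ x)))
    go (b ∷ bs) (here (a , s≤s a≤ℓ , eq)) = a , a≤ℓ , b DM.mod n ,
      Subsetₚ.x∈p∪q⁺ (inj₁ (Subsetₚ.x∈⁅x⁆ (b DM.mod n))) ,
      toℕ-injective (trans (toℕ-mod _) (trans
        (congruent⇒%≡ (congruent-*ˡ a (subst (λ t → Congruent n t b) (sym (toℕ-mod b)) (congruent-sym (congruent-% b))))) eq))
    go (b ∷ bs) (there any) with go bs any
    ... | a , a≤ℓ , b′ , b′∈ , eq = a , a≤ℓ , b′ , Subsetₚ.x∈p∪q⁺ (inj₂ b′∈) , eq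

-- Comparison with the real logarithm

fraction-* : ∀ a b c d → (ℤ.+ a ℚ./ suc b) ℚ.* (ℤ.+ c ℚ./ suc d) ≡ ℤ.+ (a * c) ℚ./ (suc b * suc d)
fraction-* a b c d = ℚₚ.toℚᵘ-injective (begin-equality
  ℚ.toℚᵘ ((ℤ.+ a ℚ./ suc b) ℚ.* (ℤ.+ c ℚ./ suc d))             ≃⟨ ℚₚ.toℚᵘ-homo-* (ℤ.+ a ℚ./ suc b) (ℤ.+ c ℚ./ suc d) ⟩
  ℚ.toℚᵘ (ℤ.+ a ℚ./ suc b) ℚᵘ.* ℚ.toℚᵘ (ℤ.+ c ℚ./ suc d)       ≃⟨ ℚᵘₚ.*-cong (ℚₚ.toℚᵘ-fromℚᵘ (ℚᵘ.mkℚᵘ (ℤ.+ a) b)) (ℚₚ.toℚᵘ-fromℚᵘ (ℚᵘ.mkℚᵘ (ℤ.+ c) d)) ⟩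
  ℚᵘ.mkℚᵘ (ℤ.+ a) b ℚᵘ.* ℚᵘ.mkℚᵘ (ℤ.+ c) d                      ≃⟨ ℚᵘ.*≡* (cong (ℤ._* ℤ.+ (suc b * suc d)) (sym (ℤₚ.pos-* a c))) ⟩
  ℚᵘ.mkℚᵘ (ℤ.+ (a * c)) (d + b * suc d)                       ≃⟨ ℚₚ.toℚᵘ-fromℚᵘ (ℚᵘ.mkℚᵘ (ℤ.+ (a * c)) (d + b * suc d)) ⟨
  ℚ.toℚᵘ (ℤ.+ (a * c) ℚ./ (suc b * suc d))                    ∎)
  where open ℚᵘₚ.≤-Reasoning

0≤fraction : ∀ m d → 0ℚ ℚ.≤ ℤ.+ m ℚ./ suc d
0≤fraction m d = Defs./-mono-≤ 0 0 m d z≤n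

reciprocalSum-mono : ∀ a {m m′} → m ≤ m′ → reciprocalSum a m ℚ.≤ reciprocalSum a m′
reciprocalSum-mono a {m} {m′} m≤m′ = begin
  reciprocalSum a m                                        ≡⟨ ℚₚ.+-identityʳ _ ⟨
  reciprocalSum a m ℚ.+ 0ℚ                                 ≤⟨ ℚₚ.+-monoʳ-≤ (reciprocalSum a m) (ℚₚ.≤-trans (0≤fraction k d) (reciprocalSum-≥ (a + m) k d (n≤1+n d))) ⟩
  reciprocalSum a m ℚ.+ reciprocalSum (a + m) k            ≡⟨ reciprocalSum-++ a m k ⟨
  reciprocalSum a (m + k)                                  ≡⟨ cong (reciprocalSum a) (m+[n∸m]≡n m≤m′) ⟩
  reciprocalSum a m′                                       ∎
  where
  open ℚₚ.≤-Reasoning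
  k = m′ ∸ m
  d = a + m + k

-- Each of the L blocks (2^l a, 2^(l+1) a] contributes at least 1/2.
reciprocalSum-dyadic : ∀ L M a → suc M ≡ 2 ^ L → ℤ.+ L ℚ./ 2 ℚ.≤ reciprocalSum (suc a) (M * suc a)
reciprocalSum-dyadic zero    zero    a eq = 0≤fraction 0 0
reciprocalSum-dyadic zero    (suc M) a ()
reciprocalSum-dyadic (suc L) M′      a eq = begin
  ℤ.+ suc L ℚ./ 2                                                        ≡⟨ /-suc L 1 ⟨
  ℤ.+ 1 ℚ./ 2 ℚ.+ ℤ.+ L ℚ./ 2                                              ≡⟨ ℚₚ.+-comm (ℤ.+ 1 ℚ./ 2) (ℤ.+ L ℚ./ 2) ⟩
  ℤ.+ L ℚ./ 2 ℚ.+ ℤ.+ 1 ℚ./ 2                                              ≤⟨ ℚₚ.+-mono-≤ (reciprocalSum-dyadic L M a M-eq) block ⟩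
  reciprocalSum (suc a) (M * suc a) ℚ.+ reciprocalSum A A              ≡⟨ reciprocalSum-++ (suc a) (M * suc a) A ⟨
  reciprocalSum (suc a) (M * suc a + A)                                ≡⟨ cong (reciprocalSum (suc a)) length-eq ⟩
  reciprocalSum (suc a) (M′ * suc a)                                   ∎
  where
  open ℚₚ.≤-Reasoning
  M = pred (2 ^ L)
  A = suc M * suc a
  M-eq : suc M ≡ 2 ^ L
  M-eq = suc-pred (2 ^ L) {{m^n≢0 2 L}}
  M′-eq : M′ ≡ M + suc M
  M′-eq = suc-injective (trans eq (trans (cong (2 *_) (sym M-eq)) (cong (suc M +_) (+-identityʳ (suc M)))))
  length-eq : M * suc a + A ≡ M′ * suc a
  length-eq = trans (sym (*-distribʳ-+ (suc a) M (suc M))) (cong (_* suc a) (sym M′-eq))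
  e : ∀ A → 1 * (A + A) ≡ A * 2
  e = solve-∀
  block : ℤ.+ 1 ℚ./ 2 ℚ.≤ reciprocalSum A A
  block = ℚₚ.≤-trans (Defs./-mono-≤ 1 1 A (pred A + A) (≤-reflexive (e A))) (reciprocalSum-≥ A A (pred A + A) ≤-refl)

lnRiemannSum-≥ : ∀ n L i → 2 ^ L ≤ n → ℤ.+ L ℚ./ 2 ℚ.≤ lnRiemannSum n i
lnRiemannSum-≥ n L i 2^L≤n = ℚₚ.≤-trans
  (reciprocalSum-dyadic L (pred (2 ^ L)) i (suc-pred (2 ^ L) {{m^n≢0 2 L}}))
  (reciprocalSum-mono (suc i) (*-monoˡ-≤ (suc i) (pred-mono-≤ 2^L≤n)))

-- Every approximant of ln n is at least L/2, and the factor 2 in `2 * K` makes up for the half. The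
-- bound thus holds term by term along the Cauchy sequence.
size-bound : ∀ K k n ℓ L i → 2 ^ L ≤ n → suc ℓ * k ≤ K * (n * L) →
  ℤ.+ k ℚ./ 1 ℚ.≤ (ℤ.+ (2 * K) ℚ./ 1) ℚ.* (((ℤ.+ n ℚ./ 1) ℚ.* (lnRiemannSum n i ℚ.⊔ 1ℚ)) ℚ.* (ℤ.+ 1 ℚ./ suc ℓ))
size-bound K k n ℓ L i 2^L≤n bound = begin
  ℤ.+ k ℚ./ 1
    ≤⟨ Defs./-mono-≤ k 0 (2 * K * (n * L * 1)) (ℓ + 1 * suc ℓ + 0) (≤-trans (≤-reflexive (e₁ k ℓ)) (≤-trans (*-monoʳ-≤ 2 bound) (≤-reflexive (e₂ K n L)))) ⟩
  ℤ.+ (2 * K * (n * L * 1)) ℚ./ (1 * (1 * 2 * suc ℓ))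
    ≡⟨ trans (cong ((ℤ.+ (2 * K) ℚ./ 1) ℚ.*_) (trans (cong (ℚ._* (ℤ.+ 1 ℚ./ suc ℓ)) (fraction-* n 0 L 1)) (fraction-* (n * L) 1 1 ℓ)))
             (fraction-* (2 * K) 0 (n * L * 1) (ℓ + 1 * suc ℓ)) ⟨
  (ℤ.+ (2 * K) ℚ./ 1) ℚ.* (((ℤ.+ n ℚ./ 1) ℚ.* (ℤ.+ L ℚ./ 2)) ℚ.* (ℤ.+ 1 ℚ./ suc ℓ))
    ≤⟨ Defs.*-mono-≤ (0≤fraction (2 * K) 0) ℚₚ.≤-refl (ℚₚ.≤-trans (0≤fraction (n * L * 1) (ℓ + 1 * suc ℓ))
         (ℚₚ.≤-reflexive (sym (trans (cong (ℚ._* (ℤ.+ 1 ℚ./ suc ℓ)) (fraction-* n 0 L 1)) (fraction-* (n * L) 1 1 ℓ)))))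
         (Defs.*-mono-≤ (ℚₚ.≤-trans (0≤fraction (n * L) 1) (ℚₚ.≤-reflexive (sym (fraction-* n 0 L 1))))
           (Defs.*-mono-≤ (0≤fraction n 0) ℚₚ.≤-refl (0≤fraction L 1)
             (ℚₚ.≤-trans (lnRiemannSum-≥ n L i 2^L≤n) (ℚₚ.p≤p⊔q (lnRiemannSum n i) 1ℚ)))
           (0≤fraction 1 ℓ) ℚₚ.≤-refl) ⟩
  (ℤ.+ (2 * K) ℚ./ 1) ℚ.* (((ℤ.+ n ℚ./ 1) ℚ.* (lnRiemannSum n i ℚ.⊔ 1ℚ)) ℚ.* (ℤ.+ 1 ℚ./ suc ℓ))  ∎
  where
  open ℚₚ.≤-Reasoning
  e₁ : ∀ k ℓ → k * suc (ℓ + 1 * suc ℓ + 0) ≡ 2 * (suc ℓ * k)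
  e₁ = solve-∀
  e₂ : ∀ K n L → 2 * (K * (n * L)) ≡ 2 * K * (n * L * 1) * 1
  e₂ = solve-∀

real-bound : ∀ K k n ℓ L .{{_ : NonZero n}} .{{_ : NonZero ℓ}} → 2 ^ L ≤ n → ℓ * k ≤ K * (n * L) →
  fromℕ k ≤ᴿ fromℕ (2 * K) *ᴿ ((fromℕ n *ᴿ log n) /ᴿ ℓ)
real-bound K k (suc p) (suc ℓ) L 2^L≤n bound ε 0<ε = 0 , λ i _ →
  relax (size-bound K k (suc p) ℓ L i 2^L≤n bound)
  where
  relax : ∀ {u v} → u ℚ.≤ v → u ℚ.≤ v ℚ.+ ε
  relax {u} {v} u≤v = subst (ℚ._≤ v ℚ.+ ε) (ℚₚ.+-identityʳ u) (ℚₚ.+-mono-≤ u≤v (ℚₚ.<⇒≤ 0<ε))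

open import Data.Fin.Subset using (∣_∣)

mainTheorem11 : ∃[ C ] (0ᴿ <ᴿ C ×
    (∀ (n ℓ : ℕ) .{{_ : NonZero n}} .{{_ : NonZero ℓ}} →
    2 ≤ n → 1 ≤ ℓ → ℓ < n →
    (∃[ B ] (IsCovering n ℓ B ×
    fromℕ ∣ B ∣ ≤ᴿ C *ᴿ ((fromℕ n *ᴿ log n) /ᴿ ℓ)))
    × fromℕ (f n ℓ) ≤ᴿ C *ᴿ ((fromℕ n *ᴿ log n) /ᴿ ℓ)))
mainTheorem11 = fromℕ (2 * coveringConstant) , constant-positive coveringConstant 1≤coveringConstant ,
  λ n ℓ 2≤n 1≤ℓ ℓ<n → bounded n ℓ 2≤n 1≤ℓ ℓ<n (2^-floor n)
  where
  constant-positive : ∀ K → 1 ≤ K → 0ᴿ <ᴿ fromℕ (2 * K)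
  constant-positive K 1≤K = 1ℚ , ℚₚ.positive⁻¹ 1ℚ , 0 ,
    λ _ _ → Defs./-mono-≤ 1 0 (2 * K) 0 (*-monoˡ-≤ 1 (≤-trans 1≤K (m≤n*m K 2)))
  1≤coveringConstant : 1 ≤ coveringConstant
  1≤coveringConstant = ≤-trans (s≤s z≤n) 512≤coveringConstant
  Bounded : (n ℓ : ℕ) .{{_ : NonZero n}} .{{_ : NonZero ℓ}} → Set
  Bounded n ℓ =
    (∃[ B ] (IsCovering n ℓ B × fromℕ ∣ B ∣ ≤ᴿ fromℕ (2 * coveringConstant) *ᴿ ((fromℕ n *ᴿ log n) /ᴿ ℓ)))
    × fromℕ (f n ℓ) ≤ᴿ fromℕ (2 * coveringConstant) *ᴿ ((fromℕ n *ᴿ log n) /ᴿ ℓ)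
  finish : ∀ n ℓ L .{{_ : NonZero n}} .{{_ : NonZero ℓ}} → 2 ^ L ≤ n →
    (B : Subset n) → IsCovering n ℓ B → ℓ * ∣ B ∣ ≤ coveringConstant * (n * L) → Bounded n ℓ
  finish n ℓ L 2^L≤n B covering small =
    (B , covering , real-bound coveringConstant ∣ B ∣ n ℓ L 2^L≤n small) ,
    real-bound coveringConstant (f n ℓ) n ℓ L 2^L≤n
      (≤-trans (*-monoʳ-≤ ℓ (proj₂ (f-isMinimum n ℓ) ∣ B ∣ (B , covering , refl))) small)
  bounded : ∀ n ℓ .{{_ : NonZero n}} .{{_ : NonZero ℓ}} → 2 ≤ n → 1 ≤ ℓ → ℓ < n →
    ∃[ L ] (2 ^ L ≤ n × n < 2 ^ suc L) → Bounded n ℓ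
  bounded n ℓ 2≤n 1≤ℓ ℓ<n (L , 2^L≤n , n<2^L⁺) = fromList (coveringList n ℓ L 2≤n 1≤ℓ ℓ<n 2^L≤n n<2^L⁺)
    where
    fromList : ∃[ bs ] ((∀ {x} → x < n → Covering.CoveredBy n ℓ bs x) × ℓ * length bs ≤ coveringConstant * (n * L)) →
               Bounded n ℓ
    fromList (bs , cover , size) = finish n ℓ L 2^L≤n (residues n bs) (residues-isCovering n ℓ bs cover)
      (≤-trans (*-monoʳ-≤ ℓ (∣residues∣≤ n bs)) size)
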